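{- The parameterized problem $k$-Rigid is $\mathsf{MINI[1]}$-hard, even when the input is restricted to graphs whose automorphism groups are elementary $2$-groups.
   Context: A colored graph $X=(V,E,c)$ is a finite graph $(V,E)$ with a vertex coloring $c$; an automorphism of $X$ is a permutation of $V$ preserving edges and colors. $k$-Rigid. Input: a colored graph $X=(V,E,c)$ and an integer $k$. Parameter: $k$. Question: is there a subset $S$ of $k$ vertices in $V$ such that there are no nontrivial automorphisms of $X$ that fix each vertex of $S$? Mini-3SAT. Input: a formula $F$ in 3-CNF of size bounded by $k\log n$, and the number $n$ in unary. Parameter: $k$. Question: is there a boolean assignment to the variables that satisfies $F$? $\mathsf{MINI[1]}$ is the class of all parameterized problems that are FPT (many-one) reducible to Mini-3SAT. A parameterized problem is $\mathsf{MINI[1]}$-hard if every problem in $\mathsf{MINI[1]}$ is FPT (many-one) reducible to it. An elementary $2$-group is a group isomorphic to $\mathbb{F}_2^m$ (additive) for some $m$. -}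

module Defs where

open import Algebra.Bundles using (Group; CommutativeRing)
import Algebra.Construct.Pointwise as Pointwise
open import Algebra.Morphism.Structures using (module GroupMorphisms)
open import Data.Bool.Base using (Bool; true; false)
open import Data.Bool.Properties using (xor-∧-commutativeRing)
open import Data.Fin.Base using (Fin; toℕ)
open import Data.Fin.Permutation using (Permutation′; _⟨$⟩ʳ_; _⟨$⟩ˡ_; _∘ₚ_; flip; inverseˡ; inverseʳ)
import Data.Fin.Permutation as Perm
open import Data.Fin.Subset using (Subset; _∈_; ∣_∣)
open import Data.List.Base using (List; []; _∷_; length; allFin)
open import Data.List.Relation.Unary.All using (All)
open import Data.Nat.Base using (ℕ; zero; suc; _+_; _*_; _^_; _≤_; _<_)
open import Data.Product.Base using (Σ; ∃; _×_; _,_; proj₁; proj₂)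
open import Data.Vec.Base using (Vec; toList)
import Data.Vec.Relation.Unary.Any as VecAny
open import Function.Bundles using (_⇔_)
open import Level using (0ℓ)
open import Relation.Binary.PropositionalEquality using (_≡_; refl; sym; trans; cong; cong₂)

------------------------------------------------------------------------
-- Machine model
--
-- Data are binary trees (S-expressions over the single atom nil).  A tree
-- of size s is a word of length s over the alphabet {nil, •} in prefix
-- notation, and words over any finite alphabet are trees of linearly
-- larger size, so subsets of Tree play the part of languages.

infixr 5 _•_

data Tree : Set where
  nil : Tree
  _•_ : Tree → Tree → Tree

size : Tree → ℕ
size nil     = 1
size (x • y) = 1 + size x + size y

-- The while-language over trees, in point-free form: a program acts on
-- one tree, its store.

infixr 4 _⨾_

data Program : Set where
  skip ⟪nil⟫ hd tl : Program
  _⨾_              : Program → Program → Program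
  ⟪_•_⟫            : Program → Program → Program
  if_then_else_    : Program → Program → Program → Program
  while_loop_      : Program → Program → Program

-- p ⊢ x ⇓ y ∶ t  says that p, started on x, halts with y in time t.
-- Every elementary step is charged the size of the tree it inspects or
-- copies.  In particular an output is never larger than the time spent, and
-- this model and multitape Turing machines simulate each other with
-- polynomial overhead.  Tests take nil as false and every other tree as true.

infix 3 _⊢_⇓_∶_

data _⊢_⇓_∶_ : Program → Tree → Tree → ℕ → Set where
  skip : ∀ {x} → skip ⊢ x ⇓ x ∶ size x
  ⟪nil⟫ : ∀ {x} → ⟪nil⟫ ⊢ x ⇓ nil ∶ size x
  hd-nil : hd ⊢ nil ⇓ nil ∶ size nil
  hd-• : ∀ {x y} → hd ⊢ x • y ⇓ x ∶ size (x • y)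
  tl-nil : tl ⊢ nil ⇓ nil ∶ size nil
  tl-• : ∀ {x y} → tl ⊢ x • y ⇓ y ∶ size (x • y)
  seq : ∀ {p q x y z s t} →
        p ⊢ x ⇓ y ∶ s → q ⊢ y ⇓ z ∶ t →
        (p ⨾ q) ⊢ x ⇓ z ∶ s + t
  pair : ∀ {p q x y z s t} →
         p ⊢ x ⇓ y ∶ s → q ⊢ x ⇓ z ∶ t →
         ⟪ p • q ⟫ ⊢ x ⇓ y • z ∶ size x + s + t
  if-true : ∀ {b p q x u v y s t} →
            b ⊢ x ⇓ u • v ∶ s → p ⊢ x ⇓ y ∶ t →
            (if b then p else q) ⊢ x ⇓ y ∶ size x + s + t
  if-false : ∀ {b p q x y s t} →
             b ⊢ x ⇓ nil ∶ s → q ⊢ x ⇓ y ∶ t →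
             (if b then p else q) ⊢ x ⇓ y ∶ size x + s + t
  while-true : ∀ {b p x u v y z s t r} →
               b ⊢ x ⇓ u • v ∶ s → p ⊢ x ⇓ y ∶ t →
               (while b loop p) ⊢ y ⇓ z ∶ r →
               (while b loop p) ⊢ x ⇓ z ∶ size x + s + t + r
  while-false : ∀ {b p x s} →
                b ⊢ x ⇓ nil ∶ s →
                (while b loop p) ⊢ x ⇓ x ∶ size x + s

encodeBool : Bool → Tree
encodeBool false = nil
encodeBool true  = nil • nil

-- Unary.
encodeℕ : ℕ → Tree
encodeℕ zero    = nil
encodeℕ (suc n) = nil • encodeℕ n

encodeList : ∀ {A : Set} → (A → Tree) → List A → Tree
encodeList f []       = nil
encodeList f (x ∷ xs) = f x • encodeList f xs

Computable : (ℕ → ℕ) → Set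
Computable f = Σ Program λ p → ∀ n → ∃ λ t → p ⊢ encodeℕ n ⇓ encodeℕ (f n) ∶ t

------------------------------------------------------------------------
-- Parameterized problems

-- Instance is the set of legal inputs, i.e. what a problem description
-- announces under "Input"; a subset L of Tree × ℕ is the case in which
-- Instance is Tree × ℕ, code is proj₁ and parameter is proj₂.
record ParameterizedProblem : Set₁ where
  field
    Instance  : Set
    code      : Instance → Tree
    parameter : Instance → ℕ
    Yes       : Instance → Set

  input : Instance → Tree
  input x = code x • encodeℕ (parameter x)

  ∥_∥ : Instance → ℕ
  ∥ x ∥ = size (code x)

-- The same question, asked only for the instances in C.
_restrictedTo_ : (P : ParameterizedProblem) →
                 (ParameterizedProblem.Instance P → Set) →
                 ParameterizedProblem
P restrictedTo C = record
  { Instance  = Σ Instance C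
  ; code      = λ x → code (proj₁ x)
  ; parameter = λ x → parameter (proj₁ x)
  ; Yes       = λ x → Yes (proj₁ x)
  } where open ParameterizedProblem P

-- FPT many-one reductions: computable in time f(k)·|x|^c, with the new
-- parameter bounded by g(k), where f and g are computable.  (|x| ≥ 1.)
infix 4 _≤fpt_

record _≤fpt_ (P Q : ParameterizedProblem) : Set where
  private
    module P = ParameterizedProblem P
    module Q = ParameterizedProblem Q
  field
    reduce          : P.Instance → Q.Instance
    correct         : ∀ x → P.Yes x ⇔ Q.Yes (reduce x)
    program         : Program
    f g             : ℕ → ℕ
    c               : ℕ
    f-computable    : Computable f
    g-computable    : Computable g
    computes        : ∀ x → ∃ λ t →
                      (program ⊢ P.input x ⇓ Q.input (reduce x) ∶ t) ×
                      t ≤ f (P.parameter x) * P.∥ x ∥ ^ c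
    parameter-bound : ∀ x → Q.parameter (reduce x) ≤ g (P.parameter x)

------------------------------------------------------------------------
-- Mini-3SAT

-- A literal is a variable with a sign: (true , i) is xᵢ, (false , i) is ¬ xᵢ.
Literal : ℕ → Set
Literal v = Bool × Fin v

-- A clause may repeat a literal, so shorter clauses can be padded.
Clause : ℕ → Set
Clause v = Vec (Literal v) 3

record 3CNF : Set where
  field
    vars    : ℕ
    clauses : List (Clause vars)

  Satisfiable : Set
  Satisfiable = Σ (Fin vars → Bool) λ α →
    All (VecAny.Any (λ ℓ → α (proj₂ ℓ) ≡ proj₁ ℓ)) clauses

  -- Number of variables plus number of literal occurrences.
  formulaSize : ℕ
  formulaSize = vars + 3 * length clauses

encodeLiteral : ∀ {v} → Literal v → Tree
encodeLiteral (b , i) = encodeBool b • encodeℕ (toℕ i)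

encodeClause : ∀ {v} → Clause v → Tree
encodeClause C = encodeList encodeLiteral (toList C)

encode3CNF : 3CNF → Tree
encode3CNF F = encodeℕ vars • encodeList encodeClause clauses
  where open 3CNF F

record Mini3SATInstance : Set where
  field
    formula  : 3CNF
    n        : ℕ
    k        : ℕ
    positive : 0 < n
    -- |F| ≤ k log₂ n for the real-valued logarithm, exponentiated.
    small    : 2 ^ 3CNF.formulaSize formula ≤ n ^ k

Mini-3SAT : ParameterizedProblem
Mini-3SAT = record
  { Instance  = Mini3SATInstance
  ; code      = λ x → encode3CNF (formula x) • encodeℕ (n x)
  ; parameter = k
  ; Yes       = λ x → 3CNF.Satisfiable (formula x)
  } where open Mini3SATInstance

MINI[1] : ParameterizedProblem → Set
MINI[1] P = P ≤fpt Mini-3SAT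

MINI[1]-Hard : ParameterizedProblem → Set₁
MINI[1]-Hard P = ∀ Q → MINI[1] Q → Q ≤fpt P

------------------------------------------------------------------------
-- Colored graphs and their automorphisms

record ColoredGraph : Set where
  field
    order    : ℕ
    adjacent : Fin order → Fin order → Bool
    color    : Fin order → ℕ
    adj-sym  : ∀ u v → adjacent u v ≡ adjacent v u
    loopless : ∀ v → adjacent v v ≡ false

-- The list of vertices, each given by its color and its row of the
-- adjacency matrix.
encodeGraph : ColoredGraph → Tree
encodeGraph X = encodeList
  (λ u → encodeℕ (color u) •
         encodeList (λ v → encodeBool (adjacent u v)) (allFin order))
  (allFin order)
  where open ColoredGraph X

record Automorphism (X : ColoredGraph) : Set where
  open ColoredGraph X
  field
    perm            : Permutation′ order
    preserves-edges : ∀ u v → adjacent (perm ⟨$⟩ʳ u) (perm ⟨$⟩ʳ v) ≡ adjacent u v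
    preserves-color : ∀ v → color (perm ⟨$⟩ʳ v) ≡ color v

Aut : ColoredGraph → Group 0ℓ 0ℓ
Aut X = record
  { Carrier = Automorphism X
  ; _≈_     = λ φ ψ → perm φ Perm.≈ perm ψ
  ; _∙_     = λ φ ψ → record
      { perm            = perm φ ∘ₚ perm ψ
      ; preserves-edges = λ u v → trans (preserves-edges ψ _ _) (preserves-edges φ u v)
      ; preserves-color = λ v → trans (preserves-color ψ _) (preserves-color φ v)
      }
  ; ε       = record
      { perm            = Perm.id
      ; preserves-edges = λ _ _ → refl
      ; preserves-color = λ _ → refl
      }
  ; _⁻¹     = λ φ → record
      { perm            = flip (perm φ)
      ; preserves-edges = λ u v → trans (sym (preserves-edges φ _ _))
                            (cong₂ adjacent (inverseʳ (perm φ)) (inverseʳ (perm φ)))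
      ; preserves-color = λ v → trans (sym (preserves-color φ _))
                            (cong color (inverseʳ (perm φ)))
      }
  ; isGroup = record
      { isMonoid = record
          { isSemigroup = record
              { isMagma = record
                  { isEquivalence = record
                      { refl  = λ _ → refl
                      ; sym   = λ φ≈ψ v → sym (φ≈ψ v)
                      ; trans = λ φ≈ψ ψ≈χ v → trans (φ≈ψ v) (ψ≈χ v)
                      }
                  ; ∙-cong = λ {_} {φ′} {ψ} φ≈φ′ ψ≈ψ′ v →
                      trans (cong (perm ψ ⟨$⟩ʳ_) (φ≈φ′ v)) (ψ≈ψ′ (perm φ′ ⟨$⟩ʳ v))
                  }
              ; assoc = λ _ _ _ _ → refl
              }
          ; identity = (λ _ _ → refl) , (λ _ _ → refl)
          }
      ; inverse = (λ φ _ → inverseʳ (perm φ)) , (λ φ _ → inverseˡ (perm φ))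
      ; ⁻¹-cong = λ {φ} {ψ} φ≈ψ v →
          trans (cong (perm φ ⟨$⟩ˡ_)
                  (trans (sym (inverseʳ (perm ψ))) (sym (φ≈ψ (perm ψ ⟨$⟩ˡ v)))))
                (inverseˡ (perm φ))
      }
  } where
  open ColoredGraph X
  open Automorphism

-- The additive group of 𝔽₂ᵐ.
𝔽₂^_ : ℕ → Group 0ℓ 0ℓ
𝔽₂^ m = Pointwise.group (Fin m) (CommutativeRing.+-group xor-∧-commutativeRing)

Elementary2Group : Group 0ℓ 0ℓ → Set
Elementary2Group G =
  ∃ λ m → ∃ (GroupMorphisms.IsGroupIsomorphism (rawGroup G) (rawGroup (𝔽₂^ m)))
  where open Group using (rawGroup)

------------------------------------------------------------------------
-- k-Rigid

Fixes : (X : ColoredGraph) → Automorphism X → Subset (ColoredGraph.order X) → Set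
Fixes X φ S = ∀ v → v ∈ S → Automorphism.perm φ ⟨$⟩ʳ v ≡ v

Rigid : ColoredGraph → ℕ → Set
Rigid X k = Σ (Subset order) λ S → ∣ S ∣ ≡ k × (∀ φ → Fixes X φ S → φ ≈ ε)
  where
  open ColoredGraph X
  open Group (Aut X) using (_≈_; ε)

k-Rigid : ParameterizedProblem
k-Rigid = record
  { Instance  = ColoredGraph × ℕ
  ; code      = λ (X , _) → encodeGraph X
  ; parameter = λ (_ , k) → k
  ; Yes       = λ (X , k) → Rigid X k
  }

{-# OPTIONS --safe #-}
module Submission where

-- Give every occurrence of a variable its own bit, and force the bits of one
-- variable to agree by a chain of implications; then each bit, by its value,
-- covers at most three "elements" (clauses and implications), and the formula is
-- satisfiable iff values can be chosen so that every element is covered.  Deal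
-- these bits, as many as the size of the formula, into k blocks of equal size up
-- to one: since 2 ^ size ≤ n ^ k, a block has at most 2 n value choices, each
-- covering O(log n) elements.  With one extra element per block that only the
-- choices for that block cover, satisfiability says that k of these sets cover
-- everything.
--
-- In the graph every element is a pair of vertices and every set U contributes
-- 2 ^ |U| vertices, the assignments U → {0,1}, each joined to the ends it
-- selects; every pair and every such family has its own colour.  An automorphism
-- amounts to the choice of the pairs to be swapped, so the group is 𝔽₂ᵐ, and
-- fixing an assignment to U forbids exactly the swaps of elements of U.

open import Algebra.Bundles using (Group)
open import Data.Bool.Base using (Bool; true; false; not; _∧_; _∨_; _xor_; T) renaming (if_then_else_ to cond)
open import Data.Bool.ListAction using (any; or)
import Data.Bool.Properties as Bool
open import Data.Empty using (⊥)
open import Data.Fin.Base using (Fin; zero; suc; toℕ; fromℕ<)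
open import Data.Fin.Permutation using (permutation; _⟨$⟩ʳ_; _⟨$⟩ˡ_; inverseˡ)
import Data.Fin.Properties as Fin
open import Data.Fin.Subset using (Subset; inside; outside; ∣_∣) renaming (_∈_ to _∈ˢ_; _∉_ to _∉ˢ_; ⊥ to ∅)
import Data.Fin.Subset.Properties as Subset
open import Data.List.Base using (List; []; _∷_; [_]; _++_; length; map; concat; replicate; foldl; foldr; reverse; lookup; allFin; tabulate; downFrom)
open import Data.List.Membership.Propositional using (_∈_; _∉_)
open import Data.List.Membership.Propositional.Properties
import Data.List.Properties as List
open import Data.List.Relation.Binary.Permutation.Propositional using (_↭_; ↭-sym)
import Data.List.Relation.Binary.Permutation.Propositional as ↭
open import Data.List.Relation.Binary.Permutation.Propositional.Properties using (↭-length; ++-comm; ∈-resp-↭)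
open import Data.List.Relation.Binary.Pointwise using (Pointwise; []; _∷_)
import Data.List.Relation.Binary.Pointwise as Pointwise
open import Data.List.Relation.Unary.All using (All; []; _∷_)
import Data.List.Relation.Unary.All as All
import Data.List.Relation.Unary.All.Properties as All
open import Data.List.Relation.Unary.AllPairs using (AllPairs; []; _∷_)
import Data.List.Relation.Unary.AllPairs.Properties as AllPairs
open import Data.List.Relation.Unary.Any using (Any; here; there)
import Data.List.Relation.Unary.Any as Any
import Data.List.Relation.Unary.Any.Properties as Any
open import Data.List.Relation.Unary.Unique.Propositional using (Unique)
import Data.List.Relation.Unary.Unique.Propositional.Properties as Unique
open import Data.Nat.Base
open import Data.Nat.Properties
open import Data.Nat.Tactic.RingSolver using (solve-∀)
open import Data.Product.Base using (∃; ∃₂; _×_; _,_; proj₁; proj₂)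
open import Data.Product.Properties using (,-injectiveˡ; ,-injectiveʳ; ≡-dec)
open import Data.Sum.Base using (_⊎_; inj₁; inj₂)
import Data.Sum.Base as Sum
open import Data.Unit.Base using (⊤; tt)
open import Data.Vec.Base using (Vec; []; _∷_; here; there; toList; _[_]≔_)
import Data.Vec.Properties as Vec
import Data.Vec.Relation.Unary.Any as VecAny
open import Defs
open import Function.Base using (id; _∘_; case_of_)
open import Function.Bundles using (_⇔_; mk⇔; Equivalence)
open import Relation.Binary.Definitions using (DecidableEquality)
open import Relation.Binary.PropositionalEquality hiding (resp; [_])
open import Relation.Nullary using (yes; no; contradiction; does)
open import Relation.Nullary.Decidable using (_×-dec_)

-- A set `U` costs `2 ^ |U|` vertices, while only `2 ^ size ≤ n ^ k` is known. Sets of size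
-- `O(log n)` are therefore affordable, but a set comparable to the whole formula would cost about
-- `n ^ k`, beyond any polynomial of degree independent of `k`. The variables of a small block may
-- occur in that many clauses; this is why occurrences are dealt out as bits of their own, and the
-- chains of implications are the price. Without the extra elements two sets of the same block could
-- be taken, which gives some bit both values. Reaching `k` extra elements with `k` vertices, none
-- of which reaches two, uses every block exactly once. All assignments to `U` are present because a
-- lone vertex joined to one end of each pair would forbid the swaps from the outset; the full
-- family is closed under every swap, and only fixing a member of it has an effect. The exponential
-- listings are short on legal inputs only, so the calculus of polynomial-time programs carries a
-- promise on the input.

private
  variable
    X Y : Set

-- The data computed by the reduction

-- The function also sees the rest of the list, whose length serves throughout as the name of a
-- position.
gather : ∀ {a b} {A : Set a} {B : Set b} → (A → List A → List B) → List A → List B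
gather g []       = []
gather g (a ∷ as) = g a as ++ gather g as

choices : List (X × X) → List (List X)
choices []             = [ [] ]
choices ((p , q) ∷ ps) = map (p ∷_) (choices ps) ++ map (q ∷_) (choices ps)

dealTo : X → List (List X) → List (List X)
dealTo b []       = []
dealTo b (B ∷ Bs) = Bs ++ [ b ∷ B ]

deal : ℕ → List X → List (List X)
deal k = foldr dealTo (replicate k [])

-- The occurrence of xᵢ with r later ones has rank r, and the elements (0 , i , r)
-- and (1 , i , r) compare its value with that of the occurrence of rank r + 1, or
-- of xᵢ itself if there is none.  (2 , c , 0) stands for the clause followed by c
-- others, (3 , j , 0) for the block followed by j others.  A bit consists of the
-- elements covered by its value false and by its value true.
Elem Bit Lit Occ Class Vertex : Set
Elem   = ℕ × ℕ × ℕ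
Bit    = List Elem × List Elem
Lit    = Bool × ℕ
Occ    = ℕ × Lit
Class  = Bool × List Elem
Vertex = ℕ × Bool × List (Elem × Bool)

_≡ᴱ_ : Elem → Elem → Bool
(a , b , c) ≡ᴱ (a′ , b′ , c′) = (a ≡ᵇ a′) ∧ ((b ≡ᵇ b′) ∧ (c ≡ᵇ c′))

_≡ᴮ_ : Bool → Bool → Bool
b ≡ᴮ c = cond b c (not c)

_∈ᵇ_ : Elem → List Elem → Bool
e ∈ᵇ es = any (e ≡ᴱ_) es

nub : List Elem → List Elem
nub = gather (λ e es → cond (e ∈ᵇ es) [] [ e ])

occs : List (List Lit) → List Occ
occs = gather (λ C Cs → map (length Cs ,_) C)

variable-of : Occ → ℕ
variable-of (_ , _ , i) = i

count : ℕ → List Occ → ℕ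
count i os = length (gather (λ o _ → cond (i ≡ᵇ variable-of o) [ tt ] []) os)

tag : Bool → ℕ
tag b = cond b 1 0

upper : ℕ → ℕ → Bool → List Elem
upper i zero    b = []
upper i (suc r) b = [ (tag b , i , r) ]

-- Let `b` be the value at rank `r` and `b′` that at rank `r + 1`. Then `(0 , i , r)` is covered iff
-- `b′` implies `b`, and `(1 , i , r)` iff `b` implies `b′`; with both covered, the two values
-- agree.
cover : Occ → ℕ → Bool → List Elem
cover (c , s , i) r b =
  (tag (not b) , i , r) ∷ upper i r b ++ cond (b ≡ᴮ s) [ (2 , c , 0) ] []

occBits : List Occ → List Bit
occBits = gather λ o os →
  let r = count (variable-of o) os in [ (cover o r false , cover o r true) ]

varBits : ℕ → List Occ → List Bit
varBits v os = map (λ i → upper i (count i os) false , upper i (count i os) true) (downFrom v)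

bits : ℕ → List (List Lit) → List Bit
bits v Cs = varBits v (occs Cs) ++ occBits (occs Cs)

family : List (List Bit) → List (List Elem)
family = gather (λ B Bs → map (λ ls → (3 , length Bs , 0) ∷ concat ls) (choices B))

elements : List (List Elem) → List Elem
elements F = nub (concat F)

-- Two neighbouring occurrences dealt to one block may cover the same element, whereas an assignment
-- must give each element a single value; hence `nub`.
classes : List (List Elem) → List Class
classes F = map (λ e → true , [ e ]) (elements F) ++ map (λ U → false , nub U) F

assignments : List Elem → List (List (Elem × Bool))
assignments U = choices (map (λ e → (e , false) , (e , true)) U)

vertices : List Class → List Vertex
vertices = gather (λ c cs → map (λ x → length cs , proj₁ c , x) (assignments (proj₂ c)))

_≡ᴬ_ : Elem × Bool → Elem × Bool → Bool
(e , b) ≡ᴬ (e′ , b′) = (e ≡ᴱ e′) ∧ (b ≡ᴮ b′)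

meets : Vertex → Vertex → Bool
meets (_ , f , x) (_ , g , y) = f ∧ (not g ∧ any (λ a → any (a ≡ᴬ_) y) x)

adj : Vertex → Vertex → Bool
adj u v = meets u v ∨ meets v u

rows : List Vertex → List (ℕ × List Bool)
rows vs = map (λ u → proj₁ u , map (adj u) vs) vs

-- Positions in lists

-- Membership that remembers what follows. Equal entries at different positions stay apart, since
-- the lengths of their remainders differ.
data Tail (a : X) (as : List X) : List X → Set where
  here  : Tail a as (a ∷ as)
  there : ∀ {b bs} → Tail a as bs → Tail a as (b ∷ bs)

Tail⇒∈ : ∀ {a : X} {as xs} → Tail a as xs → a ∈ xs
Tail⇒∈ here      = here refl
Tail⇒∈ (there t) = there (Tail⇒∈ t)

∈⇒Tail : ∀ {a : X} {xs} → a ∈ xs → ∃ λ as → Tail a as xs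
∈⇒Tail (here refl) = _ , here
∈⇒Tail (there a∈)    = let as , t = ∈⇒Tail a∈ in as , there t

Tail-length : ∀ {a : X} {as xs} → Tail a as xs → length as < length xs
Tail-length here      = ≤-refl
Tail-length (there t) = m≤n⇒m≤1+n (Tail-length t)

Tail-unique : ∀ {a b : X} {as bs xs} → Tail a as xs → Tail b bs xs →
              length as ≡ length bs → a ≡ b × as ≡ bs
Tail-unique here      here      _  = refl , refl
Tail-unique here      (there t) eq = contradiction (sym eq) (<⇒≢ (Tail-length t))
Tail-unique (there t) here      eq = contradiction eq (<⇒≢ (Tail-length t))
Tail-unique (there t) (there u) eq = Tail-unique t u eq

Tail-exists : ∀ (xs : List X) {j} → j < length xs → ∃₂ λ a as → Tail a as xs × length as ≡ j
Tail-exists (x ∷ xs) {j} j< with m≤n⇒m<n∨m≡n (≤-pred j<)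
... | inj₂ j≡  = x , xs , here , sym j≡
... | inj₁ j<′ = let a , as , t , eq = Tail-exists xs j<′ in a , as , there t , eq

∈-gather⁻ : ∀ {g : X → List X → List Y} xs {y} → y ∈ gather g xs →
            ∃₂ λ a as → Tail a as xs × y ∈ g a as
∈-gather⁻ {g = g} (x ∷ xs) y∈ with ∈-++⁻ (g x xs) y∈
... | inj₁ y∈g = x , xs , here , y∈g
... | inj₂ y∈r = let a , as , t , y∈g = ∈-gather⁻ xs y∈r in a , as , there t , y∈g

∈-gather⁺ : ∀ {g : X → List X → List Y} {a as xs y} → Tail a as xs → y ∈ g a as → y ∈ gather g xs
∈-gather⁺                  here                        y∈ = ∈-++⁺ˡ y∈
∈-gather⁺ {g = g} (there {b} {bs} t) y∈ = ∈-++⁺ʳ (g b bs) (∈-gather⁺ t y∈)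

-- Dealing

length-deal : ∀ k (bs : List X) → length (deal k bs) ≡ k
length-deal k []       = List.length-replicate k
length-deal k (b ∷ bs) = trans (length-dealTo (deal k bs)) (length-deal k bs)
  where
  length-dealTo : ∀ Bs → length (dealTo b Bs) ≡ length Bs
  length-dealTo []       = refl
  length-dealTo (B ∷ Bs) = trans (List.length-++ Bs) (+-comm _ 1)

-- At least one block is asked for because `dealTo` drops its card when there is none.
concat-deal : ∀ k (bs : List X) → concat (deal (suc k) bs) ↭ bs
concat-deal k []       = subst (_↭ []) (sym (concat-empties k)) ↭.refl
  where
  concat-empties : ∀ k → concat (replicate k []) ≡ []
  concat-empties zero    = refl
  concat-empties (suc k) = concat-empties k
concat-deal k (b ∷ bs) =
  ↭.trans (concat-dealTo (deal (suc k) bs) (subst (0 <_) (sym (length-deal (suc k) bs)) (s≤s z≤n)))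
        (↭.prep b (concat-deal k bs))
  where
  concat-dealTo : ∀ Bs → 0 < length Bs → concat (dealTo b Bs) ↭ b ∷ concat Bs
  concat-dealTo (B ∷ Bs) _ = subst (_↭ b ∷ B ++ concat Bs)
    (trans (cong (concat Bs ++_) (sym (List.++-identityʳ (b ∷ B)))) (List.concat-++ Bs [ b ∷ B ]))
    (++-comm (concat Bs) (b ∷ B))

-- If block sizes grow along the list by at most one in total, then moving the
-- first block to the end with one more card keeps this so.
Balanced : List (List X) → Set
Balanced = AllPairs (λ B C → length B ≤ length C × length C ≤ suc (length B))

deal-balanced : ∀ k (bs : List X) → Balanced (deal k bs)
deal-balanced k [] = empties k
  where
  empties : ∀ k → Balanced (replicate k [])
  empties zero    = []
  empties (suc k) = All.replicate⁺ k (z≤n , z≤n) ∷ empties k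
deal-balanced k (b ∷ bs) = dealTo-balanced (deal k bs) (deal-balanced k bs)
  where
  dealTo-balanced : ∀ Bs → Balanced Bs → Balanced (dealTo b Bs)
  dealTo-balanced []       _         = []
  dealTo-balanced (B ∷ Bs) (B≤ ∷ bal) = AllPairs.++⁺ bal ([] ∷ [])
    (All.map (λ (B≤C , C≤) → (C≤ , s≤s B≤C) ∷ []) B≤)

-- By balance no block is shorter than `pred (length B)`; adding this up over all blocks gives the
-- bound.
deal-block-length : ∀ k (bs : List X) {B} → B ∈ deal k bs →
                    length (deal k bs) * pred (length B) ≤ length (concat (deal k bs))
deal-block-length k bs {B} B∈ = total (deal k bs) least
  where
  least : ∀ {C} → C ∈ deal k bs → pred (length B) ≤ length C
  least C∈ with ∈-AllPairs₂ (deal-balanced k bs) B∈ C∈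
  ... | inj₁ refl           = pred[n]≤n
  ... | inj₂ (inj₁ (B≤C , _)) = ≤-trans pred[n]≤n B≤C
  ... | inj₂ (inj₂ (_ , B≤))  = pred-mono-≤ B≤
  total : ∀ (Bs : List (List X)) {q} → (∀ {C} → C ∈ Bs → q ≤ length C) →
          length Bs * q ≤ length (concat Bs)
  total []       _   = z≤n
  total (C ∷ Bs) q≤ = ≤-trans (+-mono-≤ (q≤ (here refl)) (total Bs (q≤ ∘ there)))
    (≤-reflexive (sym (List.length-++ C)))

^-cancelʳ-≤ : ∀ k {m n} → m ^ suc k ≤ n ^ suc k → m ≤ n
^-cancelʳ-≤ k m^≤n^ = ≮⇒≥ λ n<m → <⇒≱ (^-monoˡ-< (suc k) n<m) m^≤n^

-- For `k = 0` every card would be lost, but then the hypothesis reads `2 ^ length bs ≤ 1` and there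
-- are no cards.
deal-↭ : ∀ {n k} (bs : List X) → 2 ^ length bs ≤ n ^ k → concat (deal k bs) ↭ bs
deal-↭ {k = suc k} bs _        = concat-deal k bs
deal-↭ {k = zero}  []       _ = ↭.refl
deal-↭ {k = zero}  (b ∷ bs) 2^≤1 = contradiction 2^≤1
  (<⇒≱ (*-mono-≤ {2} {2} ≤-refl (m^n>0 2 (length bs))))

-- The `k` blocks together hold at least `k * pred (length B)` cards, so a `k`-th root of the
-- hypothesis gives `2 ^ pred (length B) ≤ n`. The factor 2 pays for the one card by which blocks
-- may differ.
deal-small : ∀ {n k} (bs : List X) → 2 ^ length bs ≤ n ^ k → ∀ {B} → B ∈ deal k bs →
             2 ^ length B ≤ 2 * n
deal-small {n = n} {k} bs 2^≤ {B} B∈ =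
  ≤-trans (2^-pred (length B)) (*-monoʳ-≤ 2 (root k (≤-trans (^-monoʳ-≤ 2 len≤) 2^≤)
    (subst (0 <_) (length-deal k bs) (∈-length B∈))))
  where
  2^-pred : ∀ m → 2 ^ m ≤ 2 * 2 ^ pred m
  2^-pred zero    = s≤s z≤n
  2^-pred (suc m) = ≤-refl
  len≤ : k * pred (length B) ≤ length bs
  len≤ = subst₂ (λ a b → a * pred (length B) ≤ b) (length-deal k bs)
           (↭-length (deal-↭ bs 2^≤)) (deal-block-length k bs B∈)
  root : ∀ k → 2 ^ (k * pred (length B)) ≤ n ^ k → 0 < k → 2 ^ pred (length B) ≤ n
  root (suc k) le _ = ^-cancelʳ-≤ k (≤-trans (≤-reflexive
    (trans (^-*-assoc 2 (pred (length B)) (suc k)) (cong (2 ^_) (*-comm (pred (length B)) (suc k))))) le)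

-- Choices of values and what they cover

Chosen : List (X × X) → List X → Set
Chosen = Pointwise (λ p x → x ≡ proj₁ p ⊎ x ≡ proj₂ p)

∈-choices⁻ : ∀ (ps : List (X × X)) {l} → l ∈ choices ps → Chosen ps l
∈-choices⁻ []             (here refl) = []
∈-choices⁻ ((p , q) ∷ ps) l∈ with ∈-++⁻ (map (p ∷_) (choices ps)) l∈
... | inj₁ l∈p with l , l∈ , refl ← ∈-map⁻ (p ∷_) l∈p = inj₁ refl ∷ ∈-choices⁻ ps l∈
... | inj₂ l∈q with l , l∈ , refl ← ∈-map⁻ (q ∷_) l∈q = inj₂ refl ∷ ∈-choices⁻ ps l∈

∈-choices⁺ : ∀ {ps : List (X × X)} {l} → Chosen ps l → l ∈ choices ps
∈-choices⁺ []               = here refl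
∈-choices⁺ (inj₁ refl ∷ c) = ∈-++⁺ˡ (∈-map⁺ _ (∈-choices⁺ c))
∈-choices⁺ {ps = (p , _) ∷ ps} (inj₂ refl ∷ c) =
  ∈-++⁺ʳ (map (p ∷_) (choices ps)) (∈-map⁺ _ (∈-choices⁺ c))

Chosen-↭ : ∀ {ps qs : List (X × X)} {l} → ps ↭ qs → Chosen ps l → ∃ λ m → (l ↭ m) × Chosen qs m
Chosen-↭ ↭.refl       c           = _ , ↭.refl , c
Chosen-↭ (↭.prep _ π)   (x ∷ c)     = let m , ρ , d = Chosen-↭ π c in _ , ↭.prep _ ρ , x ∷ d
Chosen-↭ (↭.swap _ _ π) (x ∷ y ∷ c) = let m , ρ , d = Chosen-↭ π c in _ , ↭.swap _ _ ρ , y ∷ x ∷ d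
Chosen-↭ (↭.trans π ρ)  c           =
  let m , σ , d = Chosen-↭ π c
      o , τ , e = Chosen-↭ ρ d
  in o , ↭.trans σ τ , e

mentions : Bit → Elem → Set
mentions (p , q) e = e ∈ p ⊎ e ∈ q

-- The universe to be covered is not listed: it consists of what some value of some bit could cover.
Covers : List (List Elem) → List Bit → Set
Covers ls bs = ∀ {e b} → b ∈ bs → mentions b e → e ∈ concat ls

Coverable : List Bit → Set
Coverable bs = ∃ λ ls → Chosen bs ls × Covers ls bs

concat-∈-↭ : ∀ {ls ms : List (List X)} {x} → ls ↭ ms → x ∈ concat ls → x ∈ concat ms
concat-∈-↭ {ls = ls} π x∈ = let l , x∈l , l∈ = ∈-concat⁻′ ls x∈ in ∈-concat⁺′ x∈l (∈-resp-↭ π l∈)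

Coverable-↭ : ∀ {bs cs} → bs ↭ cs → Coverable bs → Coverable cs
Coverable-↭ π (ls , c , cov) =
  let ms , ρ , d = Chosen-↭ π c
  in ms , d , λ b∈ m → concat-∈-↭ ρ (cov (∈-resp-↭ (↭-sym π) b∈) m)

pick : Bool → X × X → X
pick b (p , q) = cond b q p

pick-chosen : ∀ b (p : X × X) → pick b p ≡ proj₁ p ⊎ pick b p ≡ proj₂ p
pick-chosen false p = inj₁ refl
pick-chosen true  p = inj₂ refl

map-pick-chosen : ∀ {ps : List (X × X)} (f : X × X → Bool) → Chosen ps (map (λ p → pick (f p) p) ps)
map-pick-chosen {ps = []}     f = []
map-pick-chosen {ps = p ∷ ps} f = pick-chosen (f p) p ∷ map-pick-chosen f

-- The 3SAT instance

-- Bits may coincide as pairs of lists, so values are attached to names instead. The function for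
-- the rest is overridden at the head's name, which distinctness keeps away from all later names.
lookup-choice : ∀ {N X : Set} → DecidableEquality N →
                ∀ (ns : List (N × X × X)) {ls} → Unique (map proj₁ ns) → Chosen (map proj₂ ns) ls →
                ∃ λ (y : N → Bool) → ls ≡ map (λ n → pick (y (proj₁ n)) (proj₂ n)) ns
lookup-choice _≟_ []             _        []      = (λ _ → false) , refl
lookup-choice {N} {X} _≟_ ((n , p) ∷ ns) (n∉ ∷ u) (c ∷ cs)
  with y , eq ← lookup-choice _≟_ ns u cs = y′ , cong₂ _∷_ (head c) (trans eq (List.map-cong-local agree))
  where
  b : Bool
  b = Sum.[ (λ _ → false) , (λ _ → true) ] c
  y′ : N → Bool
  y′ m = cond (does (m ≟ n)) b (y m)
  head : ∀ {x : X} (c : x ≡ proj₁ p ⊎ x ≡ proj₂ p) →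
         x ≡ pick (cond (does (n ≟ n)) (Sum.[ (λ _ → false) , (λ _ → true) ] c) (y n)) p
  head c with n ≟ n
  head (inj₁ eq) | yes _ = eq
  head (inj₂ eq) | yes _ = eq
  head c | no n≢n = contradiction refl n≢n
  agree : All (λ m → pick (y (proj₁ m)) (proj₂ m) ≡ pick (y′ (proj₁ m)) (proj₂ m)) ns
  agree = All.map step (All.map⁻ n∉)
    where
    step : ∀ {m : N × X × X} → n ≢ proj₁ m → pick (y (proj₁ m)) (proj₂ m) ≡ pick (y′ (proj₁ m)) (proj₂ m)
    step {m} n≢ with proj₁ m ≟ n
    ... | yes eq = contradiction (sym eq) n≢
    ... | no _   = refl

module _ (v : ℕ) (Cs : List (List Lit)) where

  Satisfies : (ℕ → Bool) → Set
  Satisfies α = ∀ {C} → C ∈ Cs → ∃₂ λ s i → (s , i) ∈ C × α i ≡ s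

  private
    os : List Occ
    os = occs Cs

  varBit : ℕ → Bit
  varBit i = upper i (count i os) false , upper i (count i os) true

  occBit : Occ → ℕ → Bit
  occBit o r = cover o r false , cover o r true

  -- Bits with names: `(i , r)` is the occurrence of `i` of rank `r`. In `varNodes` the variable
  -- itself takes the first free rank, `count i os`, and so becomes the last link of its chain.
  occNodes : List Occ → List ((ℕ × ℕ) × Bit)
  occNodes = gather λ o os →
    let r = count (variable-of o) os in [ ((variable-of o , r) , occBit o r) ]

  varNodes nodes : List ((ℕ × ℕ) × Bit)
  varNodes = map (λ i → (i , count i os) , varBit i) (downFrom v)
  nodes = varNodes ++ occNodes os

  bits≡nodes : bits v Cs ≡ map proj₂ nodes
  bits≡nodes = sym (trans (List.map-++ proj₂ varNodes (occNodes os))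
    (cong₂ _++_ (sym (List.map-∘ (downFrom v))) (occNodes≡ os)))
    where
    occNodes≡ : ∀ os → map proj₂ (occNodes os) ≡ occBits os
    occNodes≡ []       = refl
    occNodes≡ (o ∷ os) = cong (occBit o (count (variable-of o) os) ∷_) (occNodes≡ os)

  data Node : (ℕ × ℕ) × Bit → Set where
    var : ∀ {i} → i < v → Node ((i , count i os) , varBit i)
    occ : ∀ {o os′} → Tail o os′ os →
          Node ((variable-of o , count (variable-of o) os′) , occBit o (count (variable-of o) os′))

  ∈-nodes⁻ : ∀ {n} → n ∈ nodes → Node n
  ∈-nodes⁻ n∈ with ∈-++⁻ varNodes n∈
  ... | inj₁ n∈v with i , i∈ , refl ← ∈-map⁻ _ n∈v = var (∈-downFrom⁻ i∈)
  ... | inj₂ n∈o with o , os′ , t , here refl ← ∈-gather⁻ os n∈o = occ t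

  ∈-nodes⁺ : ∀ {n} → Node n → n ∈ nodes
  ∈-nodes⁺ (var i<v) = ∈-++⁺ˡ (∈-map⁺ _ (∈-downFrom⁺ i<v))
  ∈-nodes⁺ (occ t)   = ∈-++⁺ʳ varNodes (∈-gather⁺ t (here refl))

∈-occs⁻ : ∀ Cs {o os} → Tail o os (occs Cs) →
          ∃₂ λ C Cs′ → Tail C Cs′ Cs × proj₁ o ≡ length Cs′ × proj₂ o ∈ C
∈-occs⁻ Cs t with C , Cs′ , u , o∈ ← ∈-gather⁻ Cs (Tail⇒∈ t) with l , l∈ , refl ← ∈-map⁻ _ o∈ =
  C , Cs′ , u , refl , l∈

∈-occs⁺ : ∀ {Cs C Cs′ l} → Tail C Cs′ Cs → l ∈ C → ∃ λ os → Tail (length Cs′ , l) os (occs Cs)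
∈-occs⁺ t l∈ = ∈⇒Tail (∈-gather⁺ t (∈-map⁺ _ l∈))

≡ᵇ-refl : ∀ n → (n ≡ᵇ n) ≡ true
≡ᵇ-refl zero    = refl
≡ᵇ-refl (suc n) = ≡ᵇ-refl n

count-∷ : ∀ o os → count (variable-of o) (o ∷ os) ≡ suc (count (variable-of o) os)
count-∷ o os rewrite ≡ᵇ-refl (variable-of o) = refl

count-∷-≤ : ∀ i o os → count i os ≤ count i (o ∷ os)
count-∷-≤ i o os with i ≡ᵇ variable-of o
... | true  = n≤1+n _
... | false = ≤-refl

count-Tail : ∀ {o os os′} → Tail o os′ os → count (variable-of o) os′ < count (variable-of o) os
count-Tail {o} {os′ = os} here   = ≤-reflexive (sym (count-∷ o os))
count-Tail {o} (there {b} {bs} t) = ≤-trans (count-Tail t) (count-∷-≤ (variable-of o) b bs)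

rank-exists : ∀ i os {r} → r < count i os →
              ∃₂ λ o os′ → Tail o os′ os × variable-of o ≡ i × count i os′ ≡ r
rank-exists i (o ∷ os) {r} r< with i ≡ᵇ variable-of o in eq
... | false = let o , os′ , t , p = rank-exists i os r< in o , os′ , there t , p
... | true with m≤n⇒m<n∨m≡n (≤-pred r<)
...   | inj₁ r<′ = let o , os′ , t , p = rank-exists i os r<′ in o , os′ , there t , p
...   | inj₂ r≡  = o , os , here , sym (≡ᵇ⇒≡ i _ (subst T (sym eq) tt)) , sym r≡

tag-injective : ∀ {b c} → tag b ≡ tag c → b ≡ c
tag-injective {false} {false} _ = refl
tag-injective {true}  {true}  _ = refl

tag≤1 : ∀ b → tag b ≤ 1
tag≤1 false = z≤n
tag≤1 true  = ≤-refl

not≢ : ∀ b → not b ≢ b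
not≢ b eq = Bool.not-¬ refl (sym eq)

not≡ : ∀ {b c} → b ≢ c → not b ≡ c
not≡ b≢c = sym (Bool.¬-not (b≢c ∘ sym))

data UpperView (i : ℕ) (b : Bool) : ℕ → Elem → Set where
  raised : ∀ {r} → UpperView i b (suc r) (tag b , i , r)

∈-upper⁻ : ∀ {i b e} r → e ∈ upper i r b → UpperView i b r e
∈-upper⁻ (suc r) (here refl) = raised

∈-upper⁺ : ∀ {i b r e} → UpperView i b r e → e ∈ upper i r b
∈-upper⁺ raised = here refl

data CoverView : Occ → ℕ → Bool → Elem → Set where
  own    : ∀ {c s i r b} → CoverView (c , s , i) r b (tag (not b) , i , r)
  linked : ∀ {c s i r b e} → UpperView i b r e → CoverView (c , s , i) r b e
  clause : ∀ {c s i r} → CoverView (c , s , i) r s (2 , c , 0)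

≡ᴮ⇒≡ : ∀ b c → b ≡ᴮ c ≡ true → b ≡ c
≡ᴮ⇒≡ true  true  _ = refl
≡ᴮ⇒≡ false false _ = refl

≡ᴮ-refl : ∀ b → b ≡ᴮ b ≡ true
≡ᴮ-refl true  = refl
≡ᴮ-refl false = refl

∈-cover⁻ : ∀ o r b {e} → e ∈ cover o r b → CoverView o r b e
∈-cover⁻ (c , s , i) r b (here refl) = own
∈-cover⁻ (c , s , i) r b (there e∈) with ∈-++⁻ (upper i r b) e∈
... | inj₁ e∈u = linked (∈-upper⁻ r e∈u)
... | inj₂ e∈c with b ≡ᴮ s in eq
...   | true with here refl ← e∈c with refl ← ≡ᴮ⇒≡ b s eq = clause

∈-cover⁺ : ∀ {o r b e} → CoverView o r b e → e ∈ cover o r b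
∈-cover⁺ own                       = here refl
∈-cover⁺ (linked u)                = there (∈-++⁺ˡ (∈-upper⁺ u))
∈-cover⁺ {c , s , i} {r} clause =
  there (∈-++⁺ʳ (upper i r s) (subst (λ t → _ ∈ cond t _ []) (sym (≡ᴮ-refl s)) (here refl)))

pick-map : ∀ (f : Bool → X) b → pick b (f false , f true) ≡ f b
pick-map f false = refl
pick-map f true  = refl

mentions-map : ∀ {f : Bool → List Elem} {e} → mentions (f false , f true) e → ∃ λ b → e ∈ f b
mentions-map (inj₁ e∈) = false , e∈
mentions-map (inj₂ e∈) = true , e∈

mention : ∀ (f : Bool → List Elem) b {e} → e ∈ f b → mentions (f false , f true) e
mention f false = inj₁
mention f true  = inj₂

raised-inverse : ∀ {j b q t i r} → UpperView j b q (t , i , r) → j ≡ i × q ≡ suc r × tag b ≡ t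
raised-inverse raised = refl , refl , refl

cover-inverse : ∀ {o b q t i r} → t ≤ 1 → CoverView o q b (t , i , r) →
                (variable-of o ≡ i × q ≡ r × tag (not b) ≡ t) ⊎
                (variable-of o ≡ i × q ≡ suc r × tag b ≡ t)
cover-inverse _          own        = inj₁ (refl , refl , refl)
cover-inverse _          (linked u) = inj₂ (raised-inverse u)
cover-inverse (s≤s ())   clause

clause-inverse : ∀ {o b q c} → CoverView o q b (2 , c , 0) → proj₁ o ≡ c × proj₁ (proj₂ o) ≡ b
clause-inverse {b = b} e = go e refl
  where
  go : ∀ {o q e c} → CoverView o q b e → e ≡ (2 , c , 0) → proj₁ o ≡ c × proj₁ (proj₂ o) ≡ b
  go own              eq = contradiction (tag≤1 (not b)) (λ t≤1 → <⇒≱ (≤-reflexive (sym (cong proj₁ eq))) t≤1)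
  go (linked raised)  eq = contradiction (tag≤1 b) (λ t≤1 → <⇒≱ (≤-reflexive (sym (cong proj₁ eq))) t≤1)
  go clause       refl = refl , refl

module _ {v : ℕ} {Cs : List (List Lit)} where

  private
    os : List Occ
    os = occs Cs

  -- Every bit takes the value that `α` gives its variable. A comparison element is then covered
  -- from one of its two ends, a clause element by the occurrence of a true literal.
  satisfiable⇒coverable : (∀ {o} → o ∈ os → variable-of o < v) →
                          ∀ α → Satisfies v Cs α → Coverable (bits v Cs)
  satisfiable⇒coverable vars<v α sat =
    ls , subst (λ bs → Chosen bs ls) (sym (bits≡nodes v Cs)) (chosen (nodes v Cs)) , covers
    where
    chosen-list : (ℕ × ℕ) × Bit → List Elem
    chosen-list n = pick (α (proj₁ (proj₁ n))) (proj₂ n)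
    ls : List (List Elem)
    ls = map chosen-list (nodes v Cs)
    chosen : ∀ ns → Chosen (map proj₂ ns) (map chosen-list ns)
    chosen []       = []
    chosen (n ∷ ns) = pick-chosen (α (proj₁ (proj₁ n))) (proj₂ n) ∷ chosen ns

    covered-by-var : ∀ {i e} → i < v → e ∈ upper i (count i os) (α i) → e ∈ concat ls
    covered-by-var {i} i<v e∈ = ∈-concat⁺′
      (subst (_ ∈_) (sym (pick-map (upper i (count i os)) (α i))) e∈)
      (∈-map⁺ chosen-list (∈-nodes⁺ v Cs (var i<v)))
    covered-by-occ : ∀ {o os′ e} → Tail o os′ os →
                     CoverView o (count (variable-of o) os′) (α (variable-of o)) e → e ∈ concat ls
    covered-by-occ {o} {os′} t e∈ = ∈-concat⁺′
      (subst (_ ∈_) (sym (pick-map (cover o (count (variable-of o) os′)) (α (variable-of o))))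
        (∈-cover⁺ e∈))
      (∈-map⁺ chosen-list (∈-nodes⁺ v Cs (occ t)))

    -- The bit of rank `r` misses this element only if the common value is `b`; then the bit one
    -- rank higher covers it, which is the variable's own bit when `r` is the last rank of an
    -- occurrence.
    link : ∀ b i {r} → i < v → r < count i os → (tag b , i , r) ∈ concat ls
    link b i {r} i<v r< with b Bool.≟ α i
    ... | no b≢ with o , os′ , t , refl , refl ← rank-exists i os r< =
      covered-by-occ t (subst (λ b → CoverView o r (α i) (tag b , i , r)) (not≡ (b≢ ∘ sym)) own)
    ... | yes refl with m≤n⇒m<n∨m≡n r<
    ...   | inj₂ eq = covered-by-var i<v (subst (λ q → _ ∈ upper i q b) eq (here refl))
    ...   | inj₁ r<′ with o , os′ , t , refl , eq ← rank-exists i os r<′ =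
      covered-by-occ t (linked (subst (λ q → UpperView i b q _) (sym eq) raised))

    covers-node : ∀ {n e} → Node v Cs n → mentions (proj₂ n) e → e ∈ concat ls
    covers-node (var {i} i<v) m
      with b , e∈ ← mentions-map {f = upper i (count i os)} m
      with count i os in eq | ∈-upper⁻ (count i os) e∈
    ... | suc r | raised = link b i i<v (≤-reflexive (sym eq))
    covers-node (occ {o} {os′} t) m
      with b , e∈ ← mentions-map {f = cover o (count (variable-of o) os′)} m
      with ∈-cover⁻ o (count (variable-of o) os′) b e∈
    ... | own = link (not b) _ (vars<v (Tail⇒∈ t)) (count-Tail t)
    ... | clause with C , Cs′ , u , refl , _ ← ∈-occs⁻ Cs t
                 with s , i , l∈ , refl ← sat (Tail⇒∈ u)
                 with os″ , t′ ← ∈-occs⁺ u l∈ = covered-by-occ t′ clause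
    ... | linked u with count (variable-of o) os′ in eq | u
    ...   | suc r | raised = link b _ (vars<v (Tail⇒∈ t))
              (≤-trans (n≤1+n _) (subst (_< count (variable-of o) os) eq (count-Tail t)))

    covers : Covers ls (bits v Cs)
    covers b∈ m with n , n∈ , refl ← ∈-map⁻ proj₂ (subst (_ ∈_) (bits≡nodes v Cs) b∈) =
      covers-node (∈-nodes⁻ v Cs n∈) m

  -- Along the list the ranks of a variable's occurrences decrease strictly, and all are below
  -- `count i os`, the rank of the variable.
  unique-names : Unique (map proj₁ (nodes v Cs))
  unique-names = subst Unique (sym (List.map-++ proj₁ (varNodes v Cs) (occNodes v Cs os)))
    (Unique.++⁺
      (subst Unique (List.map-∘ (downFrom v))
        (Unique.map⁺ {f = λ i → i , count i os} (cong proj₁) (Unique.downFrom⁺ v)))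
      (unique-occ os)
      λ (n∈v , n∈o) → <⇒≢ (name< os n∈o) (name≡ n∈v))
    where
    name< : ∀ os {n} → n ∈ map proj₁ (occNodes v Cs os) → proj₂ n < count (proj₁ n) os
    name< os n∈ with _ , m∈ , refl ← ∈-map⁻ proj₁ n∈
      with o , os′ , t , here refl ← ∈-gather⁻ os m∈ = count-Tail t
    name≡ : ∀ {n} → n ∈ map proj₁ (varNodes v Cs) → proj₂ n ≡ count (proj₁ n) os
    name≡ n∈ with _ , m∈ , refl ← ∈-map⁻ proj₁ n∈
      with _ , _ , refl ← ∈-map⁻ (λ i → (i , count i os) , varBit v Cs i) m∈ = refl
    unique-occ : ∀ os → Unique (map proj₁ (occNodes v Cs os))
    unique-occ []       = []
    unique-occ (o ∷ os) =
      All.tabulate (λ n∈ eq → <⇒≢ (name< os n∈) (subst (λ n → proj₂ n ≡ count (proj₁ n) os) eq refl)) ∷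
      unique-occ os

  -- Both (0 , i , r) and (1 , i , r) are covered only if the occurrences of
  -- rank r and r + 1 agree, so all of them agree with the variable itself.
  coverable⇒satisfiable : (∀ {C} → C ∈ Cs → 0 < length C) →
                          Coverable (bits v Cs) → ∃ λ α → Satisfies v Cs α
  coverable⇒satisfiable nonempty (ls , ch , cov)
    with y , ls≡ ← lookup-choice (≡-dec _≟_ _≟_) (nodes v Cs) unique-names
                     (subst (λ bs → Chosen bs ls) (bits≡nodes v Cs) ch) = α , satisfies
    where
    α : ℕ → Bool
    α i = y (i , count i os)

    covered : ∀ {n e} → Node v Cs n → mentions (proj₂ n) e →
              ∃ λ n′ → Node v Cs n′ × e ∈ pick (y (proj₁ n′)) (proj₂ n′)
    covered {n} {e} node m
      with l , e∈l , l∈ ← ∈-concat⁻′ _ (subst (λ ls → e ∈ concat ls) ls≡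
             (cov (subst (_ ∈_) (sym (bits≡nodes v Cs)) (∈-map⁺ proj₂ (∈-nodes⁺ v Cs node))) m))
      with n′ , n′∈ , refl ← ∈-map⁻ (λ n → pick (y (proj₁ n)) (proj₂ n)) l∈ = n′ , ∈-nodes⁻ v Cs n′∈ , e∈l

    at-var : ∀ j {t i r} → (t , i , r) ∈ pick (α j) (varBit v Cs j) →
             j ≡ i × count j os ≡ suc r × tag (α j) ≡ t
    at-var j e∈ = raised-inverse (∈-upper⁻ (count j os)
      (subst (_ ∈_) (pick-map (upper j (count j os)) (α j)) e∈))

    at-occ : ∀ o os′ {e} → let r = count (variable-of o) os′ ; b = y (variable-of o , r) in
             e ∈ pick b (occBit v Cs o r) → CoverView o r b e
    at-occ o os′ e∈ = ∈-cover⁻ o r b (subst (_ ∈_) (pick-map (cover o r) b) e∈)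
      where
      r = count (variable-of o) os′
      b = y (variable-of o , r)

    inhabited : ∀ (C : List Lit) → 0 < length C → ∃ λ l → l ∈ C
    inhabited (l ∷ _) _ = l , here refl

    agree : ∀ i {r} → r < count i os → y (i , r) ≡ y (i , suc r)
    agree i {r} r< with o , os′ , t , refl , refl ← rank-exists i os r<
      -- The element is chosen to be the one that the bit of rank `r + 1` misses with its present
      -- value. Only the bit of rank `r` can then cover it, and only with that same value.
      with covered (occ t) (mention (cover o r) (y (i , suc r)) (∈-cover⁺ {o} own))
    ... | _ , var {j} j<v , e∈
      with refl , count≡ , tag≡ ← at-var j e∈ =
      contradiction (trans (sym (tag-injective tag≡)) (cong (λ r → y (j , r)) count≡)) (not≢ _)
    ... | _ , occ {o′} {os″} u , e∈
      with cover-inverse (tag≤1 (not (y (i , suc r)))) (at-occ o′ os″ e∈)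
    ...   | inj₁ (var≡ , rank≡ , tag≡) =
      trans (cong y (sym (cong₂ _,_ var≡ rank≡))) (Bool.not-injective (tag-injective tag≡))
    ...   | inj₂ (var≡ , rank≡ , tag≡) =
      contradiction (trans (sym (tag-injective tag≡)) (cong y (cong₂ _,_ var≡ rank≡))) (not≢ _)

    agree-α : ∀ i d {r} → r + d ≡ count i os → y (i , r) ≡ α i
    agree-α i zero    {r} eq = cong (λ r → y (i , r)) (trans (sym (+-identityʳ r)) eq)
    agree-α i (suc d) {r} eq =
      trans (agree i (≤-trans (m≤m+n (suc r) d) (≤-reflexive eq′))) (agree-α i d eq′)
      where eq′ = trans (sym (+-suc r d)) eq

    satisfies : Satisfies v Cs α
    -- The element of a clause belongs to the universe only through the literals of that clause, so
    -- one literal is needed to ask how it is covered.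
    satisfies {C} C∈ with Cs′ , t ← ∈⇒Tail C∈ with (s , i) , l∈ ← inhabited C (nonempty C∈)
      with os′ , u ← ∈-occs⁺ t l∈
      with covered (occ u) (mention (cover (length Cs′ , s , i) (count i os′)) s (∈-cover⁺ clause))
    ... | _ , var {j} j<v , e∈
      with _ , _ , tag≡ ← at-var j e∈ = contradiction (subst (_≤ 1) tag≡ (tag≤1 (α j))) λ { (s≤s ()) }
    ... | _ , occ {o′} {os″} w , e∈ with c≡ , s≡ ← clause-inverse (at-occ o′ os″ e∈)
      with C″ , Cs″ , t″ , c″≡ , l″∈ ← ∈-occs⁻ Cs w
      with refl , _ ← Tail-unique t″ t (trans (sym c″≡) c≡) =
      _ , _ , l″∈ , trans (sym (agree-α _ _ (m+[n∸m]≡n (<⇒≤ (count-Tail w))))) (sym s≡)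

-- Boolean tests, repetition-free lists and assignments

T⇒true : ∀ {b} → T b → b ≡ true
T⇒true = Equivalence.to Bool.T-≡

true⇒T : ∀ {b} → b ≡ true → T b
true⇒T = Equivalence.from Bool.T-≡

lookup-injective : ∀ {xs : List X} → Unique xs → ∀ i j → lookup xs i ≡ lookup xs j → i ≡ j
lookup-injective (_ ∷ _)  zero    zero    _  = refl
lookup-injective {xs = _ ∷ xs} (x∉ ∷ _) zero    (suc j) eq = contradiction eq (All.lookup x∉ (∈-lookup j))
lookup-injective {xs = _ ∷ xs} (x∉ ∷ _) (suc i) zero    eq = contradiction (sym eq) (All.lookup x∉ (∈-lookup i))
lookup-injective (_ ∷ u)  (suc i) (suc j) eq = cong suc (lookup-injective u i j eq)

_≟ᴱ_ : DecidableEquality Elem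
_≟ᴱ_ = ≡-dec _≟_ (≡-dec _≟_ _≟_)

open import Data.List.Membership.DecPropositional _≟ᴱ_ using (_∈?_)

≡ᴱ⇒≡ : ∀ e e′ → T (e ≡ᴱ e′) → e ≡ e′
≡ᴱ⇒≡ (a , b , c) (a′ , b′ , c′) t =
  let ta , tbc = Equivalence.to Bool.T-∧ t
      tb , tc  = Equivalence.to (Bool.T-∧ {b ≡ᵇ b′}) tbc
  in cong₂ _,_ (≡ᵇ⇒≡ a a′ ta) (cong₂ _,_ (≡ᵇ⇒≡ b b′ tb) (≡ᵇ⇒≡ c c′ tc))

≡ᴱ-refl : ∀ e → T (e ≡ᴱ e)
≡ᴱ-refl (a , b , c) = Equivalence.from Bool.T-∧
  (≡⇒≡ᵇ a a refl , Equivalence.from (Bool.T-∧ {b ≡ᵇ b}) (≡⇒≡ᵇ b b refl , ≡⇒≡ᵇ c c refl))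

∈ᵇ⇒∈ : ∀ e es → T (e ∈ᵇ es) → e ∈ es
∈ᵇ⇒∈ e es t = Any.map (≡ᴱ⇒≡ e _) (Any.any⁻ (e ≡ᴱ_) es t)

∈⇒∈ᵇ : ∀ {e es} → e ∈ es → T (e ∈ᵇ es)
∈⇒∈ᵇ {e} e∈ = Any.any⁺ (e ≡ᴱ_) (Any.map (λ { refl → ≡ᴱ-refl e }) e∈)

≡ᴬ⇒≡ : ∀ a a′ → T (a ≡ᴬ a′) → a ≡ a′
≡ᴬ⇒≡ (e , b) (e′ , b′) t =
  let te , tb = Equivalence.to (Bool.T-∧ {e ≡ᴱ e′}) t
  in cong₂ _,_ (≡ᴱ⇒≡ e e′ te) (≡ᴮ⇒≡ b b′ (T⇒true tb))

≡ᴬ-refl : ∀ a → T (a ≡ᴬ a)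
≡ᴬ-refl (e , b) = Equivalence.from (Bool.T-∧ {e ≡ᴱ e}) (≡ᴱ-refl e , true⇒T (≡ᴮ-refl b))

∈-nub⁻ : ∀ xs {e} → e ∈ nub xs → e ∈ xs
∈-nub⁻ (x ∷ xs) e∈ with x ∈ᵇ xs
... | true = there (∈-nub⁻ xs e∈)
∈-nub⁻ (x ∷ xs) (here refl) | false = here refl
∈-nub⁻ (x ∷ xs) (there e∈)  | false = there (∈-nub⁻ xs e∈)

∈-nub⁺ : ∀ {xs e} → e ∈ xs → e ∈ nub xs
∈-nub⁺ {x ∷ xs} e∈ with x ∈ᵇ xs in eq
∈-nub⁺ {x ∷ xs} (here refl) | true  = ∈-nub⁺ (∈ᵇ⇒∈ x xs (true⇒T eq))
∈-nub⁺ {x ∷ xs} (there e∈)  | true  = ∈-nub⁺ e∈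
∈-nub⁺ {x ∷ xs} (here refl) | false = here refl
∈-nub⁺ {x ∷ xs} (there e∈)  | false = there (∈-nub⁺ e∈)

nub-unique : ∀ xs → Unique (nub xs)
nub-unique []       = []
nub-unique (x ∷ xs) with x ∈ᵇ xs in eq
... | true  = nub-unique xs
... | false = All.tabulate (λ { y∈ refl → subst T eq (∈⇒∈ᵇ (∈-nub⁻ xs y∈)) }) ∷ nub-unique xs

length-nub : ∀ xs → length (nub xs) ≤ length xs
length-nub []       = z≤n
length-nub (x ∷ xs) with x ∈ᵇ xs
... | true  = m≤n⇒m≤1+n (length-nub xs)
... | false = s≤s (length-nub xs)

∈-assignments⁻ : ∀ U {x} → x ∈ assignments U → map proj₁ x ≡ U
∈-assignments⁻ U x∈ = go U (∈-choices⁻ _ x∈)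
  where
  go : ∀ U {x} → Chosen (map (λ e → (e , false) , (e , true)) U) x → map proj₁ x ≡ U
  go []      []              = refl
  go (e ∷ U) (inj₁ refl ∷ c) = cong (e ∷_) (go U c)
  go (e ∷ U) (inj₂ refl ∷ c) = cong (e ∷_) (go U c)

∈-assignments⁺ : ∀ x → x ∈ assignments (map proj₁ x)
∈-assignments⁺ x = ∈-choices⁺ (go x)
  where
  go : ∀ x → Chosen (map (λ e → (e , false) , (e , true)) (map proj₁ x)) x
  go []                = []
  go ((e , false) ∷ x) = inj₁ refl ∷ go x
  go ((e , true)  ∷ x) = inj₂ refl ∷ go x

assignments-unique : ∀ U → Unique (assignments U)
assignments-unique []      = [] ∷ []
assignments-unique (e ∷ U) = Unique.++⁺
  (Unique.map⁺ List.∷-injectiveʳ (assignments-unique U))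
  (Unique.map⁺ List.∷-injectiveʳ (assignments-unique U))
  λ (x∈ , y∈) → clash (∈-map⁻ ((e , false) ∷_) x∈) (∈-map⁻ ((e , true) ∷_) y∈)
  where
  clash : ∀ {z} {A : List (List (Elem × Bool))} → ∃ (λ x → x ∈ A × z ≡ (e , false) ∷ x) → ∃ (λ y → y ∈ A × z ≡ (e , true) ∷ y) → ⊥
  clash (_ , _ , refl) (_ , _ , ())

-- As the supports agree in order and have no repetition, an entry of `y` can lie in `x` only at its
-- own position.
assignment-determined : ∀ (x y : List (Elem × Bool)) → map proj₁ x ≡ map proj₁ y →
                        Unique (map proj₁ y) → (∀ {a} → a ∈ y → a ∈ x) → x ≡ y
assignment-determined []            []            _  _        _   = refl
assignment-determined ((e , b) ∷ x) ((e′ , c) ∷ y) eq (e∉ ∷ u) y⊆x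
  with refl ← List.∷-injectiveˡ eq = cong₂ _∷_ head (assignment-determined x y tails≡ u tail)
  where
  tails≡ : map proj₁ x ≡ map proj₁ y
  tails≡ = List.∷-injectiveʳ eq
  e∉y : e ∉ map proj₁ y
  e∉y e∈ = All.lookup e∉ e∈ refl
  head : (e , b) ≡ (e , c)
  head with y⊆x (here refl)
  ... | here eq  = sym eq
  ... | there a∈ = contradiction (subst (e ∈_) tails≡ (∈-map⁺ proj₁ a∈)) e∉y
  tail : ∀ {a} → a ∈ y → a ∈ x
  tail a∈ with y⊆x (there a∈)
  ... | here refl = contradiction (∈-map⁺ proj₁ a∈) e∉y
  ... | there a∈x = a∈x

-- The graph of a list of vertices

colour : Vertex → ℕ
colour = proj₁

isPair : Vertex → Bool
isPair v = proj₁ (proj₂ v)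

assignment : Vertex → List (Elem × Bool)
assignment v = proj₂ (proj₂ v)

support : Vertex → List Elem
support v = map proj₁ (assignment v)

meets-irrefl : ∀ v → meets v v ≡ false
meets-irrefl (_ , false , _) = refl
meets-irrefl (_ , true  , _) = refl

graph : List Vertex → ColoredGraph
graph vs = record
  { order    = length vs
  ; adjacent = λ u v → adj (lookup vs u) (lookup vs v)
  ; color    = λ u → colour (lookup vs u)
  ; adj-sym  = λ u v → Bool.∨-comm (meets (lookup vs u) (lookup vs v)) _
  ; loopless = λ v → cong₂ _∨_ (meets-irrefl (lookup vs v)) (meets-irrefl (lookup vs v))
  }

-- Flipping elements

flipᴬ : (Elem → Bool) → Elem × Bool → Elem × Bool
flipᴬ z (e , b) = e , b xor z e

flip : (Elem → Bool) → Vertex → Vertex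
flip z (c , f , x) = c , f , map (flipᴬ z) x

flipᴬ-involutive : ∀ z a → flipᴬ z (flipᴬ z a) ≡ a
flipᴬ-involutive z (e , b) = cong (e ,_)
  (trans (Bool.xor-assoc b (z e) (z e)) (trans (cong (b xor_) (Bool.xor-same (z e))) (Bool.xor-identityʳ b)))

flip-involutive : ∀ z v → flip z (flip z v) ≡ v
flip-involutive z (c , f , x) = cong (λ x → c , f , x) (begin
  map (flipᴬ z) (map (flipᴬ z) x)  ≡⟨ List.map-∘ x ⟨
  map (flipᴬ z ∘ flipᴬ z) x        ≡⟨ List.map-cong (flipᴬ-involutive z) x ⟩
  map id x                         ≡⟨ List.map-id x ⟩
  x                                ∎)
  where open ≡-Reasoning

support-flip : ∀ z v → support (flip z v) ≡ support v
support-flip z v = sym (List.map-∘ (assignment v))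

any-cong : ∀ {p q : X → Bool} → (∀ x → p x ≡ q x) → ∀ xs → any p xs ≡ any q xs
any-cong p≡q xs = cong or (List.map-cong p≡q xs)

any-map : ∀ {p : Y → Bool} {f : X → Y} xs → any p (map f xs) ≡ any (p ∘ f) xs
any-map xs = cong or (sym (List.map-∘ xs))

≡ᴮ-xor : ∀ b b′ c → (b xor c) ≡ᴮ (b′ xor c) ≡ b ≡ᴮ b′
≡ᴮ-xor false false false = refl
≡ᴮ-xor false false true  = refl
≡ᴮ-xor false true  false = refl
≡ᴮ-xor false true  true  = refl
≡ᴮ-xor true  false false = refl
≡ᴮ-xor true  false true  = refl
≡ᴮ-xor true  true  false = refl
≡ᴮ-xor true  true  true  = refl

flip-≡ᴬ : ∀ z a a′ → flipᴬ z a ≡ᴬ flipᴬ z a′ ≡ a ≡ᴬ a′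
flip-≡ᴬ z (e , b) (e′ , b′) with e ≡ᴱ e′ in eq
... | false = refl
... | true with refl ← ≡ᴱ⇒≡ e e′ (true⇒T eq) = ≡ᴮ-xor b b′ (z e)

meets-flip : ∀ z u v → meets (flip z u) (flip z v) ≡ meets u v
meets-flip z (_ , f , x) (_ , g , y) = cong (λ m → f ∧ (not g ∧ m)) (begin
  any (λ a → any (a ≡ᴬ_) (map (flipᴬ z) y)) (map (flipᴬ z) x)  ≡⟨ any-map x ⟩
  any (λ a → any (flipᴬ z a ≡ᴬ_) (map (flipᴬ z) y)) x          ≡⟨ any-cong (λ a → any-map y) x ⟩
  any (λ a → any (λ a′ → flipᴬ z a ≡ᴬ flipᴬ z a′) y) x         ≡⟨ any-cong (λ a → any-cong (flip-≡ᴬ z a) y) x ⟩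
  any (λ a → any (a ≡ᴬ_) y) x                                   ∎)
  where open ≡-Reasoning

meets⁺ : ∀ {c d a y} → a ∈ y → meets (c , true , [ a ]) (d , false , y) ≡ true
meets⁺ {a = a} {y} a∈ = T⇒true (Equivalence.from (Bool.T-∨ {any (a ≡ᴬ_) y})
  (inj₁ (Any.any⁺ (a ≡ᴬ_) (Any.map (λ { refl → ≡ᴬ-refl a }) a∈))))

adj⁻ : ∀ {c d a y} → adj (c , true , [ a ]) (d , false , y) ≡ true → a ∈ y
adj⁻ {a = a} {y} eq = Any.map (≡ᴬ⇒≡ a _) (Any.any⁻ (a ≡ᴬ_) y (true⇒T
  (trans (sym (trans (cong (_∨ false) (Bool.∨-identityʳ _)) (Bool.∨-identityʳ _))) eq)))

∈-vertices⁻ : ∀ cs {v} → v ∈ vertices cs →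
              ∃₂ λ U cs′ → Tail (isPair v , U) cs′ cs × colour v ≡ length cs′ × support v ≡ U
∈-vertices⁻ cs v∈ with (f , U) , cs′ , t , v∈′ ← ∈-gather⁻ cs v∈
  with x , x∈ , refl ← ∈-map⁻ _ v∈′ = U , cs′ , t , refl , ∈-assignments⁻ U x∈

∈-vertices⁺ : ∀ {cs f x cs′} → Tail (f , map proj₁ x) cs′ cs → (length cs′ , f , x) ∈ vertices cs
∈-vertices⁺ {x = x} t = ∈-gather⁺ t (∈-map⁺ _ (∈-assignments⁺ x))

vertices-unique : ∀ cs → Unique (vertices cs)
vertices-unique []             = []
vertices-unique ((f , U) ∷ cs) = Unique.++⁺
  (Unique.map⁺ (λ { refl → refl }) (assignments-unique U)) (vertices-unique cs)
  λ (v∈ , w∈) → clash v∈ w∈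
  where
  clash : ∀ {v} → v ∈ map (λ x → length cs , f , x) (assignments U) → v ∈ vertices cs → ⊥
  clash v∈ w∈ with _ , _ , refl ← ∈-map⁻ _ v∈ with _ , cs′ , t , eq , _ ← ∈-vertices⁻ cs w∈ =
    <⇒≢ (Tail-length t) (sym eq)

flip-∈ : ∀ {cs} z {v} → v ∈ vertices cs → flip z v ∈ vertices cs
flip-∈ {cs} z {v} v∈ with U , cs′ , t , refl , refl ← ∈-vertices⁻ cs v∈ =
  ∈-vertices⁺ (subst (λ U → Tail (isPair v , U) cs′ cs) (sym (support-flip z v)) t)

firstValue : List (Elem × Bool) → Bool
firstValue []            = false
firstValue ((_ , b) ∷ _) = b

Tail-of-unique : ∀ {xs : List X} {a as bs} → Unique xs → Tail a as xs → Tail a bs xs → as ≡ bs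
Tail-of-unique _        here      here      = refl
Tail-of-unique (a∉ ∷ _) here      (there t) = contradiction refl (All.lookup a∉ (Tail⇒∈ t))
Tail-of-unique (a∉ ∷ _) (there t) here      = contradiction refl (All.lookup a∉ (Tail⇒∈ t))
Tail-of-unique (_ ∷ u)  (there t) (there s) = Tail-of-unique u t s

pairClass : Elem → Class
pairClass e = true , [ e ]

-- A graph with a pair of vertices for every element of els and the set
-- classes R.
module _ {els : List Elem} (els-unique : Unique els) {R : List Class}
         (sets : ∀ {c} → c ∈ R → proj₁ c ≡ false × Unique (proj₂ c) × (∀ {e} → e ∈ proj₂ c → e ∈ els))
         where

  tailPairs : List Elem → List Class
  tailPairs es = map pairClass es ++ R

  private
    cs : List Class
    cs = tailPairs els

    vs : List Vertex
    vs = vertices cs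

    G : ColoredGraph
    G = graph vs

  open ColoredGraph G using (order; adjacent; color)
  open Automorphism

  private
    V : Set
    V = Fin order

    D : V → Vertex
    D = lookup vs

  D-injective : ∀ {u v} → D u ≡ D v → u ≡ v
  D-injective = lookup-injective (vertices-unique cs) _ _

  vertex : ∀ {v} → v ∈ vs → V
  vertex = Any.index

  D-vertex : ∀ {v} (v∈ : v ∈ vs) → D (vertex v∈) ≡ v
  D-vertex v∈ = sym (Any.lookup-index v∈)

  D-class : ∀ u → ∃₂ λ U cs′ → Tail (isPair (D u) , U) cs′ cs ×
                  colour (D u) ≡ length cs′ × support (D u) ≡ U
  D-class u = ∈-vertices⁻ cs (∈-lookup u)

  -- A colour is the number of classes that follow, and this number pins down the class.
  same-class : ∀ u v → colour (D u) ≡ colour (D v) →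
               isPair (D u) ≡ isPair (D v) × support (D u) ≡ support (D v)
  same-class u v eq
    with _ , _ , t , c≡ , s≡ ← D-class u
    with _ , _ , t′ , c≡′ , s≡′ ← D-class v
    with class≡ , _ ← Tail-unique t t′ (trans (sym c≡) (trans eq c≡′)) =
    ,-injectiveˡ class≡ , trans s≡ (trans (,-injectiveʳ class≡) (sym s≡′))

  pair-Tail : ∀ {e es} xs → Tail e es xs → Tail (pairClass e) (tailPairs es) (tailPairs xs)
  pair-Tail (_ ∷ _)  here      = here
  pair-Tail (_ ∷ xs) (there t) = there (pair-Tail xs t)

  pair-Tail⁻ : ∀ xs {U cs} → Tail (true , U) cs (tailPairs xs) →
               ∃₂ λ e es → Tail e es xs × U ≡ [ e ] × cs ≡ tailPairs es
  pair-Tail⁻ [] t with () ← proj₁ (sets (Tail⇒∈ t))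
  pair-Tail⁻ (x ∷ xs) here      = x , xs , here , refl , refl
  pair-Tail⁻ (x ∷ xs) (there t) =
    let e , es , s , p = pair-Tail⁻ xs t in e , es , there s , p

  set-∈ : ∀ {U} → (false , U) ∈ cs → (false , U) ∈ R
  set-∈ c∈ with ∈-++⁻ (map pairClass els) c∈
  ... | inj₂ c∈R = c∈R
  ... | inj₁ c∈p with _ , _ , () ← ∈-map⁻ pairClass c∈p

  after : Fin (length els) → List Elem
  after j = proj₁ (∈⇒Tail (∈-lookup {xs = els} j))

  after-Tail : ∀ j → Tail (lookup els j) (after j) els
  after-Tail j = proj₂ (∈⇒Tail (∈-lookup {xs = els} j))

  pairColour : Fin (length els) → ℕ
  pairColour j = length (tailPairs (after j))

  pairVertex : Fin (length els) → Bool → Vertex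
  pairVertex j b = pairColour j , true , [ (lookup els j , b) ]

  pairVertex-∈ : ∀ j b → pairVertex j b ∈ vs
  pairVertex-∈ j b = ∈-vertices⁺ (pair-Tail els (after-Tail j))

  abstract
    end : Fin (length els) → Bool → V
    end j b = vertex (pairVertex-∈ j b)

    D-end : ∀ j b → D (end j b) ≡ pairVertex j b
    D-end j b = D-vertex (pairVertex-∈ j b)

  pair-shape : ∀ j {v} → colour v ≡ pairColour j → isPair v ≡ true → support v ≡ [ lookup els j ] →
               ∃ λ b → v ≡ pairVertex j b
  pair-shape j {_ , _ , (_ , b) ∷ []} refl refl refl = b , refl

  data Kind : Vertex → Set where
    pair : ∀ j b → Kind (pairVertex j b)
    set  : ∀ {c x} → (false , map proj₁ x) ∈ R → Kind (c , false , x)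

  kind : ∀ u → Kind (D u)
  kind u with D u | D-class u
  ... | c , false , x | U , cs′ , t , _ , refl = set (set-∈ (Tail⇒∈ t))
  ... | c , true , x  | U , cs′ , t , c≡ , s≡
    with e , es , t′ , refl , refl ← pair-Tail⁻ els t with (.e , b) ∷ [] ← x | refl ← s≡ =
    subst Kind (cong₂ (λ c e → c , true , [ (e , b) ]) colour≡ (sym e≡)) (pair j b)
    where
    e∈ : e ∈ els
    e∈ = Tail⇒∈ t′
    j : Fin (length els)
    j = Any.index e∈
    e≡ : e ≡ lookup els j
    e≡ = Any.lookup-index e∈
    colour≡ : pairColour j ≡ c
    colour≡ = trans (cong (length ∘ tailPairs) (Tail-of-unique els-unique
      (subst (λ e → Tail e (after j) els) (sym e≡) (after-Tail j)) t′)) (sym c≡)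

  support⊆els : ∀ u {e} → e ∈ support (D u) → e ∈ els
  support⊆els u e∈ with D u | kind u
  ... | _ | pair j b with here refl ← e∈ = ∈-lookup j
  ... | _ | set x∈ = proj₂ (proj₂ (sets x∈)) e∈

  -- Every choice of elements to flip is an automorphism

  abstract
    flip-vertex : (Elem → Bool) → V → V
    flip-vertex z u = vertex (flip-∈ {cs} z (∈-lookup {xs = vs} u))

    D-flip : ∀ z u → D (flip-vertex z u) ≡ flip z (D u)
    D-flip z u = D-vertex (flip-∈ {cs} z (∈-lookup {xs = vs} u))

  flip-vertex-involutive : ∀ z u → flip-vertex z (flip-vertex z u) ≡ u
  flip-vertex-involutive z u = D-injective (begin
    D (flip-vertex z (flip-vertex z u))  ≡⟨ D-flip z (flip-vertex z u) ⟩
    flip z (D (flip-vertex z u))         ≡⟨ cong (flip z) (D-flip z u) ⟩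
    flip z (flip z (D u))                ≡⟨ flip-involutive z (D u) ⟩
    D u                                  ∎)
    where open ≡-Reasoning

  flipping : (Elem → Bool) → Automorphism G
  flipping z = record
    { perm = permutation (flip-vertex z) (flip-vertex z)
               (flip-vertex-involutive z) (flip-vertex-involutive z)
    ; preserves-edges = λ u v → trans (cong₂ adj (D-flip z u) (D-flip z v))
        (cong₂ _∨_ (meets-flip z (D u) (D v)) (meets-flip z (D v) (D u)))
    ; preserves-color = λ v → cong colour (D-flip z v)
    }

  -- Every automorphism is of this form

  module _ (φ : Automorphism G) where

    private
      φ⁺ : V → V
      φ⁺ u = perm φ ⟨$⟩ʳ u

    φ-injective : ∀ {u v} → φ⁺ u ≡ φ⁺ v → u ≡ v
    φ-injective eq = trans (sym (inverseˡ (perm φ))) (trans (cong (perm φ ⟨$⟩ˡ_) eq) (inverseˡ (perm φ)))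

    φ-class : ∀ u → isPair (D (φ⁺ u)) ≡ isPair (D u) × support (D (φ⁺ u)) ≡ support (D u)
    φ-class u = same-class (φ⁺ u) u (preserves-color φ u)

    -- Colours keep each pair in place as a set, so the image of its `false` end tells whether the
    -- two ends are swapped.
    flips : Fin (length els) → Bool
    flips j = firstValue (assignment (D (φ⁺ (end j false))))

    φ-end : ∀ j b → ∃ λ b′ → D (φ⁺ (end j b)) ≡ pairVertex j b′
    φ-end j b = pair-shape j
      (trans (preserves-color φ (end j b)) (cong colour (D-end j b)))
      (trans (proj₁ (φ-class (end j b))) (cong isPair (D-end j b)))
      (trans (proj₂ (φ-class (end j b))) (cong support (D-end j b)))

    D-φ-end : ∀ j b → D (φ⁺ (end j b)) ≡ pairVertex j (b xor flips j)
    D-φ-end j false with b′ , eq ← φ-end j false =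
      trans eq (cong (pairVertex j) (sym (cong (firstValue ∘ assignment) eq)))
    D-φ-end j true with b′ , eq ← φ-end j true =
      trans eq (cong (pairVertex j) (sym (not≡ distinct)))
      where
      distinct : flips j ≢ b′
      distinct refl = contradiction
        (trans (sym (D-end j false)) (trans (cong D (φ-injective (D-injective
          (trans (D-φ-end j false) (sym eq))))) (D-end j true)))
        λ ()

  extend : (Fin (length els) → Bool) → Elem → Bool
  extend ζ e with e ∈? els
  ... | yes e∈ = ζ (Any.index e∈)
  ... | no _   = false

  extend-lookup : ∀ ζ j → extend ζ (lookup els j) ≡ ζ j
  extend-lookup ζ j with lookup els j ∈? els
  ... | yes e∈ = cong ζ (lookup-injective els-unique _ j (sym (Any.lookup-index e∈)))
  ... | no e∉  = contradiction (∈-lookup j) e∉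

  extend-cong : ∀ {ζ η} → (∀ j → ζ j ≡ η j) → ∀ e → extend ζ e ≡ extend η e
  extend-cong ζ≡η e with e ∈? els
  ... | yes e∈ = ζ≡η (Any.index e∈)
  ... | no _   = refl

  flip-cong : ∀ {z z′} → (∀ e → z e ≡ z′ e) → ∀ v → flip z v ≡ flip z′ v
  flip-cong z≡z′ (c , f , x) = cong (λ x → c , f , x)
    (List.map-cong (λ (e , b) → cong (λ z → e , b xor z) (z≡z′ e)) x)

  flip-pair : ∀ ζ j b → flip (extend ζ) (pairVertex j b) ≡ pairVertex j (b xor ζ j)
  flip-pair ζ j b = cong (λ z → pairVertex j (b xor z)) (extend-lookup ζ j)

  -- On pairs this is what `flips` records. The neighbours of an assignment vertex are exactly the
  -- pair ends that it selects; an automorphism carries them to neighbours of the image, so the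
  -- image contains every flipped entry, and these entries determine it.
  D-φ : ∀ φ u → D (perm φ ⟨$⟩ʳ u) ≡ flip (extend (flips φ)) (D u)
  D-φ φ u with D u in eq | kind u
  ... | _ | pair j b = begin
    D (perm φ ⟨$⟩ʳ u)              ≡⟨ cong (λ u → D (perm φ ⟨$⟩ʳ u)) (D-injective (trans eq (sym (D-end j b)))) ⟩
    D (perm φ ⟨$⟩ʳ end j b)        ≡⟨ D-φ-end φ j b ⟩
    pairVertex j (b xor flips φ j) ≡⟨ flip-pair (flips φ) j b ⟨
    flip (extend (flips φ)) (pairVertex j b) ∎
    where open ≡-Reasoning
  ... | c , _ , x | set x∈
    with D (perm φ ⟨$⟩ʳ u) in eq′ | φ-class φ u | preserves-color φ u
  ... | c′ , f′ , x′ | f≡ , s′≡ | c≡ =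
    cong₂ _,_ (trans c≡ (cong colour eq)) (cong₂ _,_ f≡false
      (assignment-determined x′ (map (flipᴬ z) x)
        (trans s′≡′ (List.map-∘ x)) (subst Unique (List.map-∘ x) (proj₁ (proj₂ (sets x∈)))) flipped-∈))
    where
    z = extend (flips φ)
    f≡false = trans f≡ (cong isPair eq)
    s′≡′ = trans s′≡ (cong support eq)
    flipped-∈ : ∀ {a} → a ∈ map (flipᴬ z) x → a ∈ x′
    flipped-∈ a∈ with (e , b) , a∈x , refl ← ∈-map⁻ (flipᴬ z) a∈ = adj⁻ {pairColour j} {c′} (begin
      adj (pairColour j , true , [ flipᴬ z (e , b) ]) (c′ , false , x′)
        ≡⟨ cong₂ adj
             (sym (trans (D-φ-end φ j b) (trans (sym (flip-pair (flips φ) j b))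
                (cong (λ e → pairColour j , true , [ flipᴬ z (e , b) ]) (sym e≡)))))
             (sym (trans eq′ (cong (λ f → c′ , f , x′) f≡false))) ⟩
      adj (D (perm φ ⟨$⟩ʳ end j b)) (D (perm φ ⟨$⟩ʳ u))
        ≡⟨ preserves-edges φ (end j b) u ⟩
      adj (D (end j b)) (D u)
        ≡⟨ cong₂ adj (trans (D-end j b) (cong (λ e → pairColour j , true , [ (e , b) ]) (sym e≡))) eq ⟩
      adj (pairColour j , true , [ (e , b) ]) (c , false , x)
        ≡⟨ cong (_∨ false) (meets⁺ {pairColour j} {c} a∈x) ⟩
      true ∎)
      where
      open ≡-Reasoning
      e∈ : e ∈ els
      e∈ = proj₂ (proj₂ (sets x∈)) (∈-map⁺ proj₁ a∈x)
      j : Fin (length els)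
      j = Any.index e∈
      e≡ : e ≡ lookup els j
      e≡ = Any.lookup-index e∈

  flips-flipping : ∀ ζ j → flips (flipping (extend ζ)) j ≡ ζ j
  flips-flipping ζ j = cong (firstValue ∘ assignment) (trans (D-flip (extend ζ) (end j false))
    (trans (cong (flip (extend ζ)) (D-end j false)) (flip-pair ζ j false)))

  flips-cong : ∀ φ ψ → Group._≈_ (Aut G) φ ψ → ∀ j → flips φ j ≡ flips ψ j
  flips-cong φ ψ φ≈ψ j = cong (firstValue ∘ assignment ∘ D) (φ≈ψ (end j false))

  flips-∙ : ∀ φ ψ j → flips (Group._∙_ (Aut G) φ ψ) j ≡ flips φ j xor flips ψ j
  flips-∙ φ ψ j = cong (firstValue ∘ assignment) (begin
    D (perm ψ ⟨$⟩ʳ (perm φ ⟨$⟩ʳ end j false))              ≡⟨ D-φ ψ _ ⟩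
    flip (extend (flips ψ)) (D (perm φ ⟨$⟩ʳ end j false))  ≡⟨ cong (flip _) (D-φ-end φ j false) ⟩
    flip (extend (flips ψ)) (pairVertex j (flips φ j))     ≡⟨ flip-pair (flips ψ) j (flips φ j) ⟩
    pairVertex j (flips φ j xor flips ψ j)                 ∎)
    where open ≡-Reasoning

  flips-ε : ∀ j → flips (Group.ε (Aut G)) j ≡ false
  flips-ε j = cong (firstValue ∘ assignment) (D-end j false)

  flips-injective : ∀ φ ψ → (∀ j → flips φ j ≡ flips ψ j) → Group._≈_ (Aut G) φ ψ
  flips-injective φ ψ eq u = D-injective (trans (D-φ φ u)
    (trans (flip-cong (extend-cong eq) (D u)) (sym (D-φ ψ u))))

  elementary : Elementary2Group (Aut G)
  elementary = length els , flips , record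
    { isGroupMonomorphism = record
        { isGroupHomomorphism = record
            { isMonoidHomomorphism = record
                { isMagmaHomomorphism = record
                    { isRelHomomorphism = record { cong = λ {φ} {ψ} → flips-cong φ ψ }
                    ; homo = flips-∙
                    }
                ; ε-homo = flips-ε
                }
            -- Negation in `𝔽₂` is the identity, so an automorphism and its inverse have to make the
            -- same swaps; they do because their product makes none.
            ; ⁻¹-homo = λ φ j → xor≡false (trans (sym (flips-∙ (Group._⁻¹ (Aut G) φ) φ j))
                (trans (flips-cong (Group._∙_ (Aut G) (Group._⁻¹ (Aut G) φ) φ) (Group.ε (Aut G))
                  (Group.inverseˡ (Aut G) φ) j) (flips-ε j)))
            }
        ; injective = λ {φ} {ψ} → flips-injective φ ψ
        }
    ; surjective = λ ζ → flipping (extend ζ) , λ {φ} φ≈ j →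
        trans (flips-cong φ (flipping (extend ζ)) φ≈ j) (flips-flipping ζ j)
    }
    where
    xor≡false : ∀ {b c} → b xor c ≡ false → b ≡ c
    xor≡false {false} eq = sym eq
    xor≡false {true} {true} _ = refl

  -- The vertices of S fix everything iff their supports cover all elements

  Supported : Subset order → Set
  Supported S = ∀ {e} → e ∈ els → ∃ λ u → u ∈ˢ S × e ∈ support (D u)

  flip-fixed : ∀ z v → flip z v ≡ v → ∀ {e} → e ∈ support v → z e ≡ false
  flip-fixed z (c , f , x) eq e∈ = go x (cong assignment eq) e∈
    where
    go : ∀ x → map (flipᴬ z) x ≡ x → ∀ {e} → e ∈ map proj₁ x → z e ≡ false
    go ((e , b) ∷ x) eq (here refl) = xor-fixed b (,-injectiveʳ (List.∷-injectiveˡ eq))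
      where
      xor-fixed : ∀ b {c} → b xor c ≡ b → c ≡ false
      xor-fixed false eq = eq
      xor-fixed true {false} _ = refl
    go (_ ∷ x) eq (there e∈) = go x (List.∷-injectiveʳ eq) e∈

  flip-fixes : ∀ z v → (∀ {e} → e ∈ support v → z e ≡ false) → flip z v ≡ v
  flip-fixes z (c , f , x) z≡ = cong (λ x → c , f , x) (go x z≡)
    where
    go : ∀ x → (∀ {e} → e ∈ map proj₁ x → z e ≡ false) → map (flipᴬ z) x ≡ x
    go []            _  = refl
    go ((e , b) ∷ x) z≡ = cong₂ _∷_
      (cong (e ,_) (trans (cong (b xor_) (z≡ (here refl))) (Bool.xor-identityʳ b))) (go x (z≡ ∘ there))

  -- Were `e` in no support of a vertex of `S`, flipping `e` alone would fix `S` and still swap the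
  -- pair of `e`.
  rigid⇒supported : ∀ S → (∀ φ → Fixes G φ S → Group._≈_ (Aut G) φ (Group.ε (Aut G))) → Supported S
  rigid⇒supported S rigid {e} e∈ with Fin.any? (λ u → (u Subset.∈? S) ×-dec (e ∈? support (D u)))
  ... | yes found = found
  ... | no none = contradiction (flip-fixed z (D (end j false)) moved (subst (e ∈_) (cong support (sym (D-end j false))) (here e≡)))
                    (λ ze≡ → subst T ze≡ (≡ᴱ-refl e))
    where
    z : Elem → Bool
    z = e ≡ᴱ_
    j : Fin (length els)
    j = Any.index e∈
    e≡ : e ≡ lookup els j
    e≡ = Any.lookup-index e∈
    fixed : ∀ u → u ∈ˢ S → flip-vertex z u ≡ u
    fixed u u∈ = D-injective (trans (D-flip z u) (flip-fixes z (D u) λ {e′} e′∈ →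
      Bool.¬-not λ eq → none (u , u∈ , subst (_∈ support (D u)) (sym (≡ᴱ⇒≡ e e′ (true⇒T eq))) e′∈)))
    moved : flip z (D (end j false)) ≡ D (end j false)
    moved = trans (sym (D-flip z (end j false))) (cong D (rigid (flipping z) fixed (end j false)))

  -- Every automorphism is a flip, and a flip that fixes a vertex leaves alone all elements of its
  -- support.
  supported⇒rigid : ∀ S → Supported S → ∀ φ → Fixes G φ S → Group._≈_ (Aut G) φ (Group.ε (Aut G))
  supported⇒rigid S supported φ fixes u = D-injective (trans (D-φ φ u)
    (flip-fixes (extend (flips φ)) (D u) (λ e∈ → unmoved (support⊆els u e∈))))
    where
    unmoved : ∀ {e} → e ∈ els → extend (flips φ) e ≡ false
    unmoved e∈ with u , u∈ , e∈u ← supported e∈ =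
      flip-fixed (extend (flips φ)) (D u) (trans (sym (D-φ φ u)) (cong D (fixes u u∈))) e∈u

-- Subsets given by lists of members

fromList : ∀ {n} → List (Fin n) → Subset n
fromList = foldr (λ i S → S [ i ]≔ inside) ∅

∈-insert⁻ : ∀ {n} (S : Subset n) i {j} → j ∈ˢ S [ i ]≔ inside → j ≡ i ⊎ j ∈ˢ S
∈-insert⁻ (_ ∷ S) zero    here       = inj₁ refl
∈-insert⁻ (_ ∷ S) zero    (there j∈) = inj₂ (there j∈)
∈-insert⁻ (_ ∷ S) (suc i) here       = inj₂ here
∈-insert⁻ (_ ∷ S) (suc i) (there j∈) = Sum.map (cong suc) there (∈-insert⁻ S i j∈)

∈-insert⁺ : ∀ {n} (S : Subset n) i {j} → j ≡ i ⊎ j ∈ˢ S → j ∈ˢ S [ i ]≔ inside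
∈-insert⁺ S i (inj₁ refl) = Vec.[]≔-updates S i
∈-insert⁺ S i {j} (inj₂ j∈) with i Fin.≟ j
... | yes refl = Vec.[]≔-updates S i
... | no i≢j   = Vec.[]≔-minimal S j i (i≢j ∘ sym) j∈

∣insert∣ : ∀ {n} (S : Subset n) i → i ∉ˢ S → ∣ S [ i ]≔ inside ∣ ≡ suc ∣ S ∣
∣insert∣ (inside  ∷ S) zero    i∉ = contradiction here i∉
∣insert∣ (outside ∷ S) zero    i∉ = refl
∣insert∣ (inside  ∷ S) (suc i) i∉ = cong suc (∣insert∣ S i (i∉ ∘ there))
∣insert∣ (outside ∷ S) (suc i) i∉ = ∣insert∣ S i (i∉ ∘ there)

∈-fromList⁻ : ∀ {n} (is : List (Fin n)) {j} → j ∈ˢ fromList is → j ∈ is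
∈-fromList⁻ []       j∈ = contradiction j∈ Subset.∉⊥
∈-fromList⁻ (i ∷ is) j∈ = Sum.[ here , there ∘ ∈-fromList⁻ is ] (∈-insert⁻ (fromList is) i j∈)

∈-fromList⁺ : ∀ {n} {is : List (Fin n)} {j} → j ∈ is → j ∈ˢ fromList is
∈-fromList⁺ {is = i ∷ is} (here eq)  = ∈-insert⁺ (fromList is) i (inj₁ eq)
∈-fromList⁺ {is = i ∷ is} (there j∈) = ∈-insert⁺ (fromList is) i (inj₂ (∈-fromList⁺ j∈))

∣fromList∣ : ∀ {n} {is : List (Fin n)} → Unique is → ∣ fromList is ∣ ≡ length is
∣fromList∣ {n} []      = Subset.∣⊥∣≡0 n
∣fromList∣ {is = i ∷ is} (i∉ ∷ u) = trans
  (∣insert∣ (fromList is) i (λ i∈ → All.lookup i∉ (∈-fromList⁻ is i∈) refl))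
  (cong suc (∣fromList∣ u))

-- Pigeonhole: a member of `S` that `v` misses would, together with the values of `v`, make `k + 1`
-- distinct members.
injection-onto : ∀ {n k} (S : Subset n) (v : Fin k → Fin n) → ∣ S ∣ ≡ k →
                 (∀ {i j} → v i ≡ v j → i ≡ j) → (∀ i → v i ∈ˢ S) →
                 ∀ {u} → u ∈ˢ S → ∃ λ j → v j ≡ u
injection-onto {k = k} S v ∣S∣≡k v-inj v∈ {u} u∈ with Fin.any? (λ j → v j Fin.≟ u)
... | yes found = found
... | no none   = contradiction
  (subst₂ _≤_ (trans (∣fromList∣ unique) (cong suc (List.length-tabulate v))) ∣S∣≡k
    (Subset.p⊆q⇒∣p∣≤∣q∣ λ i∈ → ⊆S (∈-fromList⁻ (u ∷ tabulate v) i∈)))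
  (n≮n k)
  where
  unique : Unique (u ∷ tabulate v)
  unique = All.tabulate (λ { i∈ refl → let j , eq = ∈-tabulate⁻ i∈ in none (j , sym eq) }) ∷
           Unique.tabulate⁺ v-inj
  ⊆S : ∀ {i} → i ∈ u ∷ tabulate v → i ∈ˢ S
  ⊆S (here refl) = u∈
  ⊆S (there i∈) with j , refl ← ∈-tabulate⁻ i∈ = v∈ j

-- Coverings by choices and supporting sets of vertices

Chosen-mentions : ∀ {bs ls e} → Chosen bs ls → e ∈ concat ls → ∃ λ b → b ∈ bs × mentions b e
Chosen-mentions {bs = b ∷ bs} {l ∷ ls} (c ∷ cs) e∈ with ∈-++⁻ l e∈
... | inj₁ e∈l = b , here refl , Sum.map (λ { refl → e∈l }) (λ { refl → e∈l }) c
... | inj₂ e∈r = let b , b∈ , m = Chosen-mentions cs e∈r in b , there b∈ , m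

Chosen-++⁻ : ∀ (bs : List (X × X)) {cs ls} → Chosen (bs ++ cs) ls →
             ∃₂ λ l m → ls ≡ l ++ m × Chosen bs l × Chosen cs m
Chosen-++⁻ []       ch       = [] , _ , refl , [] , ch
Chosen-++⁻ (b ∷ bs) (c ∷ ch) =
  let l , m , eq , d , e = Chosen-++⁻ bs ch in _ , m , cong (_ ∷_) eq , c ∷ d , e

Chosen-concat⁻ : ∀ (Bs : List (List (X × X))) {ls} → Chosen (concat Bs) ls →
                 ∃ λ lss → Pointwise Chosen Bs lss × ls ≡ concat lss
Chosen-concat⁻ []       []  = [] , [] , refl
Chosen-concat⁻ (B ∷ Bs) ch
  with ls , ls′ , refl , c , cs ← Chosen-++⁻ B ch
  with lss , p , refl ← Chosen-concat⁻ Bs cs = ls ∷ lss , c ∷ p , refl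

-- Merges one choice per block into a choice for all bits while keeping, for each block, the
-- property of its own share. `Q` knows a block only by its index, the number of later blocks.
Chosen-assemble : ∀ {Q : ℕ → List X → Set} Bs →
                  (∀ {B Bs′} → Tail B Bs′ Bs → ∃ λ ls → Chosen B ls × Q (length Bs′) ls) →
                  ∃ λ ls → Chosen (concat Bs) ls ×
                    (∀ {B Bs′} → Tail B Bs′ Bs → ∃ λ ls′ → Q (length Bs′) ls′ × (∀ {l} → l ∈ ls′ → l ∈ ls))
Chosen-assemble []       f = [] , [] , λ ()
Chosen-assemble {Q = Q} (B ∷ Bs) f
  with l , c , q ← f here
  with ls , cs , g ← Chosen-assemble {Q = Q} Bs (f ∘ there) =
  l ++ ls , Pointwise.++⁺ c cs , λ where
    here      → l , q , ∈-++⁺ˡ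
    (there t) → let l′ , q′ , l′⊆ = g t in l′ , q′ , ∈-++⁺ʳ l ∘ l′⊆

selector : ℕ → Elem
selector j = 3 , j , 0

selector-injective : ∀ {i j} → selector i ≡ selector j → i ≡ j
selector-injective refl = refl

-- The bound on the tags reserves the tag 3 for selectors, so that no bit mentions one.
module _ (Bs : List (List Bit))
         (tags : ∀ {B b e} → B ∈ Bs → b ∈ B → mentions b e → proj₁ e ≤ 2) where

  private
    F : List (List Elem)
    F = family Bs

    els : List Elem
    els = elements F

    R : List Class
    R = map (λ U → false , nub U) F

  els-unique : Unique els
  els-unique = nub-unique (concat F)

  els-∈ : ∀ {U e} → U ∈ F → e ∈ U → e ∈ els
  els-∈ U∈ e∈ = ∈-nub⁺ (∈-concat⁺′ e∈ U∈)

  sets : ∀ {c} → c ∈ R → proj₁ c ≡ false × Unique (proj₂ c) × (∀ {e} → e ∈ proj₂ c → e ∈ els)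
  sets c∈ with U , U∈ , refl ← ∈-map⁻ (λ U → false , nub U) c∈ =
    refl , nub-unique U , λ e∈ → els-∈ U∈ (∈-nub⁻ U e∈)

  private
    G : ColoredGraph
    G = graph (vertices (classes F))

    D : Fin (ColoredGraph.order G) → Vertex
    D = lookup (vertices (classes F))

  data BlockSet : List Elem → Set where
    blockSet : ∀ {B Bs′ ls} → Tail B Bs′ Bs → Chosen B ls →
               BlockSet (selector (length Bs′) ∷ concat ls)

  ∈-family⁻ : ∀ {U} → U ∈ F → BlockSet U
  ∈-family⁻ U∈ with B , Bs′ , t , U∈B ← ∈-gather⁻ Bs U∈
    with ls , ls∈ , refl ← ∈-map⁻ _ U∈B = blockSet t (∈-choices⁻ B ls∈)

  ∈-family⁺ : ∀ {U} → BlockSet U → U ∈ F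
  ∈-family⁺ (blockSet t c) = ∈-gather⁺ t (∈-map⁺ _ (∈-choices⁺ c))

  no-selector : ∀ {B ls j} → B ∈ Bs → Chosen B ls → selector j ∉ concat ls
  no-selector B∈ c e∈ with b , b∈ , m ← Chosen-mentions c e∈ = n≮n 2 (tags B∈ b∈ m)

  selector-∈ : ∀ {B Bs′ ls j} → Tail B Bs′ Bs → Chosen B ls →
               selector j ∈ selector (length Bs′) ∷ concat ls → j ≡ length Bs′
  selector-∈ t c (here eq)  = selector-injective eq
  selector-∈ t c (there e∈) = contradiction e∈ (no-selector (Tail⇒∈ t) c)

  data SupportView (es : List Elem) : Set where
    single : ∀ {e} → es ≡ [ e ] → SupportView es
    set    : ∀ {U} → BlockSet U → es ≡ nub U → SupportView es

  supportView : ∀ u → SupportView (support (D u))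
  supportView u with D u | kind els-unique sets u
  ... | _ | pair j b = single refl
  ... | _ | set x∈ with U , U∈ , eq ← ∈-map⁻ (λ U → false , nub U) x∈ =
    set (∈-family⁻ U∈) (,-injectiveʳ eq)

  -- This prevents one vertex from serving two blocks, on which the counting of `S` against the
  -- blocks rests.
  one-selector : ∀ u {i j} → selector i ∈ support (D u) → selector j ∈ support (D u) → i ≡ j
  one-selector u i∈ j∈ with support (D u) | supportView u
  ... | _ | single refl with here eq ← i∈ | here eq′ ← j∈ = selector-injective (trans eq (sym eq′))
  ... | _ | set (blockSet t c) refl =
    trans (selector-∈ t c (∈-nub⁻ _ i∈)) (sym (selector-∈ t c (∈-nub⁻ _ j∈)))

  pick-all : ∀ (B : List Bit) b → Chosen B (map (pick b) B)
  pick-all B b = map-pick-chosen (λ _ → b)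

  abstract
    selector-element : ∀ {B Bs′} → Tail B Bs′ Bs → selector (length Bs′) ∈ els
    selector-element {B} t = els-∈ (∈-family⁺ (blockSet t (pick-all B false))) (here refl)

  -- Each value of a bit occurs in the choice that gives this value to its whole block.
  mentioned-element : ∀ {B b e} → B ∈ Bs → b ∈ B → mentions b e → e ∈ els
  mentioned-element {B} {b} {e} B∈ b∈ m = Sum.[ by false , by true ] m
    where
    by : ∀ c → e ∈ pick c b → e ∈ els
    by c e∈ = els-∈ (∈-family⁺ (blockSet (proj₂ (∈⇒Tail B∈)) (pick-all B c)))
                    (there (∈-concat⁺′ e∈ (∈-map⁺ (pick c) b∈)))

  -- The vertex may be an end of the selector's own pair; it supports nothing further, and an
  -- arbitrary choice explains it. Otherwise it is an assignment to a set, and the selector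
  -- identifies the block of that set.
  explain : ∀ {B Bs′ es} → Tail B Bs′ Bs → SupportView es → selector (length Bs′) ∈ es →
            ∃ λ ls → Chosen B ls × (∀ {e} → e ∈ es → e ≡ selector (length Bs′) ⊎ e ∈ concat ls)
  explain {B} t (single refl) (here refl) = _ , pick-all B false , λ { (here eq) → inj₁ eq }
  explain t (set (blockSet {ls = ls} t′ c) refl) s∈
    with refl , refl ← Tail-unique t t′ (selector-∈ t′ c (∈-nub⁻ _ s∈)) =
    ls , c , λ e∈ → case ∈-nub⁻ _ e∈ of λ { (here eq) → inj₁ eq ; (there e∈ls) → inj₂ e∈ls }

  Supporting : Set
  Supporting = ∃ λ S → ∣ S ∣ ≡ length Bs × Supported els-unique sets S

  -- There are as many selectors as vertices in `S`, each supported by some vertex and no two by the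
  -- same one. So every vertex of `S` guards exactly one block, is explained by a choice for that
  -- block, and these choices cover whatever `S` supports besides selectors.
  supporting⇒coverable : Supporting → Coverable (concat Bs)
  supporting⇒coverable (S , ∣S∣≡ , supported) =
    let ls , ch , blocks = Chosen-assemble {Q = Explains} Bs choice in ls , ch , covers blocks
    where
    Explains : ℕ → List (List Elem) → Set
    Explains j ls = ∀ u → u ∈ˢ S → selector j ∈ support (D u) →
                    ∀ {e} → e ∈ support (D u) → e ≡ selector j ⊎ e ∈ concat ls

    guard : Fin (length Bs) → Fin (ColoredGraph.order G)
    guard j = let _ , _ , t , _ = Tail-exists Bs (Fin.toℕ<n j) in proj₁ (supported (selector-element t))

    guard∈S : ∀ j → guard j ∈ˢ S
    guard∈S j = let _ , _ , t , _ = Tail-exists Bs (Fin.toℕ<n j) in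
      proj₁ (proj₂ (supported (selector-element t)))

    guard-selector : ∀ j → selector (toℕ j) ∈ support (D (guard j))
    guard-selector j = let _ , _ , t , eq = Tail-exists Bs (Fin.toℕ<n j) in
      subst (λ i → selector i ∈ support (D (guard j))) eq (proj₂ (proj₂ (supported (selector-element t))))

    guard-block : ∀ j → ∃₂ λ B Bs′ → Tail B Bs′ Bs × selector (length Bs′) ∈ support (D (guard j))
    guard-block j = let B , Bs′ , t , _ = Tail-exists Bs (Fin.toℕ<n j) in
      B , Bs′ , t , proj₂ (proj₂ (supported (selector-element t)))

    guard-injective : ∀ {i j} → guard i ≡ guard j → i ≡ j
    guard-injective {i} {j} eq = Fin.toℕ-injective (one-selector (guard j)
      (subst (λ u → selector (toℕ i) ∈ support (D u)) eq (guard-selector i)) (guard-selector j))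

    guard-onto : ∀ {u} → u ∈ˢ S → ∃ λ j → guard j ≡ u
    guard-onto = injection-onto S guard ∣S∣≡ guard-injective guard∈S

    same-guard : ∀ {u v j} → u ∈ˢ S → v ∈ˢ S → selector j ∈ support (D u) → selector j ∈ support (D v) → u ≡ v
    same-guard {u} {v} u∈ v∈ eu ev with i , refl ← guard-onto u∈ | i′ , refl ← guard-onto v∈ =
      cong guard (Fin.toℕ-injective (trans (one-selector u (guard-selector i) eu)
                                           (one-selector v ev (guard-selector i′))))

    choice : ∀ {B Bs′} → Tail B Bs′ Bs → ∃ λ ls → Chosen B ls × Explains (length Bs′) ls
    choice t with u , u∈ , eu ← supported (selector-element t)
      with ls , c , es⊆ ← explain t (supportView u) eu =
      ls , c , λ v v∈ ev e∈ → es⊆ (subst (λ v → _ ∈ support (D v)) (same-guard v∈ u∈ ev eu) e∈)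

    covers : ∀ {ls} → (∀ {B Bs′} → Tail B Bs′ Bs →
               ∃ λ ls′ → Explains (length Bs′) ls′ × (∀ {l} → l ∈ ls′ → l ∈ ls)) → Covers ls (concat Bs)
    covers blocks b∈ m with B , b∈B , B∈ ← ∈-concat⁻′ Bs b∈
      with u , u∈ , e∈u ← supported (mentioned-element B∈ b∈B m)
      with j , refl ← guard-onto u∈
      with _ , _ , t , s∈ ← guard-block j
      with ls′ , explains , ls′⊆ ← blocks t
      with explains (guard j) u∈ s∈ e∈u
    ... | inj₁ refl = contradiction (tags B∈ b∈B m) (n≮n 2)
    ... | inj₂ e∈ with l , e∈l , l∈ ← ∈-concat⁻′ ls′ e∈ = ∈-concat⁺′ e∈l (ls′⊆ l∈)

  block-vertex : ∀ {U} → U ∈ F → ∃ λ u → support (D u) ≡ nub U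
  block-vertex {U} U∈
    with _ , t ← ∈⇒Tail (∈-++⁺ʳ (map (λ e → true , [ e ]) els) (∈-map⁺ (λ U → false , nub U) U∈)) =
    Any.index v∈ , trans (cong support (sym (Any.lookup-index v∈))) map-proj₁
    where
    x : List (Elem × Bool)
    -- Every assignment to `U` has the same support, and the support alone matters; the constant one
    -- is taken.
    x = map (_, false) (nub U)
    map-proj₁ : map proj₁ x ≡ nub U
    map-proj₁ = trans (sym (List.map-∘ (nub U))) (List.map-id (nub U))
    v∈ = ∈-vertices⁺ {f = false} {x} (subst (λ U → Tail (false , U) _ (classes F)) (sym map-proj₁) t)

  -- Induction over the suffixes `Cs` of `Bs`, where block indices agree with those in `Bs`. The
  -- vertices found so far have selectors with index below `length Cs`, so the vertex of the next
  -- block, whose selector has exactly this index, is new.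
  block-vertices : ∀ {Cs lss} → (∀ {B Bs′} → Tail B Bs′ Cs → Tail B Bs′ Bs) → Pointwise Chosen Cs lss →
    ∃ λ us → length us ≡ length Cs × Unique us ×
      (∀ {u} → u ∈ us → ∃ λ j → j < length Cs × selector j ∈ support (D u)) ×
      (∀ {B Bs′} → Tail B Bs′ Cs → ∃ λ u → u ∈ us × selector (length Bs′) ∈ support (D u)) ×
      (∀ {e} → e ∈ concat (concat lss) → ∃ λ u → u ∈ us × e ∈ support (D u))
  block-vertices _ [] = [] , refl , [] , (λ ()) , (λ ()) , λ ()
  block-vertices {B ∷ Cs} {ls ∷ lss} tails (c ∷ cs)
    with us , length≡ , unique , selectors , guards , covered ← block-vertices (tails ∘ there) cs
    with u , s≡ ← block-vertex (∈-family⁺ (blockSet (tails here) c)) =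
    u ∷ us , cong suc length≡ , All.tabulate u≢ ∷ unique ,
    (λ { (here refl) → length Cs , ≤-refl , selector∈
       ; (there v∈)  → let j , j< , s∈ = selectors v∈ in j , m≤n⇒m≤1+n j< , s∈ }) ,
    (λ { here      → u , here refl , selector∈
       ; (there t) → let v , v∈ , s∈ = guards t in v , there v∈ , s∈ }) ,
    λ e∈ → case-concat (∈-++⁻ (concat ls) (subst (_ ∈_) (sym (List.concat-++ ls (concat lss))) e∈))
    where
    selector∈ : selector (length Cs) ∈ support (D u)
    selector∈ = subst (_ ∈_) (sym s≡) (∈-nub⁺ {selector (length Cs) ∷ concat ls} (here refl))
    u≢ : ∀ {v} → v ∈ us → u ≢ v
    u≢ v∈ refl with j , j< , s∈ ← selectors v∈ = <⇒≢ j< (one-selector u s∈ selector∈)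
    case-concat : ∀ {e} → e ∈ concat ls ⊎ e ∈ concat (concat lss) → ∃ λ v → v ∈ u ∷ us × e ∈ support (D v)
    case-concat (inj₁ e∈) = u , here refl , subst (_ ∈_) (sym s≡) (∈-nub⁺ {selector (length Cs) ∷ concat ls} (there e∈))
    case-concat (inj₂ e∈) = let v , v∈ , e∈v = covered e∈ in v , there v∈ , e∈v

  -- One vertex per block is taken, for the set of its choice. An element is either a selector,
  -- supported by the vertex of its block, or mentioned by a bit and so in one of the chosen lists.
  coverable⇒supporting : Coverable (concat Bs) → Supporting
  coverable⇒supporting (ls , ch , cov) with lss , cs , refl ← Chosen-concat⁻ Bs ch
    with us , length≡ , unique , _ , guards , covered ← block-vertices id cs =
    fromList us , trans (∣fromList∣ unique) length≡ , supported
    where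
    supported : Supported els-unique sets (fromList us)
    supported e∈ with U , e∈U , U∈ ← ∈-concat⁻′ F (∈-nub⁻ (concat F) e∈) with ∈-family⁻ U∈ | e∈U
    ... | blockSet t c | here refl = let u , u∈ , s∈ = guards t in u , ∈-fromList⁺ u∈ , s∈
    ... | blockSet t c | there e∈c with b , b∈ , m ← Chosen-mentions c e∈c
      with u , u∈ , e∈u ← covered (cov (∈-concat⁺′ b∈ (Tail⇒∈ t)) m) = u , ∈-fromList⁺ u∈ , e∈u

-- Types encoded as trees

record Coded : Set₁ where
  field
    Carrier : Set
    enc     : Carrier → Tree

  -- The successor makes this at least 2, so raising the exponent absorbs constants and sums.
  base : Carrier → ℕ
  base x = suc (size (enc x))

open Coded

private
  variable
    A B C Γ S : Coded

Unitᶜ Boolᶜ ℕᶜ : Coded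
Unitᶜ = record { Carrier = ⊤ ; enc = λ _ → nil }
Boolᶜ = record { Carrier = Bool ; enc = encodeBool }
ℕᶜ    = record { Carrier = ℕ ; enc = encodeℕ }

infixr 2 _×ᶜ_

_×ᶜ_ : Coded → Coded → Coded
A ×ᶜ B = record { Carrier = Carrier A × Carrier B
                ; enc = λ p → enc A (proj₁ p) • enc B (proj₂ p) }

Listᶜ : Coded → Coded
Listᶜ A = record { Carrier = List (Carrier A) ; enc = encodeList (enc A) }

1≤size : ∀ x → 1 ≤ size x
1≤size nil     = ≤-refl
1≤size (x • y) = s≤s z≤n

sizes : (A : Coded) → List (Carrier A) → ℕ
sizes A xs = size (enc (Listᶜ A) xs)

length≤sizes : ∀ xs → length xs ≤ sizes A xs
length≤sizes         []       = z≤n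
length≤sizes {A = A} (x ∷ xs) =
  s≤s (≤-trans (length≤sizes {A} xs) (m≤n+m _ (size (enc A x))))

sizes-++ : ∀ xs ys → sizes A (xs ++ ys) ≤ sizes A xs + sizes A ys
sizes-++         []       ys = n≤1+n _
sizes-++ {A = A} (x ∷ xs) ys = s≤s (begin
  a + sizes A (xs ++ ys)           ≤⟨ +-monoʳ-≤ a (sizes-++ {A} xs ys) ⟩
  a + (sizes A xs + sizes A ys)    ≡⟨ sym (+-assoc a _ _) ⟩
  a + sizes A xs + sizes A ys      ∎)
  where
  open ≤-Reasoning
  a = size (enc A x)

sizes-++ʳ : ∀ xs ys → sizes A ys ≤ sizes A (xs ++ ys)
sizes-++ʳ         []       ys = ≤-refl
sizes-++ʳ {A = A} (x ∷ xs) ys =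
  ≤-trans (sizes-++ʳ {A} xs ys) (≤-trans (m≤n+m _ (size (enc A x))) (n≤1+n _))

size-∈ : ∀ {x xs} → x ∈ xs → size (enc A x) ≤ sizes A xs
size-∈         (here refl) = ≤-trans (m≤m+n _ _) (n≤1+n _)
size-∈ {A = A} (there {x = y} x∈) =
  ≤-trans (size-∈ {A} x∈) (≤-trans (m≤n+m _ (size (enc A y))) (n≤1+n _))

-- A bound on the running time is thereby one on the input of the next program, which makes
-- polynomial time closed under composition.
output≤time : ∀ {p x y t} → p ⊢ x ⇓ y ∶ t → size y ≤ t
output≤time skip             = ≤-refl
output≤time {x = x} ⟪nil⟫    = 1≤size x
output≤time hd-nil           = ≤-refl
output≤time (hd-• {x})       = ≤-trans (m≤m+n (size x) _) (n≤1+n _)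
output≤time tl-nil           = ≤-refl
output≤time (tl-• {x})       = m≤n+m _ (suc (size x))
output≤time (seq _ q)        = ≤-trans (output≤time q) (m≤n+m _ _)
output≤time (pair {x = x} p q) =
  +-mono-≤ (+-mono-≤ (1≤size x) (output≤time p)) (output≤time q)
output≤time (if-true {x = x} _ p)   = ≤-trans (output≤time p) (m≤n+m _ _)
output≤time (if-false _ q)   = ≤-trans (output≤time q) (m≤n+m _ _)
output≤time (while-true _ _ r) = ≤-trans (output≤time r) (m≤n+m _ _)
output≤time (while-false _)  = m≤m+n _ _

-- Polynomial bounds

-- Over a base of at least 2 every polynomial is dominated by a single power, so a degree is all
-- that has to be stored.
record BoundOn (A : Coded) (P : Carrier A → Set) (h : Carrier A → ℕ) : Set where
  constructor bound
  field
    degree  : ℕ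
    bounded : ∀ x → P x → h x ≤ base A x ^ degree

open BoundOn

private
  variable
    P Q : X → Set

2≤base : ∀ x → 2 ≤ base A x
2≤base {A} x = s≤s (1≤size (enc A x))

base-mono : ∀ x {m n} → m ≤ n → base A x ^ m ≤ base A x ^ n
base-mono {A} x m≤n = ^-monoʳ-≤ (base A x) m≤n

n≤2^n : ∀ n → n ≤ 2 ^ n
n≤2^n zero    = z≤n
n≤2^n (suc n) = begin
  1 + n            ≤⟨ +-mono-≤ (m^n>0 2 n) (n≤2^n n) ⟩
  2 ^ n + 2 ^ n    ≡⟨ cong (2 ^ n +_) (+-identityʳ _) ⟨
  2 ^ suc n        ∎
  where open ≤-Reasoning

bound-≤ : ∀ {h h′} → (∀ x → P x → h x ≤ h′ x) → BoundOn A P h′ → BoundOn A P h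
bound-≤ h≤h′ (bound d b) = bound d (λ x p → ≤-trans (h≤h′ x p) (b x p))

bound-const : ∀ n → BoundOn A P (λ _ → n)
bound-const {A = A} n = bound n (λ x _ → ≤-trans (n≤2^n n) (^-monoˡ-≤ n (2≤base {A} x)))

bound-size : BoundOn A P (λ x → size (enc A x))
bound-size = bound 1 (λ x _ → ≤-trans (n≤1+n _) (≤-reflexive (sym (*-identityʳ _))))

infixl 6 _⊕_
infixl 7 _⊗_

_⊕_ : ∀ {h h′} → BoundOn A P h → BoundOn A P h′ → BoundOn A P (λ x → h x + h′ x)
_⊕_ {A = A} {h = h} {h′} (bound c b) (bound d b′) = bound (1 + (c + d)) λ x p → begin
  h x + h′ x                                ≤⟨ +-mono-≤ (b x p) (b′ x p) ⟩
  base A x ^ c + base A x ^ d               ≤⟨ +-mono-≤ (base-mono {A} x (m≤m+n c d)) (base-mono {A} x (m≤n+m d c)) ⟩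
  base A x ^ (c + d) + base A x ^ (c + d)   ≡⟨ cong (base A x ^ (c + d) +_) (+-identityʳ _) ⟨
  2 * base A x ^ (c + d)                    ≤⟨ *-monoˡ-≤ _ (2≤base {A} x) ⟩
  base A x ^ (1 + (c + d))                  ∎
  where open ≤-Reasoning

_⊗_ : ∀ {h h′} → BoundOn A P h → BoundOn A P h′ → BoundOn A P (λ x → h x * h′ x)
_⊗_ {A = A} {h = h} {h′} (bound c b) (bound d b′) = bound (c + d) λ x p → begin
  h x * h′ x                   ≤⟨ *-mono-≤ (b x p) (b′ x p) ⟩
  base A x ^ c * base A x ^ d  ≡⟨ ^-distribˡ-+-* (base A x) c d ⟨
  base A x ^ (c + d)           ∎
  where open ≤-Reasoning

bound-^ : ∀ {h} n → BoundOn A P h → BoundOn A P (λ x → h x ^ n)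
bound-^ zero    b = bound-const 1
bound-^ (suc n) b = b ⊗ bound-^ n b

bound-∘ : ∀ {h} {f : Carrier A → Carrier B} → BoundOn B Q h → (∀ x → P x → Q (f x)) →
          BoundOn A P (λ x → size (enc B (f x))) → BoundOn A P (h ∘ f)
bound-∘ (bound d b) pq s =
  bound-≤ (λ x p → b _ (pq x p)) (bound-^ d (bound-const 1 ⊕ s))

-- Running times up to an upper bound

infix 3 _⊢_⇓_within_

_⊢_⇓_within_ : Program → Tree → Tree → ℕ → Set
p ⊢ x ⇓ y within τ = ∃ λ t → (p ⊢ x ⇓ y ∶ t) × t ≤ τ

private
  variable
    p q b : Program
    x y z u v : Tree
    τ₁ τ₂ τ₃ : ℕ

relax : p ⊢ x ⇓ y within τ₁ → τ₁ ≤ τ₂ → p ⊢ x ⇓ y within τ₂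
relax (t , r , t≤) τ₁≤τ₂ = t , r , ≤-trans t≤ τ₁≤τ₂

exactly : ∀ {t} → p ⊢ x ⇓ y ∶ t → p ⊢ x ⇓ y within t
exactly r = _ , r , ≤-refl

seq′ : p ⊢ x ⇓ y within τ₁ → q ⊢ y ⇓ z within τ₂ → (p ⨾ q) ⊢ x ⇓ z within τ₁ + τ₂
seq′ (_ , r , t≤) (_ , r′ , t′≤) = _ , seq r r′ , +-mono-≤ t≤ t′≤

pair′ : p ⊢ x ⇓ y within τ₁ → q ⊢ x ⇓ z within τ₂ →
        ⟪ p • q ⟫ ⊢ x ⇓ y • z within size x + τ₁ + τ₂
pair′ {x = x} (_ , r , t≤) (_ , r′ , t′≤) =
  _ , pair r r′ , +-mono-≤ (+-monoʳ-≤ (size x) t≤) t′≤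

if-true′ : b ⊢ x ⇓ u • v within τ₁ → p ⊢ x ⇓ y within τ₂ →
           (if b then p else q) ⊢ x ⇓ y within size x + τ₁ + τ₂
if-true′ {x = x} (_ , r , t≤) (_ , r′ , t′≤) =
  _ , if-true r r′ , +-mono-≤ (+-monoʳ-≤ (size x) t≤) t′≤

if-false′ : b ⊢ x ⇓ nil within τ₁ → q ⊢ x ⇓ y within τ₂ →
            (if b then p else q) ⊢ x ⇓ y within size x + τ₁ + τ₂
if-false′ {x = x} (_ , r , t≤) (_ , r′ , t′≤) =
  _ , if-false r r′ , +-mono-≤ (+-monoʳ-≤ (size x) t≤) t′≤

while-true′ : b ⊢ x ⇓ u • v within τ₁ → p ⊢ x ⇓ y within τ₂ →
              (while b loop p) ⊢ y ⇓ z within τ₃ →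
              (while b loop p) ⊢ x ⇓ z within size x + τ₁ + τ₂ + τ₃
while-true′ {x = x} (_ , r , t≤) (_ , r′ , t′≤) (_ , r″ , t″≤) =
  _ , while-true r r′ r″ , +-mono-≤ (+-mono-≤ (+-monoʳ-≤ (size x) t≤) t′≤) t″≤

while-false′ : b ⊢ x ⇓ nil within τ₁ → (while b loop p) ⊢ x ⇓ x within size x + τ₁
while-false′ {x = x} (_ , r , t≤) = _ , while-false r , +-monoʳ-≤ (size x) t≤

-- Polynomial-time functions under a promise

-- Both the run and the time bound are demanded only on inputs satisfying `P`. Listing all choices
-- is polynomial only for blocks of logarithmic length, which `P` has to guarantee.
record PolyOn (A B : Coded) (P : Carrier A → Set) (f : Carrier A → Carrier B) : Set where
  field
    program : Program
    time    : Carrier A → ℕ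
    time≤   : BoundOn A P time
    runs    : ∀ x → P x → program ⊢ enc A x ⇓ enc B (f x) within time x

open PolyOn

Always : X → Set
Always _ = ⊤

Poly : (A B : Coded) → (Carrier A → Carrier B) → Set
Poly A B = PolyOn A B Always

bound-output : ∀ {f} → PolyOn A B P f → BoundOn A P (λ x → size (enc B (f x)))
bound-output F = bound-≤
  (λ x p → let t , r , t≤ = runs F x p in ≤-trans (output≤time r) t≤) (time≤ F)

private
  variable
    f g : X → Y

resp : (∀ x → P x → f x ≡ g x) → PolyOn A B P f → PolyOn A B P g
resp {B = B} f≡g F = record
  { program = program F
  ; time    = time F
  ; time≤   = time≤ F
  ; runs    = λ x p → subst (λ y → program F ⊢ _ ⇓ enc B y within _) (f≡g x p) (runs F x p)
  }

restrict : (∀ x → P x → Q x) → PolyOn A B Q f → PolyOn A B P f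
restrict P⊆Q F = record
  { program = program F
  ; time    = time F
  ; time≤   = bound (degree (time≤ F)) (λ x p → bounded (time≤ F) x (P⊆Q x p))
  ; runs    = λ x p → runs F x (P⊆Q x p)
  }

always : Poly A B f → PolyOn A B P f
always = restrict _

recode : ∀ {f : Carrier A → Carrier B} → (∀ x → enc A x ≡ enc B (f x)) → PolyOn A B P f
recode {A = A} {f = f} eq = record
  { program = skip
  ; time    = λ x → size (enc A x)
  ; time≤   = bound-size
  ; runs    = λ x _ → subst (λ y → skip ⊢ enc A x ⇓ y within _) (eq x) (exactly skip)
  }

idᴾ : PolyOn A A P id
idᴾ = recode (λ _ → refl)

compᴾ : (∀ x → P x → Q (f x)) → PolyOn B C Q g → PolyOn A B P f → PolyOn A C P (g ∘ f)
compᴾ {f = f} PQ G F = record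
  { program = program F ⨾ program G
  ; time    = λ x → time F x + time G (f x)
  ; time≤   = time≤ F ⊕ bound-∘ (time≤ G) PQ (bound-output F)
  ; runs    = λ x p → seq′ (runs F x p) (runs G (f x) (PQ x p))
  }

infixr 9 _∘ᴾ_

_∘ᴾ_ : Poly B C g → PolyOn A B P f → PolyOn A C P (g ∘ f)
_∘ᴾ_ = compᴾ _

infixr 4 _,ᴾ_

_,ᴾ_ : PolyOn A B P f → PolyOn A C P g → PolyOn A (B ×ᶜ C) P (λ x → f x , g x)
_,ᴾ_ {A = A} F G = record
  { program = ⟪ program F • program G ⟫
  ; time    = λ x → size (enc A x) + time F x + time G x
  ; time≤   = bound-size ⊕ time≤ F ⊕ time≤ G
  ; runs    = λ x p → pair′ (runs F x p) (runs G x p)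
  }

proj₁ᴾ : PolyOn (A ×ᶜ B) A P proj₁
proj₁ᴾ {A = A} {B = B} = record
  { program = hd
  ; time    = λ x → size (enc (A ×ᶜ B) x)
  ; time≤   = bound-size
  ; runs    = λ x _ → exactly hd-•
  }

proj₂ᴾ : PolyOn (A ×ᶜ B) B P proj₂
proj₂ᴾ {A = A} {B = B} = record
  { program = tl
  ; time    = λ x → size (enc (A ×ᶜ B) x)
  ; time≤   = bound-size
  ; runs    = λ x _ → exactly tl-•
  }

nilᴾ : ∀ {y} → enc B y ≡ nil → PolyOn A B P (λ _ → y)
nilᴾ {A = A} {y = y} eq = record
  { program = ⟪nil⟫
  ; time    = λ x → size (enc A x)
  ; time≤   = bound-size
  ; runs    = λ x _ → subst (λ y → ⟪nil⟫ ⊢ enc A x ⇓ y within _) (sym eq) (exactly ⟪nil⟫)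
  }

[]ᴾ : PolyOn A (Listᶜ B) P (λ _ → [])
[]ᴾ = nilᴾ refl

falseᴾ : PolyOn A Boolᶜ P (λ _ → false)
falseᴾ = nilᴾ refl

trueᴾ : PolyOn A Boolᶜ P (λ _ → true)
trueᴾ = recode {A = Unitᶜ ×ᶜ Unitᶜ} {f = λ _ → true} (λ _ → refl) ∘ᴾ
        (nilᴾ {y = tt} refl ,ᴾ nilᴾ {y = tt} refl)

infixr 5 _∷ᴾ_

_∷ᴾ_ : ∀ {f : Carrier A → Carrier B} {g} →
       PolyOn A B P f → PolyOn A (Listᶜ B) P g → PolyOn A (Listᶜ B) P (λ x → f x ∷ g x)
_∷ᴾ_ {B = B} F G =
  recode {A = B ×ᶜ Listᶜ B} {f = λ p → proj₁ p ∷ proj₂ p} (λ _ → refl) ∘ᴾ (F ,ᴾ G)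

ifᴾ : ∀ {h : Carrier A → Bool} {f g : Carrier A → Carrier B} →
      PolyOn A Boolᶜ P h → PolyOn A B P f → PolyOn A B P g →
      PolyOn A B P (λ x → cond (h x) (f x) (g x))
ifᴾ {A = A} {B = B} {P = P} {h = h} {f} {g} H F G = record
  { program = if program H then program F else program G
  ; time    = λ x → size (enc A x) + time H x + (time F x + time G x)
  ; time≤   = bound-size ⊕ time≤ H ⊕ (time≤ F ⊕ time≤ G)
  ; runs    = branch
  }
  where
  branch : ∀ x → P x → (if program H then program F else program G) ⊢
           enc A x ⇓ enc B (cond (h x) (f x) (g x)) within
           (size (enc A x) + time H x + (time F x + time G x))
  branch x p with h x | runs H x p
  ... | true  | r = relax (if-true′ r (runs F x p)) (+-monoʳ-≤ (size (enc A x) + time H x) (m≤m+n _ _))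
  ... | false | r = relax (if-false′ r (runs G x p)) (+-monoʳ-≤ (size (enc A x) + time H x) (m≤n+m _ (time F x)))

caseList : ∀ {a b} {A : Set a} {B : Set b} → List A → B → (A → List A → B) → B
caseList []       n c = n
caseList (x ∷ xs) n c = c x xs

caseᴾ : ∀ {h : Carrier Γ → List (Carrier A)} {f : Carrier Γ → Carrier B}
        {g : Carrier (Γ ×ᶜ A ×ᶜ Listᶜ A) → Carrier B} →
        PolyOn Γ (Listᶜ A) P h → PolyOn Γ B P f →
        PolyOn (Γ ×ᶜ A ×ᶜ Listᶜ A) B Always g →
        PolyOn Γ B P (λ γ → caseList (h γ) (f γ) (λ a as → g (γ , a , as)))
caseᴾ {Γ = Γ} {A = A} {B = B} {P = P} {h = h} {f} {g} H F G = record
  { program = prog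
  ; time    = time′
  ; time≤   = bound-size ⊕ time≤ H ⊕
              (time≤ F ⊕ (time≤ (idᴾ {A = Γ} {P = P} ,ᴾ H) ⊕
                bound-∘ {f = λ γ → γ , h γ} bound-cons _ (bound-output (idᴾ ,ᴾ H))))
  ; runs    = branch
  }
  where
  prog : Program
  prog = if program H then ⟪ skip • program H ⟫ ⨾ program G else program F
  cons-time : Carrier (Γ ×ᶜ Listᶜ A) → ℕ
  cons-time (γ , [])     = 0
  cons-time (γ , a ∷ as) = time G (γ , a , as)
  bound-cons : BoundOn (Γ ×ᶜ Listᶜ A) Always cons-time
  bound-cons = bound (degree (time≤ G)) λ where
    (γ , [])     _ → z≤n
    (γ , a ∷ as) _ → bounded (time≤ G) (γ , a , as) _
  time′ : Carrier Γ → ℕ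
  time′ γ = size (enc Γ γ) + time H γ +
            (time F γ + (size (enc Γ γ) + size (enc Γ γ) + time H γ + cons-time (γ , h γ)))
  branch : ∀ γ → P γ → prog ⊢ enc Γ γ ⇓
           enc B (caseList (h γ) (f γ) (λ a as → g (γ , a , as))) within time′ γ
  branch γ p with h γ | runs H γ p
  ... | []     | r = relax (if-false′ r (runs F γ p)) (+-monoʳ-≤ (size (enc Γ γ) + time H γ) (m≤m+n _ _))
  ... | a ∷ as | r = relax
        (if-true′ r (seq′ (pair′ (exactly skip) r) (runs G (γ , a , as) _)))
        (+-monoʳ-≤ (size (enc Γ γ) + time H γ) (m≤n+m _ (time F γ)))

-- A polynomial step iterated could square the accumulator each time, so `σ` must bound all
-- intermediate accumulators. The step may assume that its entry comes from the list, which hands a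
-- promise about the list down to its entries.
module _ {xs : Carrier Γ → List (Carrier A)} {s₀ : Carrier Γ → Carrier S}
         {f : Carrier ((Γ ×ᶜ A) ×ᶜ S) → Carrier S} {σ : Carrier Γ → ℕ}
         (X : PolyOn Γ (Listᶜ A) P xs) (I : PolyOn Γ S P s₀)
         (F : PolyOn ((Γ ×ᶜ A) ×ᶜ S) S
                (λ p → P (proj₁ (proj₁ p)) × proj₂ (proj₁ p) ∈ xs (proj₁ (proj₁ p))) f)
         (bound-σ : BoundOn Γ P σ)
         (σ-bounds : ∀ γ → P γ → ∀ ys zs → xs γ ≡ ys ++ zs →
                     size (enc S (foldl (λ s a → f ((γ , a) , s)) (s₀ γ) ys)) ≤ σ γ)
  where

  private
    body loop prog : Program
    body = ⟪ hd ⨾ tl • ⟪ tl ⨾ hd •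
             (⟪ ⟪ tl ⨾ hd • hd ⨾ hd ⟫ • tl ⨾ tl ⟫ ⨾ program F) ⟫ ⟫
    loop = while hd loop body
    prog = ⟪ program X • ⟪ skip • program I ⟫ ⟫ ⨾ loop ⨾ tl ⨾ tl

    -- A state of the loop is (remaining list) • (γ • accumulator); stateSize
    -- bounds its size, and iteration bounds the time of one round.
    stateSize iteration time′ : Carrier Γ → ℕ
    stateSize γ = 2 + sizes A (xs γ) + size (enc Γ γ) + σ γ
    -- Apart from the step itself, one round of the loop inspects or copies trees no larger than the
    -- state, 16 times in all.
    iteration γ = 16 * stateSize γ + (1 + stateSize γ) ^ degree (time≤ F)
    time′ γ = (size (enc Γ γ) + time X γ + (size (enc Γ γ) + size (enc Γ γ) + time I γ))
            + (suc (sizes A (xs γ)) * iteration γ + (stateSize γ + stateSize γ))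

    bound-stateSize : BoundOn Γ P stateSize
    bound-stateSize = bound-const 2 ⊕ bound-output X ⊕ bound-size ⊕ bound-σ

    bound-iteration : BoundOn Γ P iteration
    bound-iteration = bound-const 16 ⊗ bound-stateSize ⊕
                      bound-^ (degree (time≤ F)) (bound-const 1 ⊕ bound-stateSize)

    bound-time′ : BoundOn Γ P time′
    bound-time′ = (bound-size ⊕ time≤ X ⊕ (bound-size ⊕ bound-size ⊕ time≤ I)) ⊕
                  ((bound-const 1 ⊕ bound-output X) ⊗ bound-iteration ⊕
                   (bound-stateSize ⊕ bound-stateSize))

    module _ (γ : Carrier Γ) (p : P γ) where

      step : Carrier S → Carrier A → Carrier S
      step s a = f ((γ , a) , s)

      state : List (Carrier A) → Carrier S → Tree
      state as s = enc (Listᶜ A) as • (enc Γ γ • enc S s)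

      state≤ : ∀ as s → sizes A as ≤ sizes A (xs γ) → size (enc S s) ≤ σ γ →
               size (state as s) ≤ stateSize γ
      state≤ as s as≤ s≤ = begin
        1 + sizes A as + (1 + size (enc Γ γ) + size (enc S s))
          ≤⟨ +-mono-≤ (s≤s as≤) (+-monoʳ-≤ (1 + size (enc Γ γ)) s≤) ⟩
        1 + sizes A (xs γ) + (1 + size (enc Γ γ) + σ γ)
          ≡⟨ rearrange (sizes A (xs γ)) (size (enc Γ γ)) (σ γ) ⟩
        2 + sizes A (xs γ) + size (enc Γ γ) + σ γ
          ∎
        where
        open ≤-Reasoning
        rearrange : ∀ l g s → 1 + l + (1 + g + s) ≡ 2 + l + g + s
        rearrange = solve-∀

      loop-runs : ∀ as s → (∀ {a} → a ∈ as → a ∈ xs γ) → sizes A as ≤ sizes A (xs γ) →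
                  (∀ ys zs → as ≡ ys ++ zs → size (enc S (foldl step s ys)) ≤ σ γ) →
                  loop ⊢ state as s ⇓ state [] (foldl step s as) within
                  suc (length as) * iteration γ
      loop-runs [] s _ as≤ s≤ =
        relax (while-false′ (exactly hd-•)) (begin
          size (state [] s) + size (state [] s)  ≤⟨ +-mono-≤ st≤ st≤ ⟩
          M + M                                  ≤⟨ +-monoʳ-≤ M (m≤m+n M _) ⟩
          16 * M                                 ≤⟨ m≤m+n _ _ ⟩
          iteration γ                            ≤⟨ m≤m+n _ _ ⟩
          1 * iteration γ                        ∎)
        where
        open ≤-Reasoning
        M = stateSize γ
        st≤ = state≤ [] s as≤ (s≤ [] [] refl)
      loop-runs (a ∷ as) s ⊆xs as≤ s≤ =
        relax (while-true′ (exactly hd-•)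
                 (pair′ (seq′ (exactly hd-•) (exactly tl-•))
                   (pair′ (seq′ (exactly tl-•) (exactly hd-•))
                     (seq′ (pair′ (pair′ (seq′ (exactly tl-•) (exactly hd-•))
                                         (seq′ (exactly hd-•) (exactly hd-•)))
                                  (seq′ (exactly tl-•) (exactly tl-•)))
                           (runs F ((γ , a) , s) (p , ⊆xs (here refl))))))
                 (loop-runs as (step s a) (⊆xs ∘ there)
                   (≤-trans (sizes-++ʳ {A} (a ∷ []) as) as≤)
                   (λ ys zs eq → s≤ (a ∷ ys) zs (cong (a ∷_) eq))))
              (+-monoˡ-≤ _ (begin
                _ ≤⟨ +-mono-≤ (+-mono-≤ st≤ st≤)
                       (+-mono-≤ (+-mono-≤ st≤ (+-mono-≤ st≤ list≤))
                         (+-mono-≤ (+-mono-≤ st≤ (+-mono-≤ st≤ rest≤))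
                           (+-mono-≤ (+-mono-≤ (+-mono-≤ st≤
                             (+-mono-≤ (+-mono-≤ st≤ (+-mono-≤ st≤ rest≤))
                                       (+-mono-≤ st≤ list≤)))
                             (+-mono-≤ st≤ rest≤)) step≤))) ⟩
                _ ≡⟨ total M ((1 + M) ^ degree (time≤ F)) ⟩
                iteration γ ∎))
        where
        open ≤-Reasoning
        M = stateSize γ
        st = size (state (a ∷ as) s)
        st≤ : st ≤ M
        st≤ = state≤ (a ∷ as) s as≤ (s≤ [] (a ∷ as) refl)
        list≤ : sizes A (a ∷ as) ≤ M
        list≤ = ≤-trans (≤-trans (m≤m+n _ _) (n≤1+n _)) st≤
        rest≤ : size (enc Γ γ • enc S s) ≤ M
        rest≤ = ≤-trans (m≤n+m _ (1 + sizes A (a ∷ as))) st≤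
        step≤ : time F ((γ , a) , s) ≤ (1 + M) ^ degree (time≤ F)
        step≤ = ≤-trans (bounded (time≤ F) ((γ , a) , s) (p , ⊆xs (here refl)))
          (^-monoˡ-≤ (degree (time≤ F)) (s≤s (begin
            1 + (1 + size (enc Γ γ) + size (enc A a)) + size (enc S s)
              ≡⟨ rearrange (size (enc Γ γ)) (size (enc A a)) (size (enc S s)) ⟩
            size (enc A a) + (1 + (1 + size (enc Γ γ) + size (enc S s)))
              ≤⟨ +-mono-≤ (size-∈ {A} {a} {a ∷ as} (here refl)) ≤-refl ⟩
            sizes A (a ∷ as) + (1 + (1 + size (enc Γ γ) + size (enc S s)))
              ≡⟨ +-suc (sizes A (a ∷ as)) _ ⟩
            st
              ≤⟨ st≤ ⟩
            M ∎)))
          where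
          rearrange : ∀ g a s → 1 + (1 + g + a) + s ≡ a + (1 + (1 + g + s))
          rearrange = solve-∀
        total : ∀ M τ → M + M + (M + (M + M) + (M + (M + M) +
                  (M + (M + (M + M) + (M + M)) + (M + M) + τ))) ≡ 16 * M + τ
        total = solve-∀

  foldlᴾ : PolyOn Γ S P (λ γ → foldl (λ s a → f ((γ , a) , s)) (s₀ γ) (xs γ))
  foldlᴾ = record
    { program = prog
    ; time    = time′
    ; time≤   = bound-time′
    ; runs    = λ γ p → relax
        (seq′ (pair′ (runs X γ p) (pair′ (exactly skip) (runs I γ p)))
          (seq′ (loop-runs γ p (xs γ) (s₀ γ) id ≤-refl (σ-bounds γ p))
                (seq′ (exactly tl-•) (exactly tl-•))))
        (+-monoʳ-≤ (size (enc Γ γ) + time X γ + (size (enc Γ γ) + size (enc Γ γ) + time I γ))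
          (+-mono-≤ (*-monoˡ-≤ (iteration γ) (s≤s (length≤sizes {A} (xs γ))))
            (let final≤ = state≤ γ p [] (foldl (step γ p) (s₀ γ) (xs γ)) (1≤size (enc (Listᶜ A) (xs γ)))
                            (σ-bounds γ p (xs γ) [] (sym (List.++-identityʳ _)))
             in +-mono-≤ final≤ (≤-trans (m≤n+m _ 2) final≤))))
    }

sizes-++ˡ : ∀ xs ys → sizes A xs ≤ sizes A (xs ++ ys)
sizes-++ˡ {A} []       ys = 1≤size (enc (Listᶜ A) ys)
sizes-++ˡ {A} (x ∷ xs) ys = s≤s (+-monoʳ-≤ (size (enc A x)) (sizes-++ˡ {A} xs ys))

reverseᴾ : Poly (Listᶜ A) (Listᶜ A) reverse
reverseᴾ {A} = foldlᴾ {σ = λ xs → 1 + sizes A xs} idᴾ []ᴾ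
  (proj₂ᴾ ∘ᴾ proj₁ᴾ ∷ᴾ proj₂ᴾ)
  (bound-const 1 ⊕ bound-size)
  (λ { _ _ ys zs refl → ≤-trans (push≤ [] ys) (s≤s (sizes-++ˡ {A} ys zs)) })
  where
  push≤ : ∀ s ys → sizes A (foldl (λ s a → a ∷ s) s ys) ≤ sizes A s + sizes A ys
  push≤ s []       = m≤m+n _ _
  push≤ s (y ∷ ys) = ≤-trans (push≤ (y ∷ s) ys)
    (≤-reflexive (rearrange (size (enc A y)) (sizes A s) (sizes A ys)))
    where
    rearrange : ∀ a b c → 1 + a + b + c ≡ b + (1 + a + c)
    rearrange = solve-∀

-- Runs `foldlᴾ` on the reversed list; its prefixes are the reversed suffixes of the original, hence
-- the bound on suffixes.
foldrᴾ : {xs : Carrier Γ → List (Carrier A)} {s₀ : Carrier Γ → Carrier S}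
         {f : Carrier ((Γ ×ᶜ A) ×ᶜ S) → Carrier S} {σ : Carrier Γ → ℕ} →
         PolyOn Γ (Listᶜ A) P xs → PolyOn Γ S P s₀ →
         PolyOn ((Γ ×ᶜ A) ×ᶜ S) S
           (λ p → P (proj₁ (proj₁ p)) × proj₂ (proj₁ p) ∈ xs (proj₁ (proj₁ p))) f →
         BoundOn Γ P σ →
         (∀ γ → P γ → ∀ ys zs → xs γ ≡ ys ++ zs →
           size (enc S (foldr (λ a s → f ((γ , a) , s)) (s₀ γ) zs)) ≤ σ γ) →
         PolyOn Γ S P (λ γ → foldr (λ a s → f ((γ , a) , s)) (s₀ γ) (xs γ))
foldrᴾ {Γ = Γ} {A = A} {S = S} {xs = xs} {s₀} {f} X I F bound-σ σ-bounds = resp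
  (λ γ _ → List.reverse-foldl (step γ) (s₀ γ) (xs γ))
  (foldlᴾ (reverseᴾ ∘ᴾ X) I
    (restrict (λ { ((γ , a) , s) (p , a∈) → p , Any.reverse⁻ a∈ }) F)
    bound-σ
    (λ γ p ys zs eq → subst (λ s → size (enc S s) ≤ _)
      (trans (sym (List.reverse-foldl (step γ) (s₀ γ) (reverse ys)))
             (cong (foldl (step γ) (s₀ γ)) (List.reverse-involutive ys)))
      (σ-bounds γ p (reverse zs) (reverse ys)
        (trans (sym (List.reverse-involutive (xs γ)))
               (trans (cong reverse eq) (List.reverse-++ ys zs))))))
  where
  step : Carrier Γ → Carrier S → Carrier A → Carrier S
  step γ s a = f ((γ , a) , s)

++ᴾ : {f g : Carrier Γ → List (Carrier A)} → PolyOn Γ (Listᶜ A) P f → PolyOn Γ (Listᶜ A) P g →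
      PolyOn Γ (Listᶜ A) P (λ γ → f γ ++ g γ)
++ᴾ {A = A} {f = f} {g} F G = resp (λ γ _ → sym (List.++-is-foldr (f γ) (g γ)))
  (foldrᴾ {σ = λ γ → sizes A (f γ) + sizes A (g γ)} F G
    (proj₂ᴾ ∘ᴾ proj₁ᴾ ∷ᴾ proj₂ᴾ)
    (bound-output F ⊕ bound-output G)
    (λ γ _ ys zs eq → begin
      sizes A (foldr _∷_ (g γ) zs)        ≡⟨ cong (sizes A) (List.++-is-foldr zs (g γ)) ⟨
      sizes A (zs ++ g γ)                 ≤⟨ sizes-++ {A} zs (g γ) ⟩
      sizes A zs + sizes A (g γ)          ≤⟨ +-monoˡ-≤ _ (sizes-++ʳ {A} ys zs) ⟩
      sizes A (ys ++ zs) + sizes A (g γ)  ≡⟨ cong (λ l → sizes A l + sizes A (g γ)) eq ⟨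
      sizes A (f γ) + sizes A (g γ)       ∎))
  where open ≤-Reasoning

-- The accumulator carries the suffix already traversed beside the output, since `g` needs it. Each
-- piece of output depends on the input alone and not on earlier output, so the total stays
-- polynomial.
gatherᴾ : {xs : Carrier Γ → List (Carrier A)} {g : Carrier (Γ ×ᶜ A ×ᶜ Listᶜ A) → List (Carrier B)} →
          PolyOn Γ (Listᶜ A) P xs →
          PolyOn (Γ ×ᶜ A ×ᶜ Listᶜ A) (Listᶜ B)
            (λ p → P (proj₁ p) × proj₁ (proj₂ p) ∈ xs (proj₁ p)) g →
          PolyOn Γ (Listᶜ B) P (λ γ → gather (λ a as → g (γ , a , as)) (xs γ))
gatherᴾ {Γ = Γ} {A = A} {B = B} {P = P} {xs = xs} {g} X G = resp
  (λ γ _ → cong proj₂ (tails γ (xs γ)))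
  (proj₂ᴾ ∘ᴾ foldrᴾ {S = Listᶜ A ×ᶜ Listᶜ B} {f = step} {σ = σ} X ([]ᴾ ,ᴾ []ᴾ)
    (proj₂ᴾ ∘ᴾ proj₁ᴾ ∷ᴾ proj₁ᴾ ∘ᴾ proj₂ᴾ ,ᴾ
     ++ᴾ (compᴾ (λ _ p → p) G (proj₁ᴾ ∘ᴾ proj₁ᴾ ,ᴾ proj₂ᴾ ∘ᴾ proj₁ᴾ ,ᴾ proj₁ᴾ ∘ᴾ proj₂ᴾ))
         (proj₂ᴾ ∘ᴾ proj₂ᴾ))
    (bound-const 1 ⊕ bound-output X ⊕
      (bound-const 1 ⊕ bound-output X ⊗ bound-^ (degree out) (bound-const 1 ⊕ input-bound)))
    (λ γ p ys zs eq → subst (λ s → size (enc (Listᶜ A ×ᶜ Listᶜ B) s) ≤ σ γ)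
      (sym (tails γ zs))
      (begin
        1 + sizes A zs + sizes B (gather (λ a as → g (γ , a , as)) zs)
          ≤⟨ +-mono-≤ (s≤s (suffix≤ γ ys zs eq))
               (gather≤ γ p zs (λ a∈ → subst (_ ∈_) (sym eq) (∈-++⁺ʳ ys a∈)) (suffix≤ γ ys zs eq)) ⟩
        1 + sizes A (xs γ) + (1 + length zs * piece γ)
          ≤⟨ +-monoʳ-≤ (1 + sizes A (xs γ)) (s≤s (*-monoˡ-≤ (piece γ)
               (≤-trans (length≤sizes {A} zs) (suffix≤ γ ys zs eq)))) ⟩
        σ γ ∎)))
  where
  open ≤-Reasoning
  step : Carrier ((Γ ×ᶜ A) ×ᶜ Listᶜ A ×ᶜ Listᶜ B) → List (Carrier A) × List (Carrier B)
  step ((γ , a) , as , bs) = a ∷ as , g (γ , a , as) ++ bs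
  tails : ∀ γ as → foldr (λ a s → step ((γ , a) , s)) ([] , []) as ≡
                   (as , gather (λ a as → g (γ , a , as)) as)
  tails γ []       = refl
  tails γ (a ∷ as) rewrite tails γ as = refl
  suffix≤ : ∀ γ ys zs → xs γ ≡ ys ++ zs → sizes A zs ≤ sizes A (xs γ)
  suffix≤ γ ys zs eq = subst (λ l → sizes A zs ≤ sizes A l) (sym eq) (sizes-++ʳ {A} ys zs)
  out = bound-output G
  input piece σ : Carrier Γ → ℕ
  input γ = 1 + size (enc Γ γ) + (1 + sizes A (xs γ) + sizes A (xs γ))
  piece γ = (1 + input γ) ^ degree out
  σ γ = 1 + sizes A (xs γ) + (1 + sizes A (xs γ) * piece γ)
  input-bound : BoundOn Γ P input
  input-bound = bound-const 1 ⊕ bound-size ⊕ (bound-const 1 ⊕ bound-output X ⊕ bound-output X)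
  gather≤ : ∀ γ → P γ → ∀ as → (∀ {a} → a ∈ as → a ∈ xs γ) → sizes A as ≤ sizes A (xs γ) →
            sizes B (gather (λ a as → g (γ , a , as)) as) ≤ 1 + length as * piece γ
  gather≤ γ p []       ⊆xs as≤ = ≤-refl
  gather≤ γ p (a ∷ as) ⊆xs as≤ = begin
    sizes B (g (γ , a , as) ++ gather _ as)
      ≤⟨ sizes-++ {B} (g (γ , a , as)) _ ⟩
    sizes B (g (γ , a , as)) + sizes B (gather _ as)
      ≤⟨ +-mono-≤ (bounded out (γ , a , as) (p , ⊆xs (here refl)))
           (gather≤ γ p as (⊆xs ∘ there) tail≤) ⟩
    (1 + (1 + size (enc Γ γ) + (1 + size (enc A a) + sizes A as))) ^ degree out + (1 + length as * piece γ)
      ≤⟨ +-monoˡ-≤ _ (^-monoˡ-≤ (degree out) (s≤s (+-monoʳ-≤ (1 + size (enc Γ γ))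
           (s≤s (+-mono-≤ (size-∈ {A} (⊆xs (here refl))) tail≤))))) ⟩
    piece γ + (1 + length as * piece γ)
      ≡⟨ +-suc (piece γ) _ ⟩
    1 + (piece γ + length as * piece γ)
      ∎
    where tail≤ = ≤-trans (sizes-++ʳ {A} (a ∷ []) as) as≤

-- The steps of the reduction

mapᴾ : {xs : Carrier Γ → List (Carrier A)} {g : Carrier (Γ ×ᶜ A) → Carrier B} →
       PolyOn Γ (Listᶜ A) P xs →
       PolyOn (Γ ×ᶜ A) B (λ p → P (proj₁ p) × proj₂ p ∈ xs (proj₁ p)) g →
       PolyOn Γ (Listᶜ B) P (λ γ → map (λ a → g (γ , a)) (xs γ))
mapᴾ {xs = xs} {g} X G = resp (λ γ _ → gather≡map γ (xs γ))
  (gatherᴾ X (compᴾ (λ _ p → p) G (proj₁ᴾ ,ᴾ proj₁ᴾ ∘ᴾ proj₂ᴾ) ∷ᴾ []ᴾ))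
  where
  gather≡map : ∀ γ as → gather (λ a _ → [ g (γ , a) ]) as ≡ map (λ a → g (γ , a)) as
  gather≡map γ []       = refl
  gather≡map γ (a ∷ as) = cong (_ ∷_) (gather≡map γ as)

concatᴾ : {xss : Carrier Γ → List (List (Carrier A))} →
          PolyOn Γ (Listᶜ (Listᶜ A)) P xss → PolyOn Γ (Listᶜ A) P (concat ∘ xss)
concatᴾ {xss = xss} X = resp (λ γ _ → gather≡concat (xss γ)) (gatherᴾ X (proj₁ᴾ ∘ᴾ proj₂ᴾ))
  where
  gather≡concat : ∀ (xss : List (List Y)) → gather (λ xs _ → xs) xss ≡ concat xss
  gather≡concat []         = refl
  gather≡concat (xs ∷ xss) = cong (xs ++_) (gather≡concat xss)

units→ℕ : PolyOn Γ (Listᶜ Unitᶜ) P f → PolyOn Γ ℕᶜ P (length ∘ f)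
units→ℕ F = recode enc-length ∘ᴾ F
  where
  enc-length : ∀ us → encodeList (λ _ → nil) us ≡ encodeℕ (length us)
  enc-length []       = refl
  enc-length (_ ∷ us) = cong (nil •_) (enc-length us)

ℕ→units : PolyOn Γ ℕᶜ P f → PolyOn Γ (Listᶜ Unitᶜ) P (λ γ → replicate (f γ) tt)
ℕ→units F = recode enc-replicate ∘ᴾ F
  where
  enc-replicate : ∀ n → encodeℕ n ≡ encodeList (λ _ → nil) (replicate n tt)
  enc-replicate zero    = refl
  enc-replicate (suc n) = cong (nil •_) (enc-replicate n)

lengthᴾ : {xs : Carrier Γ → List (Carrier A)} →
          PolyOn Γ (Listᶜ A) P xs → PolyOn Γ ℕᶜ P (length ∘ xs)
lengthᴾ {xs = xs} X = resp (λ γ _ → List.length-map _ (xs γ))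
  (units→ℕ (mapᴾ X (nilᴾ {y = tt} refl)))

numeralᴾ : ∀ n → PolyOn Γ ℕᶜ P (λ _ → n)
numeralᴾ n = resp (λ _ _ → List.length-replicate n) (units→ℕ (go n))
  where
  go : ∀ n → PolyOn Γ (Listᶜ Unitᶜ) P (λ _ → replicate n tt)
  go zero    = []ᴾ
  go (suc n) = nilᴾ {y = tt} refl ∷ᴾ go n

notᴾ : PolyOn Γ Boolᶜ P f → PolyOn Γ Boolᶜ P (not ∘ f)
notᴾ {f = f} F = resp (λ γ _ → cond≡not (f γ)) (ifᴾ F falseᴾ trueᴾ)
  where
  cond≡not : ∀ b → cond b false true ≡ not b
  cond≡not false = refl
  cond≡not true  = refl

∧ᴾ : PolyOn Γ Boolᶜ P f → PolyOn Γ Boolᶜ P g → PolyOn Γ Boolᶜ P (λ γ → f γ ∧ g γ)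
∧ᴾ {f = f} {g = g} F G = resp (λ γ _ → cond≡∧ (f γ) (g γ)) (ifᴾ F G falseᴾ)
  where
  cond≡∧ : ∀ b c → cond b c false ≡ b ∧ c
  cond≡∧ false c = refl
  cond≡∧ true  c = refl

∨ᴾ : PolyOn Γ Boolᶜ P f → PolyOn Γ Boolᶜ P g → PolyOn Γ Boolᶜ P (λ γ → f γ ∨ g γ)
∨ᴾ {f = f} {g = g} F G = resp (λ γ _ → cond≡∨ (f γ) (g γ)) (ifᴾ F trueᴾ G)
  where
  cond≡∨ : ∀ b c → cond b true c ≡ b ∨ c
  cond≡∨ false c = refl
  cond≡∨ true  c = refl

≡ᴮᴾ : PolyOn Γ Boolᶜ P f → PolyOn Γ Boolᶜ P g → PolyOn Γ Boolᶜ P (λ γ → f γ ≡ᴮ g γ)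
≡ᴮᴾ F G = ifᴾ F G (notᴾ G)

predᴾ : Poly ℕᶜ ℕᶜ pred
predᴾ = resp (λ { zero _ → refl ; (suc n) _ → List.length-replicate n })
  (caseᴾ (ℕ→units idᴾ) (numeralᴾ 0) (units→ℕ (proj₂ᴾ ∘ᴾ proj₂ᴾ)))

size-encodeℕ : ∀ n → size (encodeℕ n) ≡ suc (2 * n)
size-encodeℕ zero    = refl
size-encodeℕ (suc n) = cong (2 +_) (trans (size-encodeℕ n) (sym (+-suc n (n + 0))))

encodeℕ-mono : ∀ {m n} → m ≤ n → size (encodeℕ m) ≤ size (encodeℕ n)
encodeℕ-mono {n = n} z≤n = 1≤size (encodeℕ n)
encodeℕ-mono (s≤s m≤n) = s≤s (s≤s (encodeℕ-mono m≤n))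

∸ᴾ : PolyOn Γ ℕᶜ P f → PolyOn Γ ℕᶜ P g → PolyOn Γ ℕᶜ P (λ γ → f γ ∸ g γ)
∸ᴾ {f = f} {g = g} F G = resp (λ γ _ → foldr-pred (f γ) (g γ))
  (foldrᴾ {A = Unitᶜ} {σ = λ γ → size (encodeℕ (f γ))} (ℕ→units G) F (predᴾ ∘ᴾ proj₂ᴾ)
    (bound-output F) (λ γ _ _ zs _ → encodeℕ-mono (pred≤ (f γ) zs)))
  where
  foldr-pred : ∀ m n → foldr (λ _ s → pred s) m (replicate n tt) ≡ m ∸ n
  foldr-pred m zero    = refl
  foldr-pred m (suc n) = trans (cong pred (foldr-pred m n)) (pred[m∸n]≡m∸[1+n] m n)
  pred≤ : ∀ m (us : List ⊤) → foldr (λ _ s → pred s) m us ≤ m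
  pred≤ m []       = ≤-refl
  pred≤ m (_ ∷ us) = ≤-trans pred[n]≤n (pred≤ m us)

isZero : ℕ → Bool
isZero n = caseList (replicate n tt) true (λ _ _ → false)

≡ᵇᴾ : PolyOn Γ ℕᶜ P f → PolyOn Γ ℕᶜ P g → PolyOn Γ Boolᶜ P (λ γ → f γ ≡ᵇ g γ)
≡ᵇᴾ {f = f} {g = g} F G = resp (λ γ _ → antisym (f γ) (g γ))
  (∧ᴾ (isZeroᴾ ∘ᴾ ∸ᴾ F G) (isZeroᴾ ∘ᴾ ∸ᴾ G F))
  where
  isZeroᴾ : Poly ℕᶜ Boolᶜ isZero
  isZeroᴾ = caseᴾ (ℕ→units idᴾ) trueᴾ falseᴾ
  antisym : ∀ m n → isZero (m ∸ n) ∧ isZero (n ∸ m) ≡ (m ≡ᵇ n)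
  antisym zero    zero    = refl
  antisym zero    (suc n) = refl
  antisym (suc m) zero    = refl
  antisym (suc m) (suc n) = antisym m n

anyᴾ : {xs : Carrier Γ → List (Carrier A)} {g : Carrier (Γ ×ᶜ A) → Bool} →
       PolyOn Γ (Listᶜ A) P xs → Poly (Γ ×ᶜ A) Boolᶜ g →
       PolyOn Γ Boolᶜ P (λ γ → any (λ a → g (γ , a)) (xs γ))
anyᴾ {A = A} {xs = xs} {g} X G = resp (λ γ _ → foldr≡any γ (xs γ))
  (foldrᴾ {S = Boolᶜ} {f = λ { ((γ , a) , s) → g (γ , a) ∨ s }} {σ = λ _ → 3} X falseᴾ
    (∨ᴾ (always G ∘ᴾ proj₁ᴾ) proj₂ᴾ)
    (bound-const 3) (λ γ _ ys zs _ → size-bool (foldr _ false zs)))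
  where
  foldr≡any : ∀ γ as → foldr (λ a s → g (γ , a) ∨ s) false as ≡ any (λ a → g (γ , a)) as
  foldr≡any γ []       = refl
  foldr≡any γ (a ∷ as) = cong (g (γ , a) ∨_) (foldr≡any γ as)
  size-bool : ∀ b → size (encodeBool b) ≤ 3
  size-bool false = s≤s z≤n
  size-bool true  = ≤-refl

length-choices : ∀ (ps : List (X × X)) → length (choices ps) ≡ 2 ^ length ps
length-choices []             = refl
length-choices ((p , q) ∷ ps) = begin
  length (map (p ∷_) (choices ps) ++ map (q ∷_) (choices ps))
    ≡⟨ List.length-++ (map (p ∷_) (choices ps)) ⟩
  length (map (p ∷_) (choices ps)) + length (map (q ∷_) (choices ps))
    ≡⟨ cong₂ _+_ (length-map p) (trans (length-map q) (sym (+-identityʳ _))) ⟩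
  2 ^ length ((p , q) ∷ ps) ∎
  where
  open ≡-Reasoning
  length-map : ∀ r → length (map (r ∷_) (choices ps)) ≡ 2 ^ length ps
  length-map r = trans (List.length-map (r ∷_) (choices ps)) (length-choices ps)

size-choice : ∀ ps {l} → l ∈ choices ps → sizes A l ≤ sizes (A ×ᶜ A) ps
size-choice []                 (here refl) = ≤-refl
size-choice {A} ((p , q) ∷ ps) l∈ with ∈-++⁻ (map (p ∷_) (choices ps)) l∈
... | inj₁ l∈ with l , l∈ , refl ← ∈-map⁻ (p ∷_) l∈ =
  s≤s (+-mono-≤ (≤-trans (m≤m+n _ _) (n≤1+n _)) (size-choice {A} ps l∈))
... | inj₂ l∈ with l , l∈ , refl ← ∈-map⁻ (q ∷_) l∈ =
  s≤s (+-mono-≤ (≤-trans (m≤n+m _ (size (enc A p))) (n≤1+n _)) (size-choice {A} ps l∈))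

sizes≤ : ∀ xs m → (∀ {x} → x ∈ xs → size (enc A x) ≤ m) → sizes A xs ≤ 1 + length xs * (1 + m)
sizes≤         []       m ≤m = ≤-refl
sizes≤ {A = A} (x ∷ xs) m ≤m = s≤s (begin
  size (enc A x) + sizes A xs       ≤⟨ +-mono-≤ (≤m (here refl)) (sizes≤ {A} xs m (≤m ∘ there)) ⟩
  m + (1 + length xs * (1 + m))     ≡⟨ +-suc m _ ⟩
  1 + (m + length xs * (1 + m))     ∎)
  where open ≤-Reasoning

-- The only source of exponential growth. The assumed bound on the final number of choices also
-- covers the intermediate stages, which are the choices for suffixes.
choicesᴾ : {ps : Carrier Γ → List (Carrier A × Carrier A)} →
           PolyOn Γ (Listᶜ (A ×ᶜ A)) P ps → BoundOn Γ P (λ γ → 2 ^ length (ps γ)) →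
           PolyOn Γ (Listᶜ (Listᶜ A)) P (choices ∘ ps)
choicesᴾ {Γ = Γ} {A = A} {P = P} {ps = ps} F few = resp (λ γ _ → foldr≡choices (ps γ))
  (foldrᴾ {A = A ×ᶜ A} {S = Listᶜ (Listᶜ A)} {f = λ { ((γ , pq) , acc) → step pq acc }} F ([]ᴾ ∷ᴾ []ᴾ)
    (++ᴾ (mapᴾ proj₂ᴾ (proj₁ᴾ ∘ᴾ proj₂ᴾ ∘ᴾ proj₁ᴾ ∘ᴾ proj₁ᴾ ∷ᴾ proj₂ᴾ))
         (mapᴾ proj₂ᴾ (proj₂ᴾ ∘ᴾ proj₂ᴾ ∘ᴾ proj₁ᴾ ∘ᴾ proj₁ᴾ ∷ᴾ proj₂ᴾ)))
    (bound-const 1 ⊕ few ⊗ (bound-const 1 ⊕ bound-output F))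
    (λ γ _ ys zs eq → begin
      sizes (Listᶜ A) (foldr step [ [] ] zs)
        ≡⟨ cong (sizes (Listᶜ A)) (foldr≡choices zs) ⟩
      sizes (Listᶜ A) (choices zs)
        ≤⟨ sizes≤ {Listᶜ A} (choices zs) _ (size-choice {A} zs) ⟩
      1 + length (choices zs) * (1 + sizes (A ×ᶜ A) zs)
        ≡⟨ cong (λ l → 1 + l * (1 + sizes (A ×ᶜ A) zs)) (length-choices zs) ⟩
      1 + 2 ^ length zs * (1 + sizes (A ×ᶜ A) zs)
        ≤⟨ s≤s (*-mono-≤ (^-monoʳ-≤ 2 (m≤n+m (length zs) (length ys)))
                         (s≤s (sizes-++ʳ {A ×ᶜ A} ys zs))) ⟩
      1 + 2 ^ (length ys + length zs) * (1 + sizes (A ×ᶜ A) (ys ++ zs))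
        ≡⟨ cong (λ l → 1 + 2 ^ l * (1 + sizes (A ×ᶜ A) (ys ++ zs))) (List.length-++ ys) ⟨
      1 + 2 ^ length (ys ++ zs) * (1 + sizes (A ×ᶜ A) (ys ++ zs))
        ≡⟨ cong (λ l → 1 + 2 ^ length l * (1 + sizes (A ×ᶜ A) l)) eq ⟨
      1 + 2 ^ length (ps γ) * (1 + sizes (A ×ᶜ A) (ps γ)) ∎))
  where
  open ≤-Reasoning
  step : Carrier A × Carrier A → List (List (Carrier A)) → List (List (Carrier A))
  step pq acc = map (proj₁ pq ∷_) acc ++ map (proj₂ pq ∷_) acc
  foldr≡choices : ∀ ps → foldr step [ [] ] ps ≡ choices ps
  foldr≡choices []       = refl
  foldr≡choices (pq ∷ ps) = cong (step pq) (foldr≡choices ps)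

dealᴾ : {k : Carrier Γ → ℕ} {bs : Carrier Γ → List (Carrier A)} →
        PolyOn Γ ℕᶜ P k → PolyOn Γ (Listᶜ A) P bs →
        PolyOn Γ (Listᶜ (Listᶜ A)) P (λ γ → deal (k γ) (bs γ))
dealᴾ {Γ = Γ} {A = A} {k = k} {bs} K F =
  foldrᴾ {A = A} {S = Listᶜ (Listᶜ A)} {f = λ { ((γ , b) , Bs) → dealTo b Bs }} F empties
    (resp (λ { ((γ , b) , []) _ → refl ; ((γ , b) , B ∷ Bs) _ → refl })
      (caseᴾ proj₂ᴾ []ᴾ
        (++ᴾ (proj₂ᴾ ∘ᴾ proj₂ᴾ)
             ((proj₂ᴾ ∘ᴾ proj₁ᴾ ∘ᴾ proj₁ᴾ ∷ᴾ proj₁ᴾ ∘ᴾ proj₂ᴾ) ∷ᴾ []ᴾ))))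
    (bound-output empties ⊕ bound-const 2 ⊗ bound-output F)
    (λ γ _ ys zs eq → ≤-trans (deal≤ (k γ) zs)
      (+-monoʳ-≤ (sizes (Listᶜ A) (replicate (k γ) [])) (*-monoʳ-≤ 2
        (subst (λ l → sizes A zs ≤ sizes A l) (sym eq) (sizes-++ʳ {A} ys zs)))))
  where
  open ≤-Reasoning
  empties : PolyOn Γ (Listᶜ (Listᶜ A)) _ (λ γ → replicate (k γ) [])
  empties = resp (λ γ _ → List.map-replicate (λ _ → []) (k γ) tt) (mapᴾ (ℕ→units K) []ᴾ)
  dealTo≤ : ∀ b Bs → sizes (Listᶜ A) (dealTo b Bs) ≤ sizes (Listᶜ A) Bs + 2 * (1 + size (enc A b))
  dealTo≤ b []       = s≤s z≤n
  dealTo≤ b (B ∷ Bs) = begin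
    sizes (Listᶜ A) (Bs ++ [ b ∷ B ])
      ≤⟨ sizes-++ {Listᶜ A} Bs [ b ∷ B ] ⟩
    sizes (Listᶜ A) Bs + (1 + (1 + size (enc A b) + sizes A B) + 1)
      ≤⟨ m≤m+n _ (size (enc A b)) ⟩
    sizes (Listᶜ A) Bs + (1 + (1 + size (enc A b) + sizes A B) + 1) + size (enc A b)
      ≡⟨ rearrange (sizes (Listᶜ A) Bs) (size (enc A b)) (sizes A B) ⟩
    1 + sizes A B + sizes (Listᶜ A) Bs + 2 * (1 + size (enc A b)) ∎
    where
    rearrange : ∀ s b B → s + (1 + (1 + b + B) + 1) + b ≡ 1 + B + s + 2 * (1 + b)
    rearrange = solve-∀
  deal≤ : ∀ k bs → sizes (Listᶜ A) (deal k bs) ≤ sizes (Listᶜ A) (replicate k []) + 2 * sizes A bs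
  deal≤ k []       = m≤m+n _ _
  deal≤ k (b ∷ bs) = begin
    sizes (Listᶜ A) (dealTo b (deal k bs))
      ≤⟨ dealTo≤ b (deal k bs) ⟩
    sizes (Listᶜ A) (deal k bs) + 2 * (1 + size (enc A b))
      ≤⟨ +-monoˡ-≤ _ (deal≤ k bs) ⟩
    sizes (Listᶜ A) (replicate k []) + 2 * sizes A bs + 2 * (1 + size (enc A b))
      ≡⟨ rearrange (sizes (Listᶜ A) (replicate k [])) (sizes A bs) (size (enc A b)) ⟩
    sizes (Listᶜ A) (replicate k []) + 2 * sizes A (b ∷ bs) ∎
    where
    rearrange : ∀ k s b → k + 2 * s + 2 * (1 + b) ≡ k + 2 * (1 + b + s)
    rearrange = solve-∀

-- Programs for the elements, the sets and the graph

Elemᶜ Bitᶜ Litᶜ Occᶜ Classᶜ Vertexᶜ : Coded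
Elemᶜ   = ℕᶜ ×ᶜ ℕᶜ ×ᶜ ℕᶜ
Bitᶜ    = Listᶜ Elemᶜ ×ᶜ Listᶜ Elemᶜ
Litᶜ    = Boolᶜ ×ᶜ ℕᶜ
Occᶜ    = ℕᶜ ×ᶜ Litᶜ
Classᶜ  = Boolᶜ ×ᶜ Listᶜ Elemᶜ
Vertexᶜ = ℕᶜ ×ᶜ Boolᶜ ×ᶜ Listᶜ (Elemᶜ ×ᶜ Boolᶜ)

≡ᴱᴾ : {f g : Carrier Γ → Elem} → PolyOn Γ Elemᶜ P f → PolyOn Γ Elemᶜ P g →
      PolyOn Γ Boolᶜ P (λ γ → f γ ≡ᴱ g γ)
≡ᴱᴾ F G = ∧ᴾ (≡ᵇᴾ (proj₁ᴾ ∘ᴾ F) (proj₁ᴾ ∘ᴾ G))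
  (∧ᴾ (≡ᵇᴾ (proj₁ᴾ ∘ᴾ proj₂ᴾ ∘ᴾ F) (proj₁ᴾ ∘ᴾ proj₂ᴾ ∘ᴾ G))
      (≡ᵇᴾ (proj₂ᴾ ∘ᴾ proj₂ᴾ ∘ᴾ F) (proj₂ᴾ ∘ᴾ proj₂ᴾ ∘ᴾ G)))

nubᴾ : Poly (Listᶜ Elemᶜ) (Listᶜ Elemᶜ) nub
nubᴾ = gatherᴾ idᴾ (ifᴾ
  (anyᴾ (proj₂ᴾ ∘ᴾ proj₂ᴾ) (≡ᴱᴾ (proj₁ᴾ ∘ᴾ proj₂ᴾ ∘ᴾ proj₁ᴾ) proj₂ᴾ))
  []ᴾ (proj₁ᴾ ∘ᴾ proj₂ᴾ ∷ᴾ []ᴾ))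

occsᴾ : Poly (Listᶜ (Listᶜ Litᶜ)) (Listᶜ Occᶜ) occs
occsᴾ = gatherᴾ idᴾ (mapᴾ (proj₁ᴾ ∘ᴾ proj₂ᴾ) (lengthᴾ (proj₂ᴾ ∘ᴾ proj₂ᴾ ∘ᴾ proj₁ᴾ) ,ᴾ proj₂ᴾ))

countᴾ : {i : Carrier Γ → ℕ} {os : Carrier Γ → List Occ} →
         PolyOn Γ ℕᶜ P i → PolyOn Γ (Listᶜ Occᶜ) P os →
         PolyOn Γ ℕᶜ P (λ γ → count (i γ) (os γ))
countᴾ I O = closed ∘ᴾ (I ,ᴾ O)
  where
  closed : Poly (ℕᶜ ×ᶜ Listᶜ Occᶜ) ℕᶜ (λ p → count (proj₁ p) (proj₂ p))
  closed = units→ℕ (gatherᴾ proj₂ᴾ (ifᴾ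
    (≡ᵇᴾ (proj₁ᴾ ∘ᴾ proj₁ᴾ) (proj₂ᴾ ∘ᴾ proj₂ᴾ ∘ᴾ proj₁ᴾ ∘ᴾ proj₂ᴾ))
    (nilᴾ {y = tt} refl ∷ᴾ []ᴾ) []ᴾ))

tagᴾ : {b : Carrier Γ → Bool} → PolyOn Γ Boolᶜ P b → PolyOn Γ ℕᶜ P (tag ∘ b)
tagᴾ b = ifᴾ b (numeralᴾ 1) (numeralᴾ 0)

upperᴾ : {i r : Carrier Γ → ℕ} {b : Carrier Γ → Bool} →
         PolyOn Γ ℕᶜ P i → PolyOn Γ ℕᶜ P r → PolyOn Γ Boolᶜ P b →
         PolyOn Γ (Listᶜ Elemᶜ) P (λ γ → upper (i γ) (r γ) (b γ))
upperᴾ I R B = closed ∘ᴾ (I ,ᴾ R ,ᴾ B)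
  where
  closed : Poly (ℕᶜ ×ᶜ ℕᶜ ×ᶜ Boolᶜ) (Listᶜ Elemᶜ)
                (λ p → upper (proj₁ p) (proj₁ (proj₂ p)) (proj₂ (proj₂ p)))
  closed = resp
    (λ { (i , zero , b) _ → refl
       ; (i , suc r , b) _ → cong (λ l → [ (tag b , i , l) ]) (List.length-replicate r) })
    (caseᴾ (ℕ→units (proj₁ᴾ ∘ᴾ proj₂ᴾ)) []ᴾ
      ((tagᴾ (proj₂ᴾ ∘ᴾ proj₂ᴾ ∘ᴾ proj₁ᴾ) ,ᴾ proj₁ᴾ ∘ᴾ proj₁ᴾ ,ᴾ
        units→ℕ (proj₂ᴾ ∘ᴾ proj₂ᴾ)) ∷ᴾ []ᴾ))

coverᴾ : {o : Carrier Γ → Occ} {r : Carrier Γ → ℕ} {b : Carrier Γ → Bool} →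
         PolyOn Γ Occᶜ P o → PolyOn Γ ℕᶜ P r → PolyOn Γ Boolᶜ P b →
         PolyOn Γ (Listᶜ Elemᶜ) P (λ γ → cover (o γ) (r γ) (b γ))
coverᴾ O R B =
  (tagᴾ (notᴾ B) ,ᴾ proj₂ᴾ ∘ᴾ proj₂ᴾ ∘ᴾ O ,ᴾ R) ∷ᴾ
  ++ᴾ (upperᴾ (proj₂ᴾ ∘ᴾ proj₂ᴾ ∘ᴾ O) R B)
      (ifᴾ (≡ᴮᴾ B (proj₁ᴾ ∘ᴾ proj₂ᴾ ∘ᴾ O)) ((numeralᴾ 2 ,ᴾ proj₁ᴾ ∘ᴾ O ,ᴾ numeralᴾ 0) ∷ᴾ []ᴾ) []ᴾ)

occBitsᴾ : Poly (Listᶜ Occᶜ) (Listᶜ Bitᶜ) occBits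
occBitsᴾ = gatherᴾ idᴾ ((coverᴾ (proj₁ᴾ ∘ᴾ proj₂ᴾ) r falseᴾ ,ᴾ coverᴾ (proj₁ᴾ ∘ᴾ proj₂ᴾ) r trueᴾ) ∷ᴾ []ᴾ)
  where
  r : PolyOn (Γ ×ᶜ Occᶜ ×ᶜ Listᶜ Occᶜ) ℕᶜ P _
  r = countᴾ (proj₂ᴾ ∘ᴾ proj₂ᴾ ∘ᴾ proj₁ᴾ ∘ᴾ proj₂ᴾ) (proj₂ᴾ ∘ᴾ proj₂ᴾ)

downFromᴾ : Poly ℕᶜ (Listᶜ ℕᶜ) downFrom
downFromᴾ = resp (λ n _ → tails n)
  (gatherᴾ (ℕ→units idᴾ) (units→ℕ (proj₂ᴾ ∘ᴾ proj₂ᴾ) ∷ᴾ []ᴾ))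
  where
  tails : ∀ n → gather (λ _ us → [ length us ]) (replicate n tt) ≡ downFrom n
  tails zero    = refl
  tails (suc n) = cong₂ _∷_ (List.length-replicate n) (tails n)

bitsᴾ : {v : Carrier Γ → ℕ} {Cs : Carrier Γ → List (List Lit)} →
        PolyOn Γ ℕᶜ P v → PolyOn Γ (Listᶜ (Listᶜ Litᶜ)) P Cs →
        PolyOn Γ (Listᶜ Bitᶜ) P (λ γ → bits (v γ) (Cs γ))
bitsᴾ {Γ = Γ} {P = P} {v = v} {Cs} V C =
  ++ᴾ (mapᴾ {g = λ p → upper (proj₂ p) (r p) false , upper (proj₂ p) (r p) true} (downFromᴾ ∘ᴾ V)
        (upperᴾ proj₂ᴾ rᴾ falseᴾ ,ᴾ upperᴾ proj₂ᴾ rᴾ trueᴾ))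
      (occBitsᴾ ∘ᴾ occsᴾ ∘ᴾ C)
  where
  r : Carrier (Γ ×ᶜ ℕᶜ) → ℕ
  r (γ , i) = count i (occs (Cs γ))
  rᴾ : PolyOn (Γ ×ᶜ ℕᶜ) ℕᶜ (λ p → P (proj₁ p) × proj₂ p ∈ downFrom (v (proj₁ p))) r
  rᴾ = countᴾ proj₂ᴾ (occsᴾ ∘ᴾ compᴾ (λ _ → proj₁) C proj₁ᴾ)

bound-proj₁ : ∀ {Q : Carrier (Γ ×ᶜ A) → Set} {h} → (∀ p → Q p → P (proj₁ p)) → BoundOn Γ P h →
              BoundOn (Γ ×ᶜ A) Q (h ∘ proj₁)
bound-proj₁ Q⇒P b = bound-∘ b Q⇒P (bound-output proj₁ᴾ)

familyᴾ : {Bs : Carrier Γ → List (List Bit)} {few : Carrier Γ → ℕ} →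
          PolyOn Γ (Listᶜ (Listᶜ Bitᶜ)) P Bs → BoundOn Γ P few →
          (∀ γ → P γ → ∀ {B} → B ∈ Bs γ → 2 ^ length B ≤ few γ) →
          PolyOn Γ (Listᶜ (Listᶜ Elemᶜ)) P (family ∘ Bs)
familyᴾ F few 2^≤few = gatherᴾ F (mapᴾ
  (choicesᴾ (proj₁ᴾ ∘ᴾ proj₂ᴾ)
    (bound-≤ (λ { (γ , B , _) (p , B∈) → 2^≤few γ p B∈ }) (bound-proj₁ (λ _ → proj₁) few)))
  ((numeralᴾ 3 ,ᴾ lengthᴾ (proj₂ᴾ ∘ᴾ proj₂ᴾ ∘ᴾ proj₁ᴾ) ,ᴾ numeralᴾ 0) ∷ᴾ concatᴾ proj₂ᴾ))

classesᴾ : Poly (Listᶜ (Listᶜ Elemᶜ)) (Listᶜ Classᶜ) classes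
classesᴾ = ++ᴾ (mapᴾ (nubᴾ ∘ᴾ concatᴾ idᴾ) (trueᴾ ,ᴾ (proj₂ᴾ ∷ᴾ []ᴾ)))
               (mapᴾ idᴾ (falseᴾ ,ᴾ nubᴾ ∘ᴾ proj₂ᴾ))

verticesᴾ : {cs : Carrier Γ → List Class} {few : Carrier Γ → ℕ} →
            PolyOn Γ (Listᶜ Classᶜ) P cs → BoundOn Γ P few →
            (∀ γ → P γ → ∀ {c} → c ∈ cs γ → 2 ^ length (proj₂ c) ≤ few γ) →
            PolyOn Γ (Listᶜ Vertexᶜ) P (vertices ∘ cs)
verticesᴾ F few 2^≤few = gatherᴾ F (mapᴾ
  (choicesᴾ
    (mapᴾ (proj₂ᴾ ∘ᴾ proj₁ᴾ ∘ᴾ proj₂ᴾ) ((proj₂ᴾ ,ᴾ falseᴾ) ,ᴾ (proj₂ᴾ ,ᴾ trueᴾ)))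
    (bound-≤ (λ { (γ , c , _) (p , c∈) →
         ≤-trans (≤-reflexive (cong (2 ^_) (List.length-map _ (proj₂ c)))) (2^≤few γ p c∈) })
      (bound-proj₁ (λ _ → proj₁) few)))
  (lengthᴾ (proj₂ᴾ ∘ᴾ proj₂ᴾ ∘ᴾ proj₁ᴾ) ,ᴾ proj₁ᴾ ∘ᴾ proj₁ᴾ ∘ᴾ proj₂ᴾ ∘ᴾ proj₁ᴾ ,ᴾ proj₂ᴾ))

meetsᴾ : {u v : Carrier Γ → Vertex} → PolyOn Γ Vertexᶜ P u → PolyOn Γ Vertexᶜ P v →
         PolyOn Γ Boolᶜ P (λ γ → meets (u γ) (v γ))
meetsᴾ U V = closed ∘ᴾ (U ,ᴾ V)
  where
  closed : Poly (Vertexᶜ ×ᶜ Vertexᶜ) Boolᶜ (λ p → meets (proj₁ p) (proj₂ p))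
  closed = ∧ᴾ (proj₁ᴾ ∘ᴾ proj₂ᴾ ∘ᴾ proj₁ᴾ) (∧ᴾ (notᴾ (proj₁ᴾ ∘ᴾ proj₂ᴾ ∘ᴾ proj₂ᴾ))
    (anyᴾ (proj₂ᴾ ∘ᴾ proj₂ᴾ ∘ᴾ proj₁ᴾ) (anyᴾ (proj₂ᴾ ∘ᴾ proj₂ᴾ ∘ᴾ proj₂ᴾ ∘ᴾ proj₁ᴾ)
      (∧ᴾ (≡ᴱᴾ (proj₁ᴾ ∘ᴾ proj₂ᴾ ∘ᴾ proj₁ᴾ) (proj₁ᴾ ∘ᴾ proj₂ᴾ))
          (≡ᴮᴾ (proj₂ᴾ ∘ᴾ proj₂ᴾ ∘ᴾ proj₁ᴾ) (proj₂ᴾ ∘ᴾ proj₂ᴾ))))))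

rowsᴾ : Poly (Listᶜ Vertexᶜ) (Listᶜ (ℕᶜ ×ᶜ Listᶜ Boolᶜ)) rows
rowsᴾ = mapᴾ idᴾ (proj₁ᴾ ∘ᴾ proj₂ᴾ ,ᴾ
  mapᴾ proj₁ᴾ (∨ᴾ (meetsᴾ (proj₂ᴾ ∘ᴾ proj₁ᴾ) proj₂ᴾ) (meetsᴾ proj₂ᴾ (proj₂ᴾ ∘ᴾ proj₁ᴾ))))

encodeList-cong : ∀ {f g : X → Tree} → (∀ x → f x ≡ g x) → ∀ xs → encodeList f xs ≡ encodeList g xs
encodeList-cong f≡g []       = refl
encodeList-cong f≡g (x ∷ xs) = cong₂ _•_ (f≡g x) (encodeList-cong f≡g xs)

encodeList-map : ∀ {f : Y → Tree} (g : X → Y) xs → encodeList f (map g xs) ≡ encodeList (f ∘ g) xs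
encodeList-map     g []       = refl
encodeList-map {f = f} g (x ∷ xs) = cong (f (g x) •_) (encodeList-map g xs)

encodeList-lookup : ∀ (f : X → Tree) xs →
                    encodeList (f ∘ lookup xs) (allFin (length xs)) ≡ encodeList f xs
encodeList-lookup f xs = begin
  encodeList (f ∘ lookup xs) (allFin (length xs))  ≡⟨ encodeList-map (lookup xs) (allFin (length xs)) ⟨
  encodeList f (map (lookup xs) (allFin _))        ≡⟨ cong (encodeList f) (List.map-tabulate id (lookup xs)) ⟩
  encodeList f (tabulate (lookup xs))              ≡⟨ cong (encodeList f) (List.tabulate-lookup xs) ⟩
  encodeList f xs                                  ∎
  where open ≡-Reasoning

encode-rows : ∀ vs → encodeGraph (graph vs) ≡ enc (Listᶜ (ℕᶜ ×ᶜ Listᶜ Boolᶜ)) (rows vs)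
encode-rows vs = begin
  encodeList (row′ ∘ lookup vs) (allFin (length vs))  ≡⟨ encodeList-lookup row′ vs ⟩
  encodeList row′ vs                                  ≡⟨ encodeList-cong row≡ vs ⟩
  encodeList (code ∘ row) vs                          ≡⟨ encodeList-map row vs ⟨
  encodeList code (rows vs)                           ∎
  where
  open ≡-Reasoning
  code : ℕ × List Bool → Tree
  code = enc (ℕᶜ ×ᶜ Listᶜ Boolᶜ)
  row : Vertex → ℕ × List Bool
  row u = colour u , map (adj u) vs
  row′ : Vertex → Tree
  row′ u = encodeℕ (colour u) •
           encodeList (λ v → encodeBool (adj u (lookup vs v))) (allFin (length vs))
  row≡ : ∀ u → row′ u ≡ code (row u)
  row≡ u = cong (encodeℕ (colour u) •_)
    (trans (encodeList-lookup (λ v → encodeBool (adj u v)) vs) (sym (encodeList-map (adj u) vs)))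

-- Sizes of the sets and the reduction on raw data

node-of-bit : ∀ {v Cs b} → b ∈ bits v Cs → ∃ λ nm → Node v Cs (nm , b)
node-of-bit {v} {Cs} b∈ with (nm , b) , n∈ , refl ← ∈-map⁻ proj₂ (subst (_ ∈_) (bits≡nodes v Cs) b∈) =
  nm , ∈-nodes⁻ v Cs n∈

raised-tag : ∀ {i b r e} → UpperView i b r e → proj₁ e ≤ 2
raised-tag {b = b} raised = m≤n⇒m≤1+n (tag≤1 b)

bits-tags : ∀ {v Cs b e} → b ∈ bits v Cs → mentions b e → proj₁ e ≤ 2
bits-tags {v} {Cs} b∈ m with node-of-bit {v} {Cs} b∈
... | _ , var {i} _ with b , e∈ ← mentions-map {f = upper i (count i (occs Cs))} m
  = raised-tag (∈-upper⁻ (count i (occs Cs)) e∈)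
bits-tags {v} {Cs} b∈ m | _ , occ {o} {os} _
  with b , e∈ ← mentions-map {f = cover o (count (variable-of o) os)} m
  with ∈-cover⁻ o (count (variable-of o) os) b e∈
... | own      = m≤n⇒m≤1+n (tag≤1 _)
... | linked u = raised-tag u
... | clause   = ≤-refl

Small : Bit → Set
Small (p , q) = length p ≤ 3 × length q ≤ 3

length-upper : ∀ i r b → length (upper i r b) ≤ 1
length-upper i zero    b = z≤n
length-upper i (suc r) b = ≤-refl

length-cover : ∀ o r b → length (cover o r b) ≤ 3
length-cover (c , s , i) r b = s≤s (≤-trans (≤-reflexive (List.length-++ (upper i r b)))
  (+-mono-≤ (length-upper i r b) (length-cond (b ≡ᴮ s))))
  where
  length-cond : ∀ t → length (cond t [ (2 , c , 0) ] []) ≤ 1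
  length-cond false = z≤n
  length-cond true  = ≤-refl

bits-small : ∀ {v Cs b} → b ∈ bits v Cs → Small b
bits-small {v} {Cs} b∈ with node-of-bit {v} {Cs} b∈
... | _ , var {i} _ = let r = count i (occs Cs) in
  ≤-trans (length-upper i r false) (s≤s z≤n) , ≤-trans (length-upper i r true) (s≤s z≤n)
... | _ , occ {o} {os} _ = let r = count (variable-of o) os in
  length-cover o r false , length-cover o r true

length-chosen : ∀ {bs ls} → Chosen bs ls → (∀ {b} → b ∈ bs → Small b) → length (concat ls) ≤ 3 * length bs
length-chosen                         []       small = z≤n
length-chosen {bs = b ∷ bs} {l ∷ ls} (c ∷ cs) small = begin
  length (l ++ concat ls)         ≡⟨ List.length-++ l ⟩
  length l + length (concat ls)   ≤⟨ +-mono-≤ (head c (small (here refl))) (length-chosen cs (small ∘ there)) ⟩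
  3 + 3 * length bs               ≡⟨ *-suc 3 (length bs) ⟨
  3 * length (b ∷ bs)             ∎
  where
  open ≤-Reasoning
  head : ∀ {b l} → l ≡ proj₁ b ⊎ l ≡ proj₂ b → Small b → length l ≤ 3
  head (inj₁ refl) = proj₁
  head (inj₂ refl) = proj₂

-- The summand 2 serves the pairs. A set for a block `B` has one selector and at most three elements
-- per bit, hence at most `2 * 2 ^ (3 * length B)` assignments, where `2 ^ length B ≤ 2 * n`.
few : ℕ → ℕ
few n = 2 + 2 * (2 * n) ^ 3

length-occs : ∀ Cs → length (occs Cs) ≡ length (concat Cs)
length-occs []       = refl
length-occs (C ∷ Cs) = trans (List.length-++ (map (length Cs ,_) C))
  (trans (cong₂ _+_ (List.length-map _ C) (length-occs Cs)) (sym (List.length-++ C)))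

-- For a 3CNF this is exactly `formulaSize`, so the size bound of a Mini-3SAT instance applies to
-- the bits without loss.
length-bits : ∀ v Cs → length (bits v Cs) ≡ v + length (concat Cs)
length-bits v Cs = trans (List.length-++ (varBits v (occs Cs))) (cong₂ _+_
  (trans (List.length-map _ (downFrom v)) (List.length-downFrom v))
  (trans (length-occBits (occs Cs)) (length-occs Cs)))
  where
  length-occBits : ∀ os → length (occBits os) ≡ length os
  length-occBits []       = refl
  length-occBits (o ∷ os) = cong suc (length-occBits os)

module _ (v : ℕ) (Cs : List (List Lit)) (n k : ℕ) where

  blocks : List (List Bit)
  blocks = deal k (bits v Cs)

  sets-of : List (List Elem)
  sets-of = family blocks

  graphVertices : List Vertex
  graphVertices = vertices (classes sets-of)

  Logarithmic : Set
  Logarithmic = 2 ^ length (bits v Cs) ≤ n ^ k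

  module _ (log : Logarithmic) where

    block-∈-bits : ∀ {B b} → B ∈ blocks → b ∈ B → b ∈ bits v Cs
    block-∈-bits B∈ b∈ = ∈-resp-↭ (deal-↭ {n = n} {k} (bits v Cs) log) (∈-concat⁺′ b∈ B∈)

    block-tags : ∀ {B b e} → B ∈ blocks → b ∈ B → mentions b e → proj₁ e ≤ 2
    block-tags B∈ b∈ = bits-tags {v} {Cs} (block-∈-bits B∈ b∈)

    block-few : ∀ {B} → B ∈ blocks → 2 ^ length B ≤ 2 * n
    block-few = deal-small {n = n} {k} (bits v Cs) log

    class-few : ∀ {c} → c ∈ classes sets-of → 2 ^ length (proj₂ c) ≤ few n
    class-few c∈ with ∈-++⁻ (map (λ e → true , [ e ]) (elements sets-of)) c∈
    ... | inj₁ c∈ with _ , _ , refl ← ∈-map⁻ _ c∈ = m≤m+n 2 _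
    ... | inj₂ c∈ with U , U∈ , refl ← ∈-map⁻ _ c∈ with ∈-family⁻ blocks block-tags U∈
    ...   | blockSet {B} {Bs′} {ls} t c = begin
      2 ^ length (nub U)            ≤⟨ ^-monoʳ-≤ 2 (length-nub U) ⟩
      2 * 2 ^ length (concat ls)    ≤⟨ *-monoʳ-≤ 2 (^-monoʳ-≤ 2 (length-chosen c
                                         (λ b∈ → bits-small {v} {Cs} (block-∈-bits (Tail⇒∈ t) b∈)))) ⟩
      2 * 2 ^ (3 * length B)        ≡⟨ cong (λ m → 2 * 2 ^ m) (*-comm 3 (length B)) ⟩
      2 * 2 ^ (length B * 3)        ≡⟨ cong (2 *_) (^-*-assoc 2 (length B) 3) ⟨
      2 * (2 ^ length B) ^ 3        ≤⟨ *-monoʳ-≤ 2 (^-monoˡ-≤ 3 (block-few (Tail⇒∈ t))) ⟩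
      2 * (2 * n) ^ 3               ≤⟨ m≤n+m _ 2 ⟩
      few n                         ∎
      where open ≤-Reasoning

    blocks-elementary : Elementary2Group (Aut (graph graphVertices))
    blocks-elementary = elementary (els-unique blocks block-tags) (sets blocks block-tags)

    coverable⇔rigid : Coverable (bits v Cs) ⇔ Rigid (graph graphVertices) k
    coverable⇔rigid = mk⇔
      (λ cov → let S , ∣S∣ , sup = coverable⇒supporting blocks block-tags
                     (Coverable-↭ (↭-sym (deal-↭ {n = n} {k} (bits v Cs) log)) cov)
               in S , trans ∣S∣ (length-deal k (bits v Cs)) ,
                  supported⇒rigid (els-unique blocks block-tags) (sets blocks block-tags) S sup)
      (λ (S , ∣S∣ , rig) → Coverable-↭ (deal-↭ {n = n} {k} (bits v Cs) log)
        (supporting⇒coverable blocks block-tags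
          (S , trans ∣S∣ (sym (length-deal k (bits v Cs))) ,
           rigid⇒supported (els-unique blocks block-tags) (sets blocks block-tags) S rig)))

Rawᶜ : Coded
Rawᶜ = ((ℕᶜ ×ᶜ Listᶜ (Listᶜ Litᶜ)) ×ᶜ ℕᶜ) ×ᶜ ℕᶜ

Promise : Carrier Rawᶜ → Set
Promise (((v , Cs) , n) , k) = Logarithmic v Cs n k

-- abstract because the exponent is a closed numeral too large to normalise.
abstract
  reductionᴾ : PolyOn Rawᶜ (Listᶜ (ℕᶜ ×ᶜ Listᶜ Boolᶜ) ×ᶜ ℕᶜ) Promise
               (λ { (((v , Cs) , n) , k) → rows (graphVertices v Cs n k) , k })
  reductionᴾ =
    rowsᴾ ∘ᴾ verticesᴾ (classesᴾ ∘ᴾ familyᴾ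
        (dealᴾ proj₂ᴾ (bitsᴾ (proj₁ᴾ ∘ᴾ proj₁ᴾ ∘ᴾ proj₁ᴾ) (proj₂ᴾ ∘ᴾ proj₁ᴾ ∘ᴾ proj₁ᴾ)))
        (bound-const 2 ⊗ bound-n)
        (λ { (((v , Cs) , n) , k) log B∈ → block-few v Cs n k log B∈ }))
      (bound-const 2 ⊕ bound-const 2 ⊗ bound-^ 3 (bound-const 2 ⊗ bound-n))
      (λ { (((v , Cs) , n) , k) log c∈ → class-few v Cs n k log c∈ }) ,ᴾ proj₂ᴾ
    where
    -- Here the unary encoding of `n` enters: a bound polynomial in `n` is polynomial in the size of
    -- the input.
    bound-n : BoundOn Rawᶜ Promise (λ r → proj₂ (proj₁ r))
    bound-n = bound-≤ (λ { ((_ , n) , _) _ → ≤-trans (m≤n*m n 2)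
        (≤-trans (n≤1+n _) (≤-reflexive (sym (size-encodeℕ n)))) })
      (bound-output (proj₂ᴾ ∘ᴾ proj₁ᴾ))

-- Mini-3SAT instances

literal : ∀ {v} → Literal v → Lit
literal (b , i) = b , toℕ i

clauseLiterals : ∀ {v} → Clause v → List Lit
clauseLiterals C = map literal (toList C)

formulaClauses : 3CNF → List (List Lit)
formulaClauses F = map clauseLiterals (3CNF.clauses F)

length-clauseLiterals : ∀ {v} (C : Clause v) → length (clauseLiterals C) ≡ 3
length-clauseLiterals C = trans (List.length-map literal (toList C)) (Vec.length-toList C)

length-formulaClauses : ∀ {v} (Ds : List (Clause v)) → length (concat (map clauseLiterals Ds)) ≡ 3 * length Ds
length-formulaClauses []       = refl
length-formulaClauses (C ∷ Ds) = trans (List.length-++ (clauseLiterals C))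
  (trans (cong₂ _+_ (length-clauseLiterals C) (length-formulaClauses Ds)) (sym (*-suc 3 (length Ds))))

Any⇒∈ : ∀ {P : X → Set} {n} {xs : Vec X n} → VecAny.Any P xs → ∃ λ x → x ∈ toList xs × P x
Any⇒∈ (VecAny.here p)   = _ , here refl , p
Any⇒∈ (VecAny.there ps) = let x , x∈ , p = Any⇒∈ ps in x , there x∈ , p

∈⇒Any : ∀ {P : X → Set} {n x} (xs : Vec X n) → x ∈ toList xs → P x → VecAny.Any P xs
∈⇒Any (_ ∷ _)  (here refl) p = VecAny.here p
∈⇒Any (_ ∷ xs) (there x∈)  p = VecAny.there (∈⇒Any xs x∈ p)

module _ (F : 3CNF) where

  open 3CNF F

  satisfiable⇔coverable : Satisfiable ⇔ Coverable (bits vars (formulaClauses F))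
  satisfiable⇔coverable = mk⇔
    (λ (α , sat) → satisfiable⇒coverable {vars} {formulaClauses F} variables<vars (total α) (satisfies α sat))
    (λ cov → let α , sat = coverable⇒satisfiable {vars} {formulaClauses F} nonempty cov in
      α ∘ toℕ , All.tabulate λ {C} C∈ → satisfied α C (sat (∈-map⁺ clauseLiterals C∈)))
    where
    total : (Fin vars → Bool) → ℕ → Bool
    total α i with i <? vars
    ... | yes i<v = α (fromℕ< i<v)
    ... | no _    = false
    total-toℕ : ∀ α i → total α (toℕ i) ≡ α i
    total-toℕ α i with toℕ i <? vars
    ... | yes i<v = cong α (Fin.fromℕ<-toℕ i i<v)
    ... | no i≮v  = contradiction (Fin.toℕ<n i) i≮v
    satisfies : ∀ α → All (VecAny.Any (λ ℓ → α (proj₂ ℓ) ≡ proj₁ ℓ)) clauses →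
                Satisfies vars (formulaClauses F) (total α)
    satisfies α sat C∈ with C , C∈ , refl ← ∈-map⁻ clauseLiterals C∈
      with (s , i) , l∈ , eq ← Any⇒∈ (All.lookup sat C∈) =
      s , toℕ i , ∈-map⁺ literal l∈ , trans (total-toℕ α i) eq
    satisfied : ∀ α (C : Clause vars) → ∃₂ (λ s i → (s , i) ∈ clauseLiterals C × α i ≡ s) →
                VecAny.Any (λ ℓ → α (toℕ (proj₂ ℓ)) ≡ proj₁ ℓ) C
    satisfied α C (s , i , l∈ , eq) with (s , i) , ℓ∈ , refl ← ∈-map⁻ literal l∈ = ∈⇒Any C ℓ∈ eq
    variables<vars : ∀ {o} → o ∈ occs (formulaClauses F) → variable-of o < vars
    variables<vars o∈ with _ , t ← ∈⇒Tail o∈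
      with C , _ , t′ , _ , l∈ ← ∈-occs⁻ (formulaClauses F) t
      with D , _ , refl ← ∈-map⁻ clauseLiterals (Tail⇒∈ t′)
      with (_ , i) , _ , refl ← ∈-map⁻ literal l∈ = Fin.toℕ<n i
    nonempty : ∀ {C} → C ∈ formulaClauses F → 0 < length C
    nonempty C∈ with C , _ , refl ← ∈-map⁻ clauseLiterals C∈ =
      subst (0 <_) (sym (length-clauseLiterals C)) (s≤s z≤n)

module _ (x : Mini3SATInstance) where

  open Mini3SATInstance x
  open 3CNF formula using (vars; clauses)

  raw : Carrier Rawᶜ
  raw = ((vars , formulaClauses formula) , n) , k

  enc-raw : enc Rawᶜ raw ≡ ParameterizedProblem.input Mini-3SAT x
  enc-raw = cong (λ Cs → ((encodeℕ vars • Cs) • encodeℕ n) • encodeℕ k)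
    (trans (encodeList-map clauseLiterals clauses)
      (encodeList-cong (λ C → encodeList-map literal (toList C)) clauses))

  promise : Promise raw
  promise = subst (λ s → 2 ^ s ≤ n ^ k)
    (sym (trans (length-bits vars (formulaClauses formula))
                (cong (vars +_) (length-formulaClauses clauses)))) small

  rigidGraph : ColoredGraph
  rigidGraph = graph (graphVertices vars (formulaClauses formula) n k)

  rigidGraph-elementary : Elementary2Group (Aut rigidGraph)
  rigidGraph-elementary = blocks-elementary vars (formulaClauses formula) n k promise

  rigidGraph-correct : 3CNF.Satisfiable formula ⇔ Rigid rigidGraph k
  rigidGraph-correct = mk⇔
    (to (coverable⇔rigid vars (formulaClauses formula) n k promise) ∘ to (satisfiable⇔coverable formula))
    (from (satisfiable⇔coverable formula) ∘ from (coverable⇔rigid vars (formulaClauses formula) n k promise))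
    where open Equivalence

  rigidGraph-runs : PolyOn.program reductionᴾ ⊢ ParameterizedProblem.input Mini-3SAT x ⇓
                    encodeGraph rigidGraph • encodeℕ k within PolyOn.time reductionᴾ raw
  rigidGraph-runs = subst₂ (λ i o → PolyOn.program reductionᴾ ⊢ i ⇓ o within PolyOn.time reductionᴾ raw)
    enc-raw (cong (_• encodeℕ k) (sym (encode-rows (graphVertices vars (formulaClauses formula) n k))))
    (PolyOn.runs reductionᴾ raw promise)

-- Composition of reductions

*ᴾ : ∀ {Γ P} {f g : Carrier Γ → ℕ} → PolyOn Γ ℕᶜ P f → PolyOn Γ ℕᶜ P g →
     PolyOn Γ ℕᶜ P (λ γ → f γ * g γ)
*ᴾ {f = f} {g} F G = resp (λ γ _ → length-gather (f γ) (g γ))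
  (units→ℕ (gatherᴾ (ℕ→units F) (ℕ→units (compᴾ (λ _ → proj₁) G proj₁ᴾ))))
  where
  length-gather : ∀ m n → length (gather (λ _ _ → replicate n tt) (replicate m tt)) ≡ m * n
  length-gather zero    n = refl
  length-gather (suc m) n = trans (List.length-++ (replicate n tt))
    (cong₂ _+_ (List.length-replicate n) (length-gather m n))

sucᴾ : ∀ {Γ P} {f : Carrier Γ → ℕ} → PolyOn Γ ℕᶜ P f → PolyOn Γ ℕᶜ P (suc ∘ f)
sucᴾ {f = f} F = resp (λ γ _ → cong suc (List.length-replicate (f γ)))
  (units→ℕ (nilᴾ {y = tt} refl ∷ᴾ ℕ→units F))

^ᴾ : ∀ {Γ P} {f : Carrier Γ → ℕ} → PolyOn Γ ℕᶜ P f → ∀ n → PolyOn Γ ℕᶜ P (λ γ → f γ ^ n)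
^ᴾ F zero    = numeralᴾ 1
^ᴾ F (suc n) = *ᴾ F (^ᴾ F n)

computable-∘ : ∀ {f g : ℕ → ℕ} → Poly ℕᶜ ℕᶜ g → Computable f → Computable (g ∘ f)
computable-∘ {f} G (p , runs) = (p ⨾ PolyOn.program G) , λ n →
  let s , r = runs n
      t , q , _ = PolyOn.runs G (f n) tt
  in s + t , seq r q

^-distribʳ-* : ∀ n a b → (a * b) ^ n ≡ a ^ n * b ^ n
^-distribʳ-* zero    a b = refl
^-distribʳ-* (suc n) a b = trans (cong (a * b *_) (^-distribʳ-* n a b)) ([m*n]*[o*p]≡[m*o]*[n*p] a b _ _)

-- Here `a` stands for the factor depending on the parameter and `s` for the input size. A fixed
-- power of `a * s ^ c` again splits into a function of the parameter times a power of the size.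
compose-time : ∀ a s c d t₁ t₂ → 1 ≤ s → t₁ ≤ a * s ^ c → t₂ ≤ suc t₁ ^ d →
               t₁ + t₂ ≤ suc a ^ suc d * s ^ (c * suc d)
compose-time a s@(suc _) c d t₁ t₂ 1≤s t₁≤ t₂≤ = begin
  t₁ + t₂                              ≤⟨ +-mono-≤ (m≤m*n t₁ (suc t₁ ^ d) {{m^n≢0 (suc t₁) d}}) t₂≤ ⟩
  t₁ * suc t₁ ^ d + suc t₁ ^ d         ≡⟨ +-comm (t₁ * suc t₁ ^ d) _ ⟩
  -- The successor is paid for by one more `s ^ c`, turning `a` into `suc a`.
  suc t₁ ^ suc d                       ≤⟨ ^-monoˡ-≤ (suc d) (+-mono-≤ (m^n>0 s c) t₁≤) ⟩
  (suc a * s ^ c) ^ suc d              ≡⟨ ^-distribʳ-* (suc d) (suc a) (s ^ c) ⟩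
  suc a ^ suc d * (s ^ c) ^ suc d      ≡⟨ cong (suc a ^ suc d *_) (^-*-assoc s c (suc d)) ⟩
  suc a ^ suc d * s ^ (c * suc d)      ∎
  where open ≤-Reasoning

-- Membership of `Q` in the class is itself a reduction to Mini-3SAT, so it suffices to append the
-- one reduction to graphs. That reduction is polynomial and leaves the parameter as it is, hence
-- the parameter bound `R.g` is inherited.
theorem2p6 : MINI[1]-Hard (k-Rigid restrictedTo (λ x → Elementary2Group (Aut (proj₁ x))))
theorem2p6 Q Q≤ = record
  { reduce          = λ x → (rigidGraph (R.reduce x) , Mini3SATInstance.k (R.reduce x)) ,
                            rigidGraph-elementary (R.reduce x)
  ; correct         = λ x → mk⇔
      (Equivalence.to (rigidGraph-correct (R.reduce x)) ∘ Equivalence.to (R.correct x))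
      (Equivalence.from (R.correct x) ∘ Equivalence.from (rigidGraph-correct (R.reduce x)))
  ; program         = R.program ⨾ PolyOn.program reductionᴾ
  ; f               = λ k → suc (R.f k) ^ suc d
  ; g               = R.g
  ; c               = R.c * suc d
  ; f-computable    = computable-∘ (^ᴾ (sucᴾ idᴾ) (suc d)) R.f-computable
  ; g-computable    = R.g-computable
  ; computes        = λ x →
      let t₁ , r₁ , t₁≤ = R.computes x
          t₂ , r₂ , t₂≤ = rigidGraph-runs (R.reduce x)
      in t₁ + t₂ , seq r₁ r₂ ,
         compose-time (R.f (Q.parameter x)) (Q.∥ x ∥) R.c d t₁ t₂ (1≤size (Q.code x)) t₁≤
           (≤-trans t₂≤ (≤-trans
             (BoundOn.bounded (PolyOn.time≤ reductionᴾ) (raw (R.reduce x)) (promise (R.reduce x)))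
             (^-monoˡ-≤ d (s≤s (≤-trans (≤-reflexive (cong size (enc-raw (R.reduce x)))) (output≤time r₁))))))
  ; parameter-bound = R.parameter-bound
  }
  where
  module Q = ParameterizedProblem Q
  module R = _≤fpt_ Q≤
  d : ℕ
  d = BoundOn.degree (PolyOn.time≤ reductionᴾ)
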